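{- Let $c > 0$ be a constant. There exists a constant $K = K(c) > 0$ such that for every $n$ and every cross-intersecting pair of families $\mathcal{A}, \mathcal{B} \subset S_n$ with $\sqrt{|\mathcal{A}||\mathcal{B}|} \geq c(n-1)!$, there exist $i, j \in [n]$ such that \[|\{\sigma \in \mathcal{A} : \sigma(i) \neq j\}| \leq K(n-2)! \quad\text{and}\quad |\{\sigma \in \mathcal{B} : \sigma(i) \neq j\}| \leq K(n-2)!,\] i.e. all but at most $O((n-2)!)$ permutations in $\mathcal{A}$ and all but at most $O((n-2)!)$ permutations in $\mathcal{B}$ map $i$ to $j$.
   Context: $S_n$ is the symmetric group on $[n]=\{1,\ldots,n\}$. A pair of families $\mathcal{A},\mathcal{B} \subset S_n$ is cross-intersecting if for every $\sigma \in \mathcal{A}$ and every $\tau \in \mathcal{B}$ there is some $i \in [n]$ with $\sigma(i) = \tau(i)$. The $O(\cdot)$ is as $n\to\infty$ with $c$ fixed. -}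

module Defs where

open import Data.Fin.Base using (Fin)
open import Data.Fin.Permutation using (Permutation′; _⟨$⟩ʳ_; _≈_)
open import Data.Fin.Properties using (_≟_)
open import Data.Integer.Base using (+_)
open import Data.List.Base using (List; length; filter)
open import Data.Nat.Base as ℕ using (ℕ)
open import Data.Nat.Properties using (_!≢0)
open import Data.Product.Base using (∃; ∃-syntax; _×_; _,_)
open import Data.Rational.Base as ℚ using (ℚ; 0ℚ; 1ℚ; _÷_; 1/_)
import Data.Rational.Properties as ℚ
open import Data.Sum.Base using (_⊎_; inj₁; inj₂)
open import Level using (0ℓ)
open import Relation.Binary.Bundles using (Setoid)
open import Relation.Binary.PropositionalEquality using (_≡_; refl; sym; trans; cong; subst)
open import Relation.Nullary using (¬_; yes; no)
open import Relation.Nullary.Decidable using (¬?)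
import Data.List.Membership.Setoid as Membership
import Data.List.Relation.Unary.Unique.Setoid as Unique

-- Real numbers as (two-sided, located) Dedekind cuts of ℚ:
-- Lower q means q < x and Upper q means x < q.

record ℝ : Set₁ where
  field
    Lower Upper     : ℚ → Set
    lower-inhabited : ∃ Lower
    upper-inhabited : ∃ Upper
    lower-closed    : ∀ {p q} → p ℚ.< q → Lower q → Lower p
    upper-closed    : ∀ {p q} → p ℚ.< q → Upper p → Upper q
    lower-open      : ∀ {p} → Lower p → ∃[ q ] p ℚ.< q × Lower q
    upper-open      : ∀ {q} → Upper q → ∃[ p ] p ℚ.< q × Upper p
    disjoint        : ∀ {q} → Lower q → ¬ Upper q
    located         : ∀ {p q} → p ℚ.< q → Lower p ⊎ Upper q

open ℝ

infix 4 _<ᵣ_ _≤ᵣ_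

_<ᵣ_ : ℝ → ℝ → Set
x <ᵣ y = ∃[ q ] Upper x q × Lower y q

_≤ᵣ_ : ℝ → ℝ → Set
x ≤ᵣ y = ∀ {q} → Lower x q → Lower y q

ℕ→ℚ : ℕ → ℚ
ℕ→ℚ m = + m ℚ./ 1

private
  0≤ℕ→ℚ : ∀ m → 0ℚ ℚ.≤ ℕ→ℚ m
  0≤ℕ→ℚ m = ℚ.nonNegative⁻¹ (ℕ→ℚ m) {{ℚ.normalize-nonNeg m 1}}

  p-1<p : ∀ p → p ℚ.- 1ℚ ℚ.< p
  p-1<p p = subst (p ℚ.- 1ℚ ℚ.<_) (ℚ.+-identityʳ p) (ℚ.+-monoʳ-< p (ℚ.negative⁻¹ (ℚ.- 1ℚ)))

  p<p+1 : ∀ p → p ℚ.< p ℚ.+ 1ℚ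
  p<p+1 p = subst (ℚ._< p ℚ.+ 1ℚ) (ℚ.+-identityʳ p) (ℚ.+-monoʳ-< p (ℚ.positive⁻¹ 1ℚ))

ℚ→ℝ : ℚ → ℝ
ℚ→ℝ x = record
  { Lower           = ℚ._< x
  ; Upper           = x ℚ.<_
  ; lower-inhabited = x ℚ.- 1ℚ , p-1<p x
  ; upper-inhabited = x ℚ.+ 1ℚ , p<p+1 x
  ; lower-closed    = ℚ.<-trans
  ; upper-closed    = λ p<q x<p → ℚ.<-trans x<p p<q
  ; lower-open      = λ p<x → let (m , p<m , m<x) = ℚ.<-dense p<x in m , p<m , m<x
  ; upper-open      = λ x<q → let (m , x<m , m<q) = ℚ.<-dense x<q in m , m<q , x<m
  ; disjoint        = ℚ.<-asym
  ; located         = loc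
  }
  where
  loc : ∀ {p q} → p ℚ.< q → p ℚ.< x ⊎ x ℚ.< q
  loc {p} p<q with p ℚ.<? x
  ... | yes p<x = inj₁ p<x
  ... | no  p≮x = inj₂ (ℚ.≤-<-trans (ℚ.≮⇒≥ p≮x) p<q)

ℕ→ℝ : ℕ → ℝ
ℕ→ℝ m = ℚ→ℝ (ℕ→ℚ m)

0ℝ : ℝ
0ℝ = ℚ→ℝ 0ℚ

-- The product of x and a positive natural number k:  q < x · k  iff  q ÷ k < x.

infixl 7 _·_

_·_ : ℝ → (k : ℕ) → .{{ℕ.NonZero k}} → ℝ
x · k = record
  { Lower           = λ q → Lower x (q ÷ r)
  ; Upper           = λ q → Upper x (q ÷ r)
  ; lower-inhabited = let (q , l) = lower-inhabited x in q ℚ.* r , subst (Lower x) (back q) l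
  ; upper-inhabited = let (q , u) = upper-inhabited x in q ℚ.* r , subst (Upper x) (back q) u
  ; lower-closed    = λ p<q → lower-closed x (÷-mono p<q)
  ; upper-closed    = λ p<q → upper-closed x (÷-mono p<q)
  ; lower-open      = λ {p} l → let (q , p<q , l′) = lower-open x l in
                        q ℚ.* r , ÷-cancel (subst (p ÷ r ℚ.<_) (back q) p<q) , subst (Lower x) (back q) l′
  ; upper-open      = λ {q} u → let (p , p<q , u′) = upper-open x u in
                        p ℚ.* r , ÷-cancel (subst (ℚ._< q ÷ r) (back p) p<q) , subst (Upper x) (back p) u′
  ; disjoint        = disjoint x
  ; located         = λ p<q → located x (÷-mono p<q)
  }
  where
  r : ℚ
  r = ℕ→ℚ k

  instance
    r-pos : ℚ.Positive r
    r-pos = ℚ.normalize-pos k 1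

    r-nonZero : ℚ.NonZero r
    r-nonZero = ℚ.pos⇒nonZero r

    1/r-pos : ℚ.Positive (1/ r)
    1/r-pos = ℚ.1/pos⇒pos r

    1/r-nonNeg : ℚ.NonNegative (1/ r)
    1/r-nonNeg = ℚ.pos⇒nonNeg (1/ r)

  back : ∀ q → q ≡ (q ℚ.* r) ÷ r
  back q = sym (trans (ℚ.*-assoc q r (1/ r))
                      (trans (cong (q ℚ.*_) (ℚ.*-inverseʳ r)) (ℚ.*-identityʳ q)))

  ÷-mono : ∀ {p q} → p ℚ.< q → p ÷ r ℚ.< q ÷ r
  ÷-mono = ℚ.*-monoˡ-<-pos (1/ r)

  ÷-cancel : ∀ {p q} → p ÷ r ℚ.< q ÷ r → p ℚ.< q
  ÷-cancel = ℚ.*-cancelʳ-<-nonNeg (1/ r)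

-- √ m is the supremum of the rationals r with r² ≤ m and the infimum of the
-- non-negative rationals r with m ≤ r².

√ : ℕ → ℝ
√ m = record
  { Lower           = L
  ; Upper           = U
  ; lower-inhabited = 0ℚ ℚ.- 1ℚ , 0ℚ , p-1<p 0ℚ , 0≤ℕ→ℚ m
  ; upper-inhabited = s ℚ.+ 1ℚ , s , p<p+1 s , 0≤s , m≤s²
  ; lower-closed    = λ { p<q (r , q<r , h) → r , ℚ.<-trans p<q q<r , h }
  ; upper-closed    = λ { p<q (r , r<p , h) → r , ℚ.<-trans r<p p<q , h }
  ; lower-open      = λ { (r , p<r , h) → let (t , p<t , t<r) = ℚ.<-dense p<r in
                          t , p<t , r , t<r , h }
  ; upper-open      = λ { (r , r<q , h) → let (t , r<t , t<q) = ℚ.<-dense r<q in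
                          t , t<q , r , r<t , h }
  ; disjoint        = dis
  ; located         = loc
  }
  where
  L U : ℚ → Set
  L q = ∃[ r ] q ℚ.< r × r ℚ.* r ℚ.≤ ℕ→ℚ m
  U q = ∃[ r ] r ℚ.< q × 0ℚ ℚ.≤ r × ℕ→ℚ m ℚ.≤ r ℚ.* r

  s : ℚ
  s = ℕ→ℚ m ℚ.+ 1ℚ

  m≤s : ℕ→ℚ m ℚ.≤ s
  m≤s = ℚ.<⇒≤ (p<p+1 (ℕ→ℚ m))

  0≤s : 0ℚ ℚ.≤ s
  0≤s = ℚ.≤-trans (0≤ℕ→ℚ m) m≤s

  1≤s : 1ℚ ℚ.≤ s
  1≤s = subst (ℚ._≤ s) (ℚ.+-identityˡ 1ℚ) (ℚ.+-monoˡ-≤ 1ℚ (0≤ℕ→ℚ m))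

  m≤s² : ℕ→ℚ m ℚ.≤ s ℚ.* s
  m≤s² = ℚ.≤-trans m≤s
    (subst (ℚ._≤ s ℚ.* s) (ℚ.*-identityʳ s) (ℚ.*-monoˡ-≤-nonNeg s {{ℚ.nonNegative 0≤s}} 1≤s))

  dis : ∀ {q} → L q → ¬ U q
  dis {q} (r , q<r , r²≤m) (t , t<q , 0≤t , m≤t²) = ℚ.<-irrefl refl
    (ℚ.<-≤-trans (ℚ.≤-<-trans t²≤tr tr<r²) (ℚ.≤-trans r²≤m m≤t²))
    where
    t<r : t ℚ.< r
    t<r = ℚ.<-trans t<q q<r
    t²≤tr : t ℚ.* t ℚ.≤ t ℚ.* r
    t²≤tr = ℚ.*-monoˡ-≤-nonNeg t {{ℚ.nonNegative 0≤t}} (ℚ.<⇒≤ t<r)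
    tr<r² : t ℚ.* r ℚ.< r ℚ.* r
    tr<r² = ℚ.*-monoˡ-<-pos r {{ℚ.positive (ℚ.≤-<-trans 0≤t t<r)}} t<r

  loc : ∀ {p q} → p ℚ.< q → L p ⊎ U q
  loc p<q with ℚ.<-dense p<q
  ... | t , p<t , t<q with t ℚ.* t ℚ.≤? ℕ→ℚ m | 0ℚ ℚ.≤? t
  ... | yes t²≤m | _       = inj₁ (t , p<t , t²≤m)
  ... | no  t²≰m | yes 0≤t = inj₂ (t , t<q , 0≤t , ℚ.<⇒≤ (ℚ.≰⇒> t²≰m))
  ... | no  _    | no  0≰t = inj₁ (0ℚ , ℚ.<-trans p<t (ℚ.≰⇒> 0≰t) , 0≤ℕ→ℚ m)

infixl 7 _·!_

_·!_ : ℝ → ℕ → ℝ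
x ·! m = (x · (m ℕ.!)) {{m !≢0}}

-- The set Sₙ; permutations are identified when they agree pointwise.

S : ℕ → Setoid 0ℓ 0ℓ
S n = record
  { Carrier       = Permutation′ n
  ; _≈_           = _≈_
  ; isEquivalence = record
    { refl  = λ _ → refl
    ; sym   = λ σ≈τ i → sym (σ≈τ i)
    ; trans = λ σ≈τ τ≈ρ i → trans (σ≈τ i) (τ≈ρ i)
    }
  }

-- A subset of the finite set Sₙ, as a repetition-free list of its elements.

record Family (n : ℕ) : Set where
  field
    elements : List (Permutation′ n)
    unique   : Unique.Unique (S n) elements

open Family public using (elements)

infix 4 _∈_

_∈_ : ∀ {n} → Permutation′ n → Family n → Set
_∈_ {n} σ 𝒜 = Membership._∈_ (S n) σ (elements 𝒜)

∣_∣ : ∀ {n} → Family n → ℕ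
∣ 𝒜 ∣ = length (elements 𝒜)

CrossIntersecting : ∀ {n} → Family n → Family n → Set
CrossIntersecting {n} 𝒜 ℬ =
  ∀ (σ τ : Permutation′ n) → σ ∈ 𝒜 → τ ∈ ℬ → ∃[ i ] σ ⟨$⟩ʳ i ≡ τ ⟨$⟩ʳ i

-- |{σ ∈ 𝒜 : σ(i) ≠ j}|

∣_∣[_↛_] : ∀ {n} → Family n → Fin n → Fin n → ℕ
∣ 𝒜 ∣[ i ↛ j ] = length (filter (λ σ → ¬? (σ ⟨$⟩ʳ i ≟ j)) (elements 𝒜))

{-# OPTIONS --safe #-}
module Submission where

-- Call a family of permutations, viewed as n-subsets of the n² cells (i , j), r-spread if at most r^(-|Q|) of its
-- members contain Q, for every set Q of cells. Two r-spread families with r proportional to n have disjoint members: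
-- a random set of cells contains a member of such a family with probability above 1/2. To see this, expose a random
-- set w first; an encoding argument shows that for most w and σ some member inside w ∪ σ leaves only a small residue
-- outside w, and the residues inherit spreadness, so that a second moment argument finishes the job.
-- If X maximises r^|X| |𝒜(X)| then the link 𝒜(X) is spread, and |X| is small. Hence most of ℬ meets X, and some star
-- (i , j) contains a non-negligible part of ℬ. Swapping two values and deleting i, induction on n bounds
-- |{σ ∈ 𝒜 : σ(i) = j′}| |{τ ∈ ℬ : τ(i) = j}| by a multiple of (n - 2)!² for j′ ≠ j, which successively forces 𝒜 and
-- ℬ to concentrate on that star.

open import Defs
open import Data.Bool.Base using (true; false; if_then_else_)
open import Data.Empty using (⊥; ⊥-elim)
open import Data.Fin.Base using (Fin; zero; suc; punchIn; punchOut; combine; remQuot)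
open import Data.Fin.Permutation using (Permutation′; _⟨$⟩ʳ_; _⟨$⟩ˡ_; _≈_; remove; punchIn-permute; transpose; _∘ₚ_; inverseˡ)
open import Data.Fin.Properties using (_≟_; punchIn-punchOut; punchIn-injective; remQuot-combine; combine-remQuot; suc-injective)
open import Data.Fin.Subset as Sub using (Subset; _∩_; _∪_; ∁; _⊆_; ⁅_⁆; inside; outside) renaming (∣_∣ to ∥_∥)
open import Data.Fin.Subset.Properties as Sub using (_⊆?_; nonempty?)
import Data.Integer.Base as ℤ
import Data.Integer.Properties as ℤ
open import Data.List.Base using (List; []; _∷_; map; length; filter; allFin; foldr)
open import Data.List.Membership.Propositional using (find; lose) renaming (_∈_ to _∈ˡ_)
open import Data.List.Membership.Propositional.Properties using (∈-filter⁻; ∈-map⁻; ∈-map⁺)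
open import Data.List.Properties using (length-map; map-∘; map-tabulate; length-filter; length-tabulate; filter-all)
open import Data.List.Relation.Unary.All as All using (All; []; _∷_)
import Data.List.Relation.Unary.All.Properties as All
open import Data.List.Relation.Unary.AllPairs using ([]; _∷_)
open import Data.List.Relation.Unary.Any as Any using (Any; here; there; any?)
open import Data.List.Relation.Unary.Unique.Propositional using (Unique)
import Data.List.Relation.Unary.Unique.Propositional.Properties as Unique
import Data.List.Relation.Unary.Unique.Setoid as USetoid
import Data.List.Relation.Unary.Unique.Setoid.Properties as USetoid
open import Data.Nat.Base as ℕ
open import Data.Nat.Coprimality as Coprimality using (1-coprimeTo)
open import Data.Nat.DivMod using (m≡m%n+[m/n]*n; m%n<n; m/n*n≤m; m*n/n≡m; /-monoˡ-≤)
open import Data.Nat.ListAction using (sum)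
open import Data.Nat.Properties as ℕ hiding (_≟_; suc-injective)
open import Data.Nat.Tactic.RingSolver using (solve-∀)
open import Data.Product.Base using (∃-syntax; _×_; _,_; proj₁; proj₂)
open import Data.Rational.Base as ℚ using (ℚ; mkℚ; 0ℚ; 1ℚ; _÷_; 1/_; ↧ₙ_)
import Data.Rational.Properties as ℚ
open import Data.Rational.Unnormalised.Base as ℚᵘ using (mkℚᵘ)
import Data.Rational.Unnormalised.Properties as ℚᵘ
open import Data.Sum.Base using (inj₁; inj₂; [_,_]′)
open import Data.Vec.Base as Vec using ([]; _∷_; here; there)
open import Data.Vec.Properties using (lookup⇒[]=; []=⇒lookup; lookup∘tabulate)
open import Function.Base using (_∘_)
open import Level using (Level)
open import Relation.Binary.PropositionalEquality hiding (J)
open import Relation.Nullary using (Dec; yes; no; does; ¬_; contradiction)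
open import Relation.Nullary.Decidable using (¬?; dec-true)
open import Relation.Unary using (Pred; Decidable)

-- A second moment applied directly to n-sets compares (1 + 2 / t)^n with 1, so it would need
-- spreadness well above n. But a family of permutations is at most (n!)^(1/n)-spread, about n / e:
-- take for Q a whole member. This is why a first random set has to cut the members down to residues
-- of size below k = t / 10. The encoding bound behind this cut loses a factor 8^n, which (1 + 2
-- t)^k beats because t and k are both linear in n. The densities 1/4 and 1/3 are matched by 1 -
-- (3/4)(2/3) = 1/2, so that the union of both random sets and its complement have the same law.
--
-- A popular star found in this way holds only about a 1 / (2 q) part of ℬ. The swapping argument
-- gains a factor of order n, hence q must stay below a small multiple of n; at the same time 2^q
-- must exceed the density loss of the families, which is polynomial in n. Probabilities appear
-- throughout as weighted integer sums with cleared denominators.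

private
  variable
    ℓ ℓ₁ ℓ₂ : Level
    A B : Set ℓ
    P : Set ℓ₁
    Q : Set ℓ₂
    n N : ℕ

-- Sums over lists and over subsets

𝟙 : Dec P → ℕ
𝟙 P? = if does P? then 1 else 0

𝟙≤1 : (P? : Dec P) → 𝟙 P? ≤ 1
𝟙≤1 (yes _) = ≤-refl
𝟙≤1 (no _)  = z≤n

𝟙-true : (P? : Dec P) → P → 𝟙 P? ≡ 1
𝟙-true (yes _) _ = refl
𝟙-true (no ¬p) p = contradiction p ¬p

𝟙-false : (P? : Dec P) → ¬ P → 𝟙 P? ≡ 0
𝟙-false (yes p) ¬p = contradiction p ¬p
𝟙-false (no _)  _  = refl

𝟙-mono : (P? : Dec P) (Q? : Dec Q) → (P → Q) → 𝟙 P? ≤ 𝟙 Q?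
𝟙-mono (no _)  Q? f = z≤n
𝟙-mono (yes p) Q? f = ≤-reflexive (sym (𝟙-true Q? (f p)))

*-𝟙-≤ : ∀ (P? : Dec P) {x y} → (P → x ≤ y) → x * 𝟙 P? ≤ y
*-𝟙-≤ (yes p) {x} h = ≤-trans (≤-reflexive (*-identityʳ x)) (h p)
*-𝟙-≤ (no _)  {x} h = ≤-trans (≤-reflexive (*-zeroʳ x)) z≤n

∑ : (A → ℕ) → List A → ℕ
∑ f xs = sum (map f xs)

∑-mono-∈ : ∀ {f g : A → ℕ} xs → (∀ {x} → x ∈ˡ xs → f x ≤ g x) → ∑ f xs ≤ ∑ g xs
∑-mono-∈ []       h = z≤n
∑-mono-∈ (x ∷ xs) h = +-mono-≤ (h (here refl)) (∑-mono-∈ xs (h ∘ there))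

∑-mono : ∀ {f g : A → ℕ} xs → (∀ x → f x ≤ g x) → ∑ f xs ≤ ∑ g xs
∑-mono xs h = ∑-mono-∈ xs (λ {x} _ → h x)

∑-cong : ∀ {f g : A → ℕ} xs → (∀ x → f x ≡ g x) → ∑ f xs ≡ ∑ g xs
∑-cong []       h = refl
∑-cong (x ∷ xs) h = cong₂ _+_ (h x) (∑-cong xs h)

∑-+ : ∀ (f g : A → ℕ) xs → ∑ (λ x → f x + g x) xs ≡ ∑ f xs + ∑ g xs
∑-+ f g []       = refl
∑-+ f g (x ∷ xs) rewrite ∑-+ f g xs = lemma (f x) (g x) (∑ f xs) (∑ g xs)
  where
  lemma : ∀ a b c d → a + b + (c + d) ≡ a + c + (b + d)
  lemma = solve-∀

∑-* : ∀ c (f : A → ℕ) xs → ∑ (λ x → c * f x) xs ≡ c * ∑ f xs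
∑-* c f []       = sym (*-zeroʳ c)
∑-* c f (x ∷ xs) rewrite ∑-* c f xs = sym (*-distribˡ-+ c (f x) (∑ f xs))

∑-const : ∀ c (xs : List A) → ∑ (λ _ → c) xs ≡ length xs * c
∑-const c []       = refl
∑-const c (x ∷ xs) = cong (c +_) (∑-const c xs)

∑-swap : ∀ (f : A → B → ℕ) xs ys → ∑ (λ x → ∑ (f x) ys) xs ≡ ∑ (λ y → ∑ (λ x → f x y) xs) ys
∑-swap f []       ys = sym (trans (∑-const 0 ys) (*-zeroʳ (length ys)))
∑-swap f (x ∷ xs) ys rewrite ∑-swap f xs ys = sym (∑-+ (f x) (λ y → ∑ (λ x → f x y) xs) ys)

∑-term : ∀ (f : A → ℕ) {x xs} → x ∈ˡ xs → f x ≤ ∑ f xs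
∑-term f (here refl) = m≤m+n _ _
∑-term f (there {x = y} x∈) = ≤-trans (∑-term f x∈) (m≤n+m _ (f y))

module _ {P : Pred A ℓ₁} (P? : Decidable P) where

  ∑-filter : ∀ f xs → ∑ f (filter P? xs) ≡ ∑ (λ x → 𝟙 (P? x) * f x) xs
  ∑-filter f []       = refl
  ∑-filter f (x ∷ xs) with does (P? x)
  ... | true  = cong₂ _+_ (sym (+-identityʳ (f x))) (∑-filter f xs)
  ... | false = ∑-filter f xs

  length-filter-∑ : ∀ xs → length (filter P? xs) ≡ ∑ (λ x → 𝟙 (P? x)) xs
  length-filter-∑ []       = refl
  length-filter-∑ (x ∷ xs) with does (P? x)
  ... | true  = cong suc (length-filter-∑ xs)
  ... | false = length-filter-∑ xs

∑-filter-≤ : ∀ {p} {P : Pred A p} (P? : Decidable P) f xs → ∑ f (filter P? xs) ≤ ∑ f xs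
∑-filter-≤ P? f xs = ≤-trans (≤-reflexive (∑-filter P? f xs))
  (∑-mono xs (λ x → ≤-trans (*-monoˡ-≤ (f x) (𝟙≤1 (P? x))) (≤-reflexive (*-identityˡ (f x)))))

-- E α β f is the sum of f over all subsets, each element of the ground set contributing
-- a factor α if it is inside and β if it is outside.
E : ℕ → ℕ → (Subset N → ℕ) → ℕ
E {zero}  α β f = f []
E {suc N} α β f = α * E α β (f ∘ (inside ∷_)) + β * E α β (f ∘ (outside ∷_))

module _ {α β : ℕ} where

  E-mono : {f g : Subset N → ℕ} → (∀ v → f v ≤ g v) → E α β f ≤ E α β g
  E-mono {zero}  h = h []
  E-mono {suc N} h = +-mono-≤ (*-monoʳ-≤ α (E-mono (λ v → h (inside ∷ v))))
                              (*-monoʳ-≤ β (E-mono (λ v → h (outside ∷ v))))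

  E-cong : {f g : Subset N → ℕ} → (∀ v → f v ≡ g v) → E α β f ≡ E α β g
  E-cong {zero}  h = h []
  E-cong {suc N} h = cong₂ (λ x y → α * x + β * y) (E-cong (λ v → h (inside ∷ v)))
                                                   (E-cong (λ v → h (outside ∷ v)))

  E-+ : (f g : Subset N → ℕ) → E α β (λ v → f v + g v) ≡ E α β f + E α β g
  E-+ {zero}  f g = refl
  E-+ {suc N} f g
    rewrite E-+ (f ∘ (inside ∷_)) (g ∘ (inside ∷_)) | E-+ (f ∘ (outside ∷_)) (g ∘ (outside ∷_))
    = lemma α β (E α β (f ∘ (inside ∷_))) (E α β (g ∘ (inside ∷_)))
                (E α β (f ∘ (outside ∷_))) (E α β (g ∘ (outside ∷_)))
    where
    lemma : ∀ α β a b c d → α * (a + b) + β * (c + d) ≡ (α * a + β * c) + (α * b + β * d)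
    lemma = solve-∀

  E-* : ∀ c (f : Subset N → ℕ) → E α β (λ v → c * f v) ≡ c * E α β f
  E-* {zero}  c f = refl
  E-* {suc N} c f rewrite E-* c (f ∘ (inside ∷_)) | E-* c (f ∘ (outside ∷_))
    = lemma α β c (E α β (f ∘ (inside ∷_))) (E α β (f ∘ (outside ∷_)))
    where
    lemma : ∀ α β c a b → α * (c * a) + β * (c * b) ≡ c * (α * a + β * b)
    lemma = solve-∀

  E-const : ∀ c → E {N} α β (λ _ → c) ≡ (α + β) ^ N * c
  E-const {zero}  c = sym (+-identityʳ c)
  E-const {suc N} c rewrite E-const {N} c = lemma α β ((α + β) ^ N) c
    where
    lemma : ∀ α β x c → α * (x * c) + β * (x * c) ≡ (α + β) * x * c
    lemma = solve-∀

  E-∑ : ∀ (f : A → Subset N → ℕ) xs → E α β (λ v → ∑ (λ x → f x v) xs) ≡ ∑ (λ x → E α β (f x)) xs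
  E-∑ {N = N} f [] = trans (E-const {N} 0) (*-zeroʳ ((α + β) ^ N))
  E-∑ f (x ∷ xs) = trans (E-+ (f x) (λ v → ∑ (λ x → f x v) xs)) (cong (E α β (f x) +_) (E-∑ f xs))

E-∁ : (f : Subset N → ℕ) → E 1 1 (f ∘ ∁) ≡ E 1 1 f
E-∁ {zero}  f = refl
E-∁ {suc N} f rewrite E-∁ (f ∘ (inside ∷_)) | E-∁ (f ∘ (outside ∷_)) =
  +-comm (1 * E 1 1 (f ∘ (outside ∷_))) (1 * E 1 1 (f ∘ (inside ∷_)))

E-exists : ∀ c (f : Subset N → ℕ) → 2 ^ N * c < E 1 1 f → ∃[ v ] c < f v
E-exists {zero}  c f h = [] , subst (_< f []) (+-identityʳ c) h
E-exists {suc N} c f h with 2 ^ N * c <? E 1 1 (f ∘ (inside ∷_))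
... | yes h₁ = let (v , hv) = E-exists c _ h₁ in inside ∷ v , hv
... | no ¬h₁ with 2 ^ N * c <? E 1 1 (f ∘ (outside ∷_))
... | yes h₂ = let (v , hv) = E-exists c _ h₂ in outside ∷ v , hv
... | no ¬h₂ = contradiction h (≤⇒≯ (begin
  1 * E 1 1 (f ∘ (inside ∷_)) + 1 * E 1 1 (f ∘ (outside ∷_)) ≤⟨ +-mono-≤ (*-monoʳ-≤ 1 (≮⇒≥ ¬h₁)) (*-monoʳ-≤ 1 (≮⇒≥ ¬h₂)) ⟩
  1 * (2 ^ N * c) + 1 * (2 ^ N * c)                          ≡⟨ lemma (2 ^ N) c ⟩
  2 ^ suc N * c                                              ∎))
  where
  open ≤-Reasoning
  lemma : ∀ x c → 1 * (x * c) + 1 * (x * c) ≡ 2 * x * c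
  lemma = solve-∀

-- If w and u are independent with densities 1/4 and 1/3 then w ∪ u is uniform.
E-coupling : (f : Subset N → ℕ) → E 1 3 (λ w → E 1 2 (λ u → f (w ∪ u))) ≡ 6 ^ N * E 1 1 f
E-coupling {zero}  f = sym (+-identityʳ _)
E-coupling {suc N} f = begin
  1 * E 1 3 (λ w → 1 * E 1 2 (λ u → f (inside ∷ w ∪ u)) + 2 * E 1 2 (λ u → f (inside ∷ w ∪ u)))
   + 3 * E 1 3 (λ w → 1 * E 1 2 (λ u → f (inside ∷ w ∪ u)) + 2 * E 1 2 (λ u → f (outside ∷ w ∪ u)))
    ≡⟨ cong₂ (λ x y → 1 * x + 3 * y) (split (inside ∷_) (inside ∷_)) (split (inside ∷_) (outside ∷_)) ⟩
  1 * (1 * (6 ^ N * I) + 2 * (6 ^ N * I)) + 3 * (1 * (6 ^ N * I) + 2 * (6 ^ N * O))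
    ≡⟨ lemma (6 ^ N) I O ⟩
  6 * 6 ^ N * (1 * I + 1 * O) ∎
  where
  open ≡-Reasoning
  I O : ℕ
  I = E 1 1 (f ∘ (inside ∷_))
  O = E 1 1 (f ∘ (outside ∷_))
  lemma : ∀ c i o → 1 * (1 * (c * i) + 2 * (c * i)) + 3 * (1 * (c * i) + 2 * (c * o)) ≡ 6 * c * (1 * i + 1 * o)
  lemma = solve-∀
  split : ∀ (g h : Subset N → Subset (suc N)) →
          E 1 3 (λ w → 1 * E 1 2 (λ u → f (g (w ∪ u))) + 2 * E 1 2 (λ u → f (h (w ∪ u)))) ≡
          1 * (6 ^ N * E 1 1 (f ∘ g)) + 2 * (6 ^ N * E 1 1 (f ∘ h))
  split g h = trans (E-+ (λ w → 1 * E 1 2 (λ u → f (g (w ∪ u)))) (λ w → 2 * E 1 2 (λ u → f (h (w ∪ u)))))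
    (cong₂ _+_ (trans (E-* 1 (λ w → E 1 2 (λ u → f (g (w ∪ u))))) (cong (1 *_) (E-coupling (f ∘ g))))
               (trans (E-* 2 (λ w → E 1 2 (λ u → f (h (w ∪ u))))) (cong (2 *_) (E-coupling (f ∘ h)))))

-- `w ∪ σ` has the law of `w` conditioned on containing `σ`, an event of probability 4^(-|σ|). The
-- inequality comes from the sets `w` that miss part of `σ`: they only add to the right-hand side.
E-plant : ∀ (f : Subset N → ℕ) σ → E 1 3 (λ w → f (w ∪ σ)) ≤ 4 ^ ∥ σ ∥ * E 1 3 f
E-plant f []            = ≤-reflexive (sym (+-identityʳ _))
E-plant f (outside ∷ σ) = begin
  1 * E 1 3 (λ w → f (inside ∷ w ∪ σ)) + 3 * E 1 3 (λ w → f (outside ∷ w ∪ σ))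
    ≤⟨ +-mono-≤ (*-monoʳ-≤ 1 (E-plant (f ∘ (inside ∷_)) σ)) (*-monoʳ-≤ 3 (E-plant (f ∘ (outside ∷_)) σ)) ⟩
  1 * (4 ^ ∥ σ ∥ * E 1 3 (f ∘ (inside ∷_))) + 3 * (4 ^ ∥ σ ∥ * E 1 3 (f ∘ (outside ∷_)))
    ≡⟨ lemma (4 ^ ∥ σ ∥) (E 1 3 (f ∘ (inside ∷_))) (E 1 3 (f ∘ (outside ∷_))) ⟩
  4 ^ ∥ σ ∥ * E 1 3 f ∎
  where
  open ≤-Reasoning
  lemma : ∀ x i o → 1 * (x * i) + 3 * (x * o) ≡ x * (1 * i + 3 * o)
  lemma = solve-∀
E-plant f (inside ∷ σ) = begin
  1 * E 1 3 (λ w → f (inside ∷ w ∪ σ)) + 3 * E 1 3 (λ w → f (inside ∷ w ∪ σ))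
    ≡⟨ lemma₁ (E 1 3 (λ w → f (inside ∷ w ∪ σ))) ⟩
  4 * E 1 3 (λ w → f (inside ∷ w ∪ σ))
    ≤⟨ *-monoʳ-≤ 4 (E-plant (f ∘ (inside ∷_)) σ) ⟩
  4 * (4 ^ ∥ σ ∥ * E 1 3 (f ∘ (inside ∷_)))
    ≤⟨ m≤m+n _ (4 * (4 ^ ∥ σ ∥ * (3 * E 1 3 (f ∘ (outside ∷_))))) ⟩
  4 * (4 ^ ∥ σ ∥ * E 1 3 (f ∘ (inside ∷_))) + 4 * (4 ^ ∥ σ ∥ * (3 * E 1 3 (f ∘ (outside ∷_))))
    ≡⟨ lemma₂ (4 ^ ∥ σ ∥) (E 1 3 (f ∘ (inside ∷_))) (E 1 3 (f ∘ (outside ∷_))) ⟩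
  4 * 4 ^ ∥ σ ∥ * E 1 3 f ∎
  where
  open ≤-Reasoning
  lemma₁ : ∀ x → 1 * x + 3 * x ≡ 4 * x
  lemma₁ = solve-∀
  lemma₂ : ∀ x i o → 4 * (x * i) + 4 * (x * (3 * o)) ≡ 4 * x * (1 * i + 3 * o)
  lemma₂ = solve-∀

private
  E12-0 : E {N} 1 2 (λ _ → 0) ≡ 0
  E12-0 {N} = trans (E-const {N = N} 0) (*-zeroʳ (3 ^ N))

-- Both containments together have probability 3^(-|S ∪ T|), and |S ∪ T| = |S| + |T| - |S ∩ T|. The
-- exponent is expressed through the overlap because that is what spreadness controls.
E-superset₂ : ∀ (S T : Subset N) →
  3 ^ ∥ S ∥ * 3 ^ ∥ T ∥ * E 1 2 (λ u → 𝟙 (S ⊆? u) * 𝟙 (T ⊆? u)) ≡ 3 ^ N * 3 ^ ∥ S ∩ T ∥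
E-superset₂ [] [] = refl
E-superset₂ {suc N} (inside ∷ S) (inside ∷ T) = begin
  3 * 3 ^ ∥ S ∥ * (3 * 3 ^ ∥ T ∥) * (1 * J + 2 * E {N} 1 2 (λ _ → 0)) ≡⟨ cong (λ x → 3 * 3 ^ ∥ S ∥ * (3 * 3 ^ ∥ T ∥) * (1 * J + 2 * x)) (E12-0 {N}) ⟩
  3 * 3 ^ ∥ S ∥ * (3 * 3 ^ ∥ T ∥) * (1 * J + 2 * 0)                   ≡⟨ lemma₁ (3 ^ ∥ S ∥) (3 ^ ∥ T ∥) J ⟩
  9 * (3 ^ ∥ S ∥ * 3 ^ ∥ T ∥ * J)                                     ≡⟨ cong (9 *_) (E-superset₂ S T) ⟩
  9 * (3 ^ N * 3 ^ ∥ S ∩ T ∥)                                         ≡⟨ lemma₂ (3 ^ N) (3 ^ ∥ S ∩ T ∥) ⟩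
  3 * 3 ^ N * (3 * 3 ^ ∥ S ∩ T ∥)                                     ∎
  where
  open ≡-Reasoning
  J : ℕ
  J = E 1 2 (λ u → 𝟙 (S ⊆? u) * 𝟙 (T ⊆? u))
  lemma₁ : ∀ s t j → 3 * s * (3 * t) * (1 * j + 2 * 0) ≡ 9 * (s * t * j)
  lemma₁ = solve-∀
  lemma₂ : ∀ s t → 9 * (s * t) ≡ 3 * s * (3 * t)
  lemma₂ = solve-∀
E-superset₂ {suc N} (inside ∷ S) (outside ∷ T) = begin
  3 * 3 ^ ∥ S ∥ * 3 ^ ∥ T ∥ * (1 * J + 2 * E {N} 1 2 (λ _ → 0)) ≡⟨ cong (λ x → 3 * 3 ^ ∥ S ∥ * 3 ^ ∥ T ∥ * (1 * J + 2 * x)) (E12-0 {N}) ⟩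
  3 * 3 ^ ∥ S ∥ * 3 ^ ∥ T ∥ * (1 * J + 2 * 0)                   ≡⟨ lemma₁ (3 ^ ∥ S ∥) (3 ^ ∥ T ∥) J ⟩
  3 * (3 ^ ∥ S ∥ * 3 ^ ∥ T ∥ * J)                               ≡⟨ cong (3 *_) (E-superset₂ S T) ⟩
  3 * (3 ^ N * 3 ^ ∥ S ∩ T ∥)                                   ≡⟨ *-assoc 3 (3 ^ N) _ ⟨
  3 * 3 ^ N * 3 ^ ∥ S ∩ T ∥                                     ∎
  where
  open ≡-Reasoning
  J : ℕ
  J = E 1 2 (λ u → 𝟙 (S ⊆? u) * 𝟙 (T ⊆? u))
  lemma₁ : ∀ s t j → 3 * s * t * (1 * j + 2 * 0) ≡ 3 * (s * t * j)
  lemma₁ = solve-∀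
E-superset₂ {suc N} (outside ∷ S) (inside ∷ T) = begin
  3 ^ ∥ S ∥ * (3 * 3 ^ ∥ T ∥) * (1 * J + 2 * E {N} 1 2 (λ u → 𝟙 (S ⊆? u) * 0))
    ≡⟨ cong (λ x → 3 ^ ∥ S ∥ * (3 * 3 ^ ∥ T ∥) * (1 * J + 2 * x)) (trans (E-cong (λ u → *-zeroʳ (𝟙 (S ⊆? u)))) (E12-0 {N})) ⟩
  3 ^ ∥ S ∥ * (3 * 3 ^ ∥ T ∥) * (1 * J + 2 * 0)                 ≡⟨ lemma₁ (3 ^ ∥ S ∥) (3 ^ ∥ T ∥) J ⟩
  3 * (3 ^ ∥ S ∥ * 3 ^ ∥ T ∥ * J)                               ≡⟨ cong (3 *_) (E-superset₂ S T) ⟩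
  3 * (3 ^ N * 3 ^ ∥ S ∩ T ∥)                                   ≡⟨ *-assoc 3 (3 ^ N) _ ⟨
  3 * 3 ^ N * 3 ^ ∥ S ∩ T ∥                                     ∎
  where
  open ≡-Reasoning
  J : ℕ
  J = E 1 2 (λ u → 𝟙 (S ⊆? u) * 𝟙 (T ⊆? u))
  lemma₁ : ∀ s t j → s * (3 * t) * (1 * j + 2 * 0) ≡ 3 * (s * t * j)
  lemma₁ = solve-∀
E-superset₂ {suc N} (outside ∷ S) (outside ∷ T) = begin
  3 ^ ∥ S ∥ * 3 ^ ∥ T ∥ * (1 * J + 2 * J)                       ≡⟨ lemma₁ (3 ^ ∥ S ∥) (3 ^ ∥ T ∥) J ⟩
  3 * (3 ^ ∥ S ∥ * 3 ^ ∥ T ∥ * J)                               ≡⟨ cong (3 *_) (E-superset₂ S T) ⟩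
  3 * (3 ^ N * 3 ^ ∥ S ∩ T ∥)                                   ≡⟨ *-assoc 3 (3 ^ N) _ ⟨
  3 * 3 ^ N * 3 ^ ∥ S ∩ T ∥                                     ∎
  where
  open ≡-Reasoning
  J : ℕ
  J = E 1 2 (λ u → 𝟙 (S ⊆? u) * 𝟙 (T ⊆? u))
  lemma₁ : ∀ s t j → s * t * (1 * j + 2 * j) ≡ 3 * (s * t * j)
  lemma₁ = solve-∀

∣p∩p∣≡∣p∣ : ∀ (S : Subset N) → ∥ S ∩ S ∥ ≡ ∥ S ∥
∣p∩p∣≡∣p∣ []            = refl
∣p∩p∣≡∣p∣ (inside ∷ S)  = cong suc (∣p∩p∣≡∣p∣ S)
∣p∩p∣≡∣p∣ (outside ∷ S) = ∣p∩p∣≡∣p∣ S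

𝟙-idem : ∀ {p} {P : Set p} (P? : Dec P) → 𝟙 P? * 𝟙 P? ≡ 𝟙 P?
𝟙-idem (yes _) = refl
𝟙-idem (no _)  = refl

E-superset : ∀ (S : Subset N) → 3 ^ ∥ S ∥ * E 1 2 (λ u → 𝟙 (S ⊆? u)) ≡ 3 ^ N
E-superset {N} S = *-cancelˡ-≡ _ _ (3 ^ ∥ S ∥) {{m^n≢0 3 ∥ S ∥}} (begin
  3 ^ ∥ S ∥ * (3 ^ ∥ S ∥ * E 1 2 (λ u → 𝟙 (S ⊆? u)))                 ≡⟨ *-assoc (3 ^ ∥ S ∥) _ _ ⟨
  3 ^ ∥ S ∥ * 3 ^ ∥ S ∥ * E 1 2 (λ u → 𝟙 (S ⊆? u))                   ≡⟨ cong (3 ^ ∥ S ∥ * 3 ^ ∥ S ∥ *_) (E-cong (λ u → 𝟙-idem (S ⊆? u))) ⟨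
  3 ^ ∥ S ∥ * 3 ^ ∥ S ∥ * E 1 2 (λ u → 𝟙 (S ⊆? u) * 𝟙 (S ⊆? u))      ≡⟨ E-superset₂ S S ⟩
  3 ^ N * 3 ^ ∥ S ∩ S ∥                                              ≡⟨ cong (λ k → 3 ^ N * 3 ^ k) (∣p∩p∣≡∣p∣ S) ⟩
  3 ^ N * 3 ^ ∥ S ∥                                                  ≡⟨ *-comm (3 ^ N) _ ⟩
  3 ^ ∥ S ∥ * 3 ^ N                                                  ∎)
  where open ≡-Reasoning

-- The binomial theorem on `R ∩ S`: only its subsets Q survive, each with weight y^|Q|.
E-subset₂ : ∀ y (R S : Subset N) → E y 1 (λ Q → 𝟙 (Q ⊆? R) * 𝟙 (Q ⊆? S)) ≡ suc y ^ ∥ R ∩ S ∥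
E-subset₂ y [] [] = refl
E-subset₂ {suc N} y (outside ∷ R) (s ∷ S) = trans
  (cong₂ (λ a b → y * a + 1 * b) (trans (E-const {N = N} 0) (*-zeroʳ ((y + 1) ^ N))) (E-subset₂ y R S))
  (cong₂ _+_ (*-zeroʳ y) (*-identityˡ _))
E-subset₂ {suc N} y (inside ∷ R) (outside ∷ S) = trans
  (cong₂ (λ a b → y * a + 1 * b)
    (trans (E-cong (λ Q → *-zeroʳ (𝟙 (Q ⊆? R)))) (trans (E-const {N = N} 0) (*-zeroʳ ((y + 1) ^ N)))) (E-subset₂ y R S))
  (cong₂ _+_ (*-zeroʳ y) (*-identityˡ _))
E-subset₂ {suc N} y (inside ∷ R) (inside ∷ S) = trans
  (cong₂ (λ a b → y * a + 1 * b) (E-subset₂ y R S) (E-subset₂ y R S))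
  (lemma y (suc y ^ ∥ R ∩ S ∥))
  where
  lemma : ∀ y x → y * x + 1 * x ≡ x + y * x
  lemma = solve-∀

E-subset : ∀ y s (R : Subset N) → s ^ ∥ R ∥ * E y s (λ Q → 𝟙 (Q ⊆? R)) ≡ (y + s) ^ ∥ R ∥ * s ^ N
E-subset y s [] = refl
E-subset {suc N} y s (outside ∷ R) = begin
  s ^ ∥ R ∥ * (y * E {N} y s (λ _ → 0) + s * J) ≡⟨ cong (λ z → s ^ ∥ R ∥ * (y * z + s * J)) (trans (E-const {N = N} 0) (*-zeroʳ ((y + s) ^ N))) ⟩
  s ^ ∥ R ∥ * (y * 0 + s * J)                   ≡⟨ lemma₁ (s ^ ∥ R ∥) y s J ⟩
  s * (s ^ ∥ R ∥ * J)                           ≡⟨ cong (s *_) (E-subset y s R) ⟩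
  s * ((y + s) ^ ∥ R ∥ * s ^ N)                 ≡⟨ lemma₂ s ((y + s) ^ ∥ R ∥) (s ^ N) ⟩
  (y + s) ^ ∥ R ∥ * (s * s ^ N)                 ∎
  where
  open ≡-Reasoning
  J : ℕ
  J = E y s (λ Q → 𝟙 (Q ⊆? R))
  lemma₁ : ∀ a y s j → a * (y * 0 + s * j) ≡ s * (a * j)
  lemma₁ = solve-∀
  lemma₂ : ∀ s a b → s * (a * b) ≡ a * (s * b)
  lemma₂ = solve-∀
E-subset {suc N} y s (inside ∷ R) = begin
  s * s ^ ∥ R ∥ * (y * J + s * J)             ≡⟨ lemma₁ (s ^ ∥ R ∥) y s J ⟩
  (y + s) * s * (s ^ ∥ R ∥ * J)               ≡⟨ cong ((y + s) * s *_) (E-subset y s R) ⟩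
  (y + s) * s * ((y + s) ^ ∥ R ∥ * s ^ N)     ≡⟨ lemma₂ (y + s) s ((y + s) ^ ∥ R ∥) (s ^ N) ⟩
  (y + s) * (y + s) ^ ∥ R ∥ * (s * s ^ N)     ∎
  where
  open ≡-Reasoning
  J : ℕ
  J = E y s (λ Q → 𝟙 (Q ⊆? R))
  lemma₁ : ∀ a y s j → s * a * (y * j + s * j) ≡ (y + s) * s * (a * j)
  lemma₁ = solve-∀
  lemma₂ : ∀ z s a b → z * s * (a * b) ≡ z * a * (s * b)
  lemma₂ = solve-∀

-- Each Q has weight y^|Q| on the left and y^|Q| s^(N - |Q|) on the right. Splitting s^N as s^(N -
-- |Q|) s^|Q| hands to `f Q` exactly the power that the spread condition multiplies it with, so no
-- negative power of `s` is ever needed.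
E-rescale : ∀ y s M (f g : Subset N → ℕ) → (∀ Q → f Q * s ^ ∥ Q ∥ ≤ M * g Q) →
            s ^ N * E y 1 f ≤ M * E y s g
E-rescale {zero} y s M f g h = subst (_≤ M * g []) (trans (*-identityʳ (f [])) (sym (+-identityʳ (f [])))) (h [])
E-rescale {suc N} y s M f g h = begin
  s * s ^ N * (y * I + 1 * O)                                       ≡⟨ lemma₁ s (s ^ N) y I O ⟩
  y * (s ^ N * (s * I)) + s * (s ^ N * O)
    ≡⟨ cong (λ z → y * (s ^ N * z) + s * (s ^ N * O)) (E-* s (f ∘ (inside ∷_))) ⟨
  y * (s ^ N * E y 1 (λ Q → s * f (inside ∷ Q))) + s * (s ^ N * O)
    ≤⟨ +-mono-≤ (*-monoʳ-≤ y (E-rescale y s M (λ Q → s * f (inside ∷ Q)) (g ∘ (inside ∷_))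
                   (λ Q → ≤-trans (≤-reflexive (lemma₂ s (f (inside ∷ Q)) (s ^ ∥ Q ∥))) (h (inside ∷ Q)))))
                (*-monoʳ-≤ s (E-rescale y s M (f ∘ (outside ∷_)) (g ∘ (outside ∷_)) (λ Q → h (outside ∷ Q)))) ⟩
  y * (M * E y s (g ∘ (inside ∷_))) + s * (M * E y s (g ∘ (outside ∷_)))
    ≡⟨ lemma₃ y s M (E y s (g ∘ (inside ∷_))) (E y s (g ∘ (outside ∷_))) ⟩
  M * E y s g ∎
  where
  open ≤-Reasoning
  I O : ℕ
  I = E y 1 (f ∘ (inside ∷_))
  O = E y 1 (f ∘ (outside ∷_))
  lemma₁ : ∀ s z y i o → s * z * (y * i + 1 * o) ≡ y * (z * (s * i)) + s * (z * o)
  lemma₁ = solve-∀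
  lemma₂ : ∀ s a z → s * a * z ≡ a * (s * z)
  lemma₂ = solve-∀
  lemma₃ : ∀ y s m i o → y * (m * i) + s * (m * o) ≡ m * (y * i + s * o)
  lemma₃ = solve-∀

-- The sets are given through a map `T` so that indices with equal sets count separately: different
-- members may leave the same residue.
Spread : ℕ → ℕ → (A → Subset N) → List A → Set
Spread s M T xs = ∀ Q → s ^ ∥ Q ∥ * ∑ (λ x → 𝟙 (Q ⊆? T x)) xs ≤ M

-- Expand (1 + y) ^ ∥ R ∩ T ∥ over the subsets of R ∩ T and apply spreadness to each of them.
spread-moment : ∀ s .{{_ : NonZero s}} {M} (T : A → Subset N) xs → Spread s M T xs →
  ∀ y R → s ^ ∥ R ∥ * ∑ (λ x → suc y ^ ∥ R ∩ T x ∥) xs ≤ M * (y + s) ^ ∥ R ∥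
spread-moment {N = N} s {M} T xs spread y R = *-cancelˡ-≤ (s ^ N) {{m^n≢0 s N}} (begin
  s ^ N * (s ^ ∥ R ∥ * ∑ (λ x → suc y ^ ∥ R ∩ T x ∥) xs) ≡⟨ lemma₁ (s ^ N) (s ^ ∥ R ∥) _ ⟩
  s ^ ∥ R ∥ * (s ^ N * ∑ (λ x → suc y ^ ∥ R ∩ T x ∥) xs)
    ≡⟨ cong (λ z → s ^ ∥ R ∥ * (s ^ N * z)) (begin-equality
       ∑ (λ x → suc y ^ ∥ R ∩ T x ∥) xs                               ≡⟨ ∑-cong xs (λ x → E-subset₂ y R (T x)) ⟨
       ∑ (λ x → E y 1 (λ Q → 𝟙 (Q ⊆? R) * 𝟙 (Q ⊆? T x))) xs           ≡⟨ E-∑ (λ x Q → 𝟙 (Q ⊆? R) * 𝟙 (Q ⊆? T x)) xs ⟨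
       E y 1 (λ Q → ∑ (λ x → 𝟙 (Q ⊆? R) * 𝟙 (Q ⊆? T x)) xs)           ≡⟨ E-cong (λ Q → ∑-* (𝟙 (Q ⊆? R)) (λ x → 𝟙 (Q ⊆? T x)) xs) ⟩
       E y 1 (λ Q → 𝟙 (Q ⊆? R) * ∑ (λ x → 𝟙 (Q ⊆? T x)) xs)           ∎) ⟩
  s ^ ∥ R ∥ * (s ^ N * E y 1 (λ Q → 𝟙 (Q ⊆? R) * ∑ (λ x → 𝟙 (Q ⊆? T x)) xs))
    ≤⟨ *-monoʳ-≤ (s ^ ∥ R ∥) (E-rescale y s M _ (λ Q → 𝟙 (Q ⊆? R)) (λ Q → begin
       𝟙 (Q ⊆? R) * ∑ (λ x → 𝟙 (Q ⊆? T x)) xs * s ^ ∥ Q ∥   ≡⟨ lemma₂ (𝟙 (Q ⊆? R)) _ (s ^ ∥ Q ∥) ⟩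
       s ^ ∥ Q ∥ * ∑ (λ x → 𝟙 (Q ⊆? T x)) xs * 𝟙 (Q ⊆? R)   ≤⟨ *-monoˡ-≤ (𝟙 (Q ⊆? R)) (spread Q) ⟩
       M * 𝟙 (Q ⊆? R)                                       ∎)) ⟩
  s ^ ∥ R ∥ * (M * E y s (λ Q → 𝟙 (Q ⊆? R)))  ≡⟨ lemma₁ (s ^ ∥ R ∥) M _ ⟩
  M * (s ^ ∥ R ∥ * E y s (λ Q → 𝟙 (Q ⊆? R)))  ≡⟨ cong (M *_) (E-subset y s R) ⟩
  M * ((y + s) ^ ∥ R ∥ * s ^ N)               ≡⟨ lemma₃ M ((y + s) ^ ∥ R ∥) (s ^ N) ⟩
  s ^ N * (M * (y + s) ^ ∥ R ∥)               ∎)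
  where
  open ≤-Reasoning
  lemma₁ : ∀ a b c → a * (b * c) ≡ b * (a * c)
  lemma₁ = solve-∀
  lemma₂ : ∀ a b c → a * b * c ≡ c * b * a
  lemma₂ = solve-∀
  lemma₃ : ∀ a b c → a * (b * c) ≡ c * (a * b)
  lemma₃ = solve-∀

-- The spread lemma

^-distribʳ-* : ∀ n m o → (m * o) ^ n ≡ m ^ n * o ^ n
^-distribʳ-* zero    m o = refl
^-distribʳ-* (suc n) m o rewrite ^-distribʳ-* n m o = lemma m o (m ^ n) (o ^ n)
  where
  lemma : ∀ m o x y → m * o * (x * y) ≡ m * x * (o * y)
  lemma = solve-∀

-- Keeping at least half of the members costs a factor 2, which 2^j absorbs as soon as j ≥ 1. The
-- case j = 0, a bound by the new length itself, has to come from `c ≤ g`.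
halve-spread : ∀ t j {c c′ L g} → c ≤ c′ → c ≤ g → (2 * t) ^ j * c′ ≤ L → L ≤ 2 * g → t ^ j * c ≤ g
halve-spread t zero    {c}                 c≤c′ c≤g h L≤2g = ≤-trans (≤-reflexive (*-identityˡ c)) c≤g
halve-spread t (suc j) {c} {c′} {L} {g}    c≤c′ c≤g h L≤2g = *-cancelˡ-≤ 2 (begin
  2 * (t ^ suc j * c)                ≤⟨ *-monoʳ-≤ 2 (*-monoʳ-≤ (t ^ suc j) c≤c′) ⟩
  2 * (t ^ suc j * c′)               ≤⟨ *-monoˡ-≤ (t ^ suc j * c′) (m≤m*n 2 (2 ^ j) {{m^n≢0 2 j}}) ⟩
  2 ^ suc j * (t ^ suc j * c′)       ≡⟨ *-assoc (2 ^ suc j) (t ^ suc j) c′ ⟨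
  2 ^ suc j * t ^ suc j * c′         ≡⟨ cong (_* c′) (^-distribʳ-* (suc j) 2 t) ⟨
  (2 * t) ^ suc j * c′               ≤⟨ h ⟩
  L                                  ≤⟨ L≤2g ⟩
  2 * g                              ∎)
  where open ≤-Reasoning

2ab≤a²+b² : ∀ a b → 2 * a * b ≤ a * a + b * b
2ab≤a²+b² a b = [ (λ b≤a → subst₂ _≤_ (lemma₁ b a) (+-comm (b * b) (a * a)) (ordered b≤a)) , ordered ]′ (≤-total b a)
  where
  open ≤-Reasoning
  lemma₁ : ∀ b a → 2 * b * a ≡ 2 * a * b
  lemma₁ = solve-∀
  lemma₂ : ∀ a d → 2 * a * (a + d) + d * d ≡ a * a + (a + d) * (a + d)
  lemma₂ = solve-∀
  ordered : ∀ {a b} → a ≤ b → 2 * a * b ≤ a * a + b * b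
  ordered {a} a≤b with d , refl ← m≤n⇒∃[o]m+o≡n a≤b = begin
    2 * a * (a + d)                ≤⟨ m≤m+n _ (d * d) ⟩
    2 * a * (a + d) + d * d        ≡⟨ lemma₂ a d ⟩
    a * a + (a + d) * (a + d)      ∎

-- The second moment of the number of T x inside a random set of density 1/3, weighted so that all expectations are 1.
second-moment : ∀ t .{{_ : NonZero t}} (T : A → Subset N) xs → Spread t (length xs) T xs →
  (∀ {x} → x ∈ˡ xs → 4 * (2 + t) ^ ∥ T x ∥ ≤ 5 * t ^ ∥ T x ∥) → 0 < length xs →
  3 * 3 ^ N ≤ 4 * E 1 2 (λ u → 𝟙 (any? (λ x → T x ⊆? u) xs))
second-moment {A = A} {N = N} t T xs spread small nonempty =
  *-cancelˡ-≤ (g * g) {{m*n≢0 g g}} (+-cancelˡ-≤ (5 * 3 ^ N * (g * g)) _ _ (begin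
    5 * 3 ^ N * (g * g) + g * g * (3 * 3 ^ N)  ≡⟨ lemma₁ g (3 ^ N) ⟩
    4 * (2 * g * (g * 3 ^ N))                  ≡⟨ cong (λ z → 4 * (2 * g * z)) EZ ⟨
    4 * (2 * g * E 1 2 Z)                      ≡⟨ cong (4 *_) (E-* (2 * g) Z) ⟨
    4 * E 1 2 (λ u → 2 * g * Z u)              ≤⟨ *-monoʳ-≤ 4 (E-mono pointwise) ⟩
    4 * E 1 2 (λ u → Z u * Z u + g * g * hit u)
      ≡⟨ cong (4 *_) (trans (E-+ (λ u → Z u * Z u) (λ u → g * g * hit u)) (cong (E 1 2 (λ u → Z u * Z u) +_) (E-* (g * g) hit))) ⟩
    4 * (E 1 2 (λ u → Z u * Z u) + g * g * E 1 2 hit) ≡⟨ *-distribˡ-+ 4 (E 1 2 (λ u → Z u * Z u)) _ ⟩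
    4 * E 1 2 (λ u → Z u * Z u) + 4 * (g * g * E 1 2 hit) ≤⟨ +-monoˡ-≤ (4 * (g * g * E 1 2 hit)) EZ² ⟩
    5 * 3 ^ N * (g * g) + 4 * (g * g * E 1 2 hit)   ≡⟨ cong (5 * 3 ^ N * (g * g) +_) (lemma₂ (g * g) (E 1 2 hit)) ⟩
    5 * 3 ^ N * (g * g) + g * g * (4 * E 1 2 hit)   ∎))
  where
  open ≤-Reasoning
  g : ℕ
  g = length xs
  instance
    g≢0 : NonZero g
    g≢0 = >-nonZero nonempty
  term : A → Subset N → ℕ
  term x u = 3 ^ ∥ T x ∥ * 𝟙 (T x ⊆? u)
  Z hit : Subset N → ℕ
  Z u = ∑ (λ x → term x u) xs
  hit u = 𝟙 (any? (λ x → T x ⊆? u) xs)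

  lemma₁ : ∀ g z → 5 * z * (g * g) + g * g * (3 * z) ≡ 4 * (2 * g * (g * z))
  lemma₁ = solve-∀
  lemma₂ : ∀ g z → 4 * (g * z) ≡ g * (4 * z)
  lemma₂ = solve-∀

  EZ : E 1 2 Z ≡ g * 3 ^ N
  EZ = begin-equality
    E 1 2 Z                       ≡⟨ E-∑ term xs ⟩
    ∑ (λ x → E 1 2 (term x)) xs   ≡⟨ ∑-cong xs (λ x → trans (E-* (3 ^ ∥ T x ∥) (λ u → 𝟙 (T x ⊆? u))) (E-superset (T x))) ⟩
    ∑ (λ _ → 3 ^ N) xs            ≡⟨ ∑-const (3 ^ N) xs ⟩
    g * 3 ^ N                     ∎

  Eterm : ∀ x y → E 1 2 (λ u → term x u * term y u) ≡ 3 ^ N * 3 ^ ∥ T x ∩ T y ∥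
  Eterm x y = begin-equality
    E 1 2 (λ u → term x u * term y u)
      ≡⟨ E-cong (λ u → lemma₃ (3 ^ ∥ T x ∥) (3 ^ ∥ T y ∥) (𝟙 (T x ⊆? u)) (𝟙 (T y ⊆? u))) ⟩
    E 1 2 (λ u → 3 ^ ∥ T x ∥ * 3 ^ ∥ T y ∥ * (𝟙 (T x ⊆? u) * 𝟙 (T y ⊆? u)))
      ≡⟨ E-* (3 ^ ∥ T x ∥ * 3 ^ ∥ T y ∥) (λ u → 𝟙 (T x ⊆? u) * 𝟙 (T y ⊆? u)) ⟩
    3 ^ ∥ T x ∥ * 3 ^ ∥ T y ∥ * E 1 2 (λ u → 𝟙 (T x ⊆? u) * 𝟙 (T y ⊆? u))
      ≡⟨ E-superset₂ (T x) (T y) ⟩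
    3 ^ N * 3 ^ ∥ T x ∩ T y ∥ ∎
    where
    lemma₃ : ∀ a b c d → a * c * (b * d) ≡ a * b * (c * d)
    lemma₃ = solve-∀

  -- Taking y = 2 in `spread-moment` bounds the average of 3^|T x ∩ T y| over y by (1 + 2 / t)^|T
  -- x|, and `small` bounds this by 5/4.
  row : ∀ {x} → x ∈ˡ xs → 4 * ∑ (λ y → 3 ^ ∥ T x ∩ T y ∥) xs ≤ 5 * g
  row {x} x∈ = *-cancelˡ-≤ (t ^ ∥ T x ∥) {{m^n≢0 t ∥ T x ∥}} (begin
    t ^ ∥ T x ∥ * (4 * ∑ (λ y → 3 ^ ∥ T x ∩ T y ∥) xs)  ≡⟨ lemma₄ (t ^ ∥ T x ∥) 4 _ ⟩
    4 * (t ^ ∥ T x ∥ * ∑ (λ y → 3 ^ ∥ T x ∩ T y ∥) xs)  ≤⟨ *-monoʳ-≤ 4 (spread-moment t T xs spread 2 (T x)) ⟩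
    4 * (g * (2 + t) ^ ∥ T x ∥)                         ≡⟨ lemma₄ 4 g _ ⟩
    g * (4 * (2 + t) ^ ∥ T x ∥)                         ≤⟨ *-monoʳ-≤ g (small x∈) ⟩
    g * (5 * t ^ ∥ T x ∥)                               ≡⟨ lemma₅ g 5 (t ^ ∥ T x ∥) ⟩
    t ^ ∥ T x ∥ * (5 * g)                               ∎)
    where
    lemma₄ : ∀ a b c → a * (b * c) ≡ b * (a * c)
    lemma₄ = solve-∀
    lemma₅ : ∀ a b c → a * (b * c) ≡ c * (b * a)
    lemma₅ = solve-∀

  EZ² : 4 * E 1 2 (λ u → Z u * Z u) ≤ 5 * 3 ^ N * (g * g)
  EZ² = begin
    4 * E 1 2 (λ u → Z u * Z u)
      ≡⟨ cong (4 *_) (E-cong (λ u → trans (sym (∑-* (Z u) (λ x → term x u) xs))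
           (∑-cong xs (λ x → trans (*-comm (Z u) (term x u)) (sym (∑-* (term x u) (λ y → term y u) xs)))))) ⟩
    4 * E 1 2 (λ u → ∑ (λ x → ∑ (λ y → term x u * term y u) xs) xs)
      ≡⟨ cong (4 *_) (trans (E-∑ (λ x u → ∑ (λ y → term x u * term y u) xs) xs)
           (∑-cong xs (λ x → trans (E-∑ (λ y u → term x u * term y u) xs)
             (trans (∑-cong xs (Eterm x)) (∑-* (3 ^ N) (λ y → 3 ^ ∥ T x ∩ T y ∥) xs))))) ⟩
    4 * ∑ (λ x → 3 ^ N * ∑ (λ y → 3 ^ ∥ T x ∩ T y ∥) xs) xs
      ≡⟨ ∑-* 4 (λ x → 3 ^ N * ∑ (λ y → 3 ^ ∥ T x ∩ T y ∥) xs) xs ⟨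
    ∑ (λ x → 4 * (3 ^ N * ∑ (λ y → 3 ^ ∥ T x ∩ T y ∥) xs)) xs
      ≤⟨ ∑-mono-∈ xs (λ {x} x∈ → ≤-trans (≤-reflexive (lemma₄ 4 (3 ^ N) _)) (*-monoʳ-≤ (3 ^ N) (row x∈))) ⟩
    ∑ (λ _ → 3 ^ N * (5 * g)) xs   ≡⟨ ∑-const (3 ^ N * (5 * g)) xs ⟩
    g * (3 ^ N * (5 * g))          ≡⟨ lemma₅ g (3 ^ N) ⟩
    5 * 3 ^ N * (g * g)            ∎
    where
    lemma₄ : ∀ a b c → a * (b * c) ≡ b * (a * c)
    lemma₄ = solve-∀
    lemma₅ : ∀ g z → g * (z * (5 * g)) ≡ 5 * z * (g * g)
    lemma₅ = solve-∀

  -- Where some `T x` lies in `u` this is (Z - g)² ≥ 0, elsewhere Z = 0. In units of g², averaging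
  -- gives 2 ≤ 5/4 + P(hit), which is the bound 3/4; being linear in `hit`, it replaces the
  -- Cauchy-Schwarz inequality.
  pointwise : ∀ u → 2 * g * Z u ≤ Z u * Z u + g * g * hit u
  pointwise u with any? (λ x → T x ⊆? u) xs
  ... | yes _ = begin
    2 * g * Z u               ≤⟨ 2ab≤a²+b² g (Z u) ⟩
    g * g + Z u * Z u         ≡⟨ +-comm (g * g) _ ⟩
    Z u * Z u + g * g         ≡⟨ cong (Z u * Z u +_) (*-identityʳ (g * g)) ⟨
    Z u * Z u + g * g * 1     ∎
  ... | no ¬any = ≤-trans (≤-reflexive (trans (cong (2 * g *_) Z≡0) (*-zeroʳ (2 * g)))) z≤n
    where
    Z≡0 : Z u ≡ 0
    Z≡0 = n≤0⇒n≡0 (≤-trans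
      (∑-mono-∈ {g = λ _ → 0} xs (λ {x} x∈ → ≤-reflexive (trans
        (cong (3 ^ ∥ T x ∥ *_) (𝟙-false (T x ⊆? u) (λ T⊆u → ¬any (lose x∈ T⊆u)))) (*-zeroʳ (3 ^ ∥ T x ∥)))))
      (≤-reflexive (trans (∑-const 0 xs) (*-zeroʳ g))))

-- Residues left by a first random set

memberWithin : List (Subset N) → Subset N → Subset N
-- The encoding sums over all Z, also those without a member inside; the empty default meets every σ
-- in nothing and keeps the bounds valid there.
memberWithin []      Z = Sub.⊥
memberWithin (σ ∷ F) Z with σ ⊆? Z
... | yes _ = σ
... | no _  = memberWithin F Z

memberWithin-size : ∀ {n} (F : List (Subset N)) Z → (∀ {σ} → σ ∈ˡ F → ∥ σ ∥ ≤ n) → ∥ memberWithin F Z ∥ ≤ n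
memberWithin-size {N} []      Z h = subst (_≤ _) (sym (Sub.∣⊥∣≡0 N)) z≤n
memberWithin-size     (σ ∷ F) Z h with σ ⊆? Z
... | yes _ = h (here refl)
... | no _  = memberWithin-size F Z (h ∘ there)

memberWithin-∈ : ∀ (F : List (Subset N)) Z {σ} → σ ∈ˡ F → σ ⊆ Z → memberWithin F Z ∈ˡ F × memberWithin F Z ⊆ Z
memberWithin-∈ (τ ∷ F) Z σ∈ σ⊆Z with τ ⊆? Z
memberWithin-∈ (τ ∷ F) Z σ∈          σ⊆Z | yes τ⊆Z = here refl , τ⊆Z
memberWithin-∈ (τ ∷ F) Z (here refl) σ⊆Z | no τ⊈Z  = contradiction (λ {x} → σ⊆Z {x}) τ⊈Z
memberWithin-∈ (τ ∷ F) Z (there σ∈)  σ⊆Z | no _    = let (∈F , ⊆Z) = memberWithin-∈ F Z σ∈ σ⊆Z in there ∈F , ⊆Z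

module _ (F : List (Subset N)) where

  -- What a second random set still has to supply. The chosen member lies in `w ∪ σ`, so for `σ` in
  -- `F` its part outside `w` lies in `σ`, even when it is a member other than `σ`; this is how
  -- residues inherit spreadness.
  residue : Subset N → Subset N → Subset N
  residue w σ = memberWithin F (w ∪ σ) ∩ ∁ w

  module _ {σ : Subset N} (σ∈F : σ ∈ˡ F) (w : Subset N) where

    private
      ρ = memberWithin F (w ∪ σ)
      ρ∈F⊆Z : ρ ∈ˡ F × ρ ⊆ w ∪ σ
      ρ∈F⊆Z = memberWithin-∈ F (w ∪ σ) σ∈F (Sub.q⊆p∪q w σ)

    residue⊆ : residue w σ ⊆ σ
    residue⊆ x∈ with x∈ρ , x∈∁w ← Sub.x∈p∩q⁻ ρ (∁ w) x∈ =
      [ (λ x∈w → contradiction x∈w (Sub.x∈∁p⇒x∉p x∈∁w)) , (λ x∈σ → x∈σ) ]′ (Sub.x∈p∪q⁻ w σ (proj₂ ρ∈F⊆Z x∈ρ))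

    residue⊆-∩ : residue w σ ⊆ memberWithin F (w ∪ σ) ∩ σ
    residue⊆-∩ x∈ = Sub.x∈p∩q⁺ (Sub.p∩q⊆p ρ (∁ w) x∈ , residue⊆ x∈)

    residue-hit : ∀ {u} → residue w σ ⊆ u → Any (_⊆ w ∪ u) F
    residue-hit {u} T⊆u = lose (proj₁ ρ∈F⊆Z) ρ⊆
      where
      ρ⊆ : ρ ⊆ w ∪ u
      ρ⊆ {x} x∈ρ with x Sub.∈? w
      ... | yes x∈w = Sub.p⊆p∪q u x∈w
      ... | no x∉w  = Sub.q⊆p∪q w u (T⊆u (Sub.x∈p∩q⁺ (x∈ρ , Sub.x∉p⇒x∈∁p x∉w)))

  private
    L = length F

  -- The pair (w , σ) is counted at Z = w ∪ σ: at most 4 ^ ∥ σ ∥ of the (weighted) sets w lead to the same Z,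
  -- and Z alone determines the member ρ of F, which meets σ in at least k elements whenever the residue is large.
  large-residues : ∀ {n} s .{{_ : NonZero s}} k → Spread s L (λ σ → σ) F → (∀ {σ} → σ ∈ˡ F → ∥ σ ∥ ≤ n) →
    suc s ^ k * E 1 3 (λ w → ∑ (λ σ → 𝟙 (k ≤? ∥ residue w σ ∥)) F) ≤ 8 ^ n * (4 ^ N * L)
  large-residues {n} s k spread size = begin
    suc s ^ k * E 1 3 (λ w → ∑ (λ σ → large σ w) F)    ≡⟨ cong (suc s ^ k *_) (E-∑ large F) ⟩
    suc s ^ k * ∑ (λ σ → E 1 3 (large σ)) F            ≡⟨ ∑-* (suc s ^ k) (λ σ → E 1 3 (large σ)) F ⟨
    ∑ (λ σ → suc s ^ k * E 1 3 (large σ)) F            ≡⟨ ∑-cong F (λ σ → E-* (suc s ^ k) (large σ)) ⟨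
    ∑ (λ σ → E 1 3 (λ w → suc s ^ k * large σ w)) F    ≤⟨ ∑-mono-∈ F (λ σ∈F → E-mono (bound σ∈F)) ⟩
    ∑ (λ σ → E 1 3 (λ w → meet σ (w ∪ σ))) F        ≤⟨ ∑-mono F (λ σ → E-plant (meet σ) σ) ⟩
    ∑ (λ σ → 4 ^ ∥ σ ∥ * E 1 3 (meet σ)) F
      ≤⟨ ∑-mono-∈ F (λ {σ} σ∈F → *-monoˡ-≤ (E 1 3 (meet σ)) (^-monoʳ-≤ 4 (size σ∈F))) ⟩
    ∑ (λ σ → 4 ^ n * E 1 3 (meet σ)) F              ≡⟨ ∑-* (4 ^ n) (λ σ → E 1 3 (meet σ)) F ⟩
    4 ^ n * ∑ (λ σ → E 1 3 (meet σ)) F              ≡⟨ cong (4 ^ n *_) (E-∑ meet F) ⟨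
    4 ^ n * E 1 3 (λ Z → ∑ (λ σ → meet σ Z) F)      ≤⟨ *-monoʳ-≤ (4 ^ n) (E-mono total-meet) ⟩
    4 ^ n * E {N} 1 3 (λ _ → L * 2 ^ n)                ≡⟨ cong (4 ^ n *_) (E-const {N = N} (L * 2 ^ n)) ⟩
    4 ^ n * (4 ^ N * (L * 2 ^ n))                      ≡⟨ lemma (4 ^ n) (4 ^ N) L (2 ^ n) ⟩
    4 ^ n * 2 ^ n * (4 ^ N * L)                        ≡⟨ cong (_* (4 ^ N * L)) (^-distribʳ-* n 4 2) ⟨
    8 ^ n * (4 ^ N * L)                                ∎
    where
    open ≤-Reasoning
    large meet : Subset N → Subset N → ℕ
    large σ w = 𝟙 (k ≤? ∥ residue w σ ∥)
    meet σ Z = suc s ^ ∥ memberWithin F Z ∩ σ ∥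
    lemma : ∀ a b c d → a * (b * (c * d)) ≡ a * d * (b * c)
    lemma = solve-∀
    bound : ∀ {σ} → σ ∈ˡ F → ∀ w → suc s ^ k * large σ w ≤ meet σ (w ∪ σ)
    bound {σ} σ∈F w = *-𝟙-≤ (k ≤? ∥ residue w σ ∥)
      (λ k≤ → ^-monoʳ-≤ (suc s) (≤-trans k≤ (Sub.p⊆q⇒∣p∣≤∣q∣ (residue⊆-∩ σ∈F w))))
    total-meet : ∀ Z → ∑ (λ σ → meet σ Z) F ≤ L * 2 ^ n
    total-meet Z = ≤-trans (*-cancelˡ-≤ (s ^ ∥ ρ ∥) {{m^n≢0 s ∥ ρ ∥}} (begin
      -- With y = s the loss (y + s) / s per element of ρ is only 2, while each element of a large
      -- residue gains 1 + s.
      s ^ ∥ ρ ∥ * ∑ (λ σ → meet σ Z) F   ≤⟨ spread-moment s (λ σ → σ) F spread s ρ ⟩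
      L * (s + s) ^ ∥ ρ ∥                   ≡⟨ cong (λ z → L * (s + z) ^ ∥ ρ ∥) (+-identityʳ s) ⟨
      L * (2 * s) ^ ∥ ρ ∥                   ≡⟨ cong (L *_) (^-distribʳ-* ∥ ρ ∥ 2 s) ⟩
      L * (2 ^ ∥ ρ ∥ * s ^ ∥ ρ ∥)           ≡⟨ lemma′ L (2 ^ ∥ ρ ∥) (s ^ ∥ ρ ∥) ⟩
      s ^ ∥ ρ ∥ * (L * 2 ^ ∥ ρ ∥)           ∎))
      (*-monoʳ-≤ L (^-monoʳ-≤ 2 (memberWithin-size F Z size)))
      where
      ρ = memberWithin F Z
      lemma′ : ∀ a b c → a * (b * c) ≡ c * (a * b)
      lemma′ = solve-∀

  module _ {n : ℕ} (t k : ℕ) .{{_ : NonZero t}} (spread : Spread (2 * t) L (λ σ → σ) F)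
           (size : ∀ {σ} → σ ∈ˡ F → ∥ σ ∥ ≤ n) (nonempty : 0 < L)
           (few : 8 * 8 ^ n ≤ suc (2 * t) ^ k)
           (flat : ∀ {j} → j < k → 4 * (2 + t) ^ j ≤ 5 * t ^ j) where

    private
      instance
        2t≢0 : NonZero (2 * t)
        2t≢0 = m*n≢0 2 t
        L≢0 : NonZero L
        L≢0 = >-nonZero nonempty

      hit : Subset N → ℕ
      hit v = 𝟙 (any? (_⊆? v) F)

      b H : Subset N → ℕ
      b w = ∑ (λ σ → 𝟙 (k ≤? ∥ residue w σ ∥)) F
      H w = E 1 2 (λ u → hit (w ∪ u))

      -- The assumption `few` is made for this: its factor 8^n cancels the loss 4^n 2^n of
      -- `large-residues`, and its extra 8 leaves an average fraction of 1/8 of large residues.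
      E-b : 8 * E 1 3 b ≤ 4 ^ N * L
      E-b = *-cancelˡ-≤ (8 ^ n) {{m^n≢0 8 n}} (begin
        8 ^ n * (8 * E 1 3 b)      ≡⟨ lemma (8 ^ n) (E 1 3 b) ⟩
        8 * 8 ^ n * E 1 3 b        ≤⟨ *-monoˡ-≤ (E 1 3 b) few ⟩
        suc (2 * t) ^ k * E 1 3 b  ≤⟨ large-residues (2 * t) k spread size ⟩
        8 ^ n * (4 ^ N * L)        ∎)
        where
        open ≤-Reasoning
        lemma : ∀ x y → x * (8 * y) ≡ 8 * x * y
        lemma = solve-∀

      per-w : ∀ w → 3 * 3 ^ N * L ≤ 4 * L * H w + 6 * 3 ^ N * b w
      per-w w with 2 * b w ≤? L
      ... | no 2b≰L = begin
        3 * 3 ^ N * L                       ≤⟨ *-monoʳ-≤ (3 * 3 ^ N) (≰⇒≥ 2b≰L) ⟩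
        3 * 3 ^ N * (2 * b w)               ≡⟨ lemma (3 ^ N) (b w) ⟩
        6 * 3 ^ N * b w                     ≤⟨ m≤n+m _ (4 * L * H w) ⟩
        4 * L * H w + 6 * 3 ^ N * b w       ∎
        where
        open ≤-Reasoning
        lemma : ∀ x y → 3 * x * (2 * y) ≡ 6 * x * y
        lemma = solve-∀
      ... | yes 2b≤L = begin
        3 * 3 ^ N * L                       ≤⟨ *-monoˡ-≤ L (second-moment t (residue w) good good-spread good-flat good-nonempty) ⟩
        4 * E 1 2 (λ u → 𝟙 (any? (λ σ → residue w σ ⊆? u) good)) * L
          ≤⟨ *-monoˡ-≤ L (*-monoʳ-≤ 4 (E-mono (λ u → 𝟙-mono (any? (λ σ → residue w σ ⊆? u) good) (any? (_⊆? w ∪ u) F)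
               (λ p → let (σ , σ∈ , T⊆u) = find p in residue-hit (good⊆F σ∈) w T⊆u)))) ⟩
        4 * H w * L                         ≡⟨ lemma (H w) L ⟩
        4 * L * H w                         ≤⟨ m≤m+n _ _ ⟩
        4 * L * H w + 6 * 3 ^ N * b w       ∎
        where
        open ≤-Reasoning
        lemma : ∀ x y → 4 * x * y ≡ 4 * y * x
        lemma = solve-∀
        good : List (Subset N)
        good = filter (λ σ → ∥ residue w σ ∥ <? k) F
        g = length good
        good⊆F : ∀ {σ} → σ ∈ˡ good → σ ∈ˡ F
        good⊆F σ∈ = proj₁ (∈-filter⁻ (λ σ → ∥ residue w σ ∥ <? k) {xs = F} σ∈)
        complement : ∀ m → 𝟙 (m <? k) + 𝟙 (k ≤? m) ≡ 1
        complement m with ≤-<-connex k m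
        ... | inj₁ k≤m = cong₂ _+_ (𝟙-false (m <? k) (≤⇒≯ k≤m)) (𝟙-true (k ≤? m) k≤m)
        ... | inj₂ m<k = cong₂ _+_ (𝟙-true (m <? k) m<k) (𝟙-false (k ≤? m) (<⇒≱ m<k))
        g+b≡L : g + b w ≡ L
        g+b≡L = begin-equality
          g + b w       ≡⟨ cong (_+ b w) (length-filter-∑ (λ σ → ∥ residue w σ ∥ <? k) F) ⟩
          ∑ (λ σ → 𝟙 (∥ residue w σ ∥ <? k)) F + b w
                        ≡⟨ ∑-+ (λ σ → 𝟙 (∥ residue w σ ∥ <? k)) (λ σ → 𝟙 (k ≤? ∥ residue w σ ∥)) F ⟨
          ∑ (λ σ → 𝟙 (∥ residue w σ ∥ <? k) + 𝟙 (k ≤? ∥ residue w σ ∥)) F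
                        ≡⟨ ∑-cong F (λ σ → complement ∥ residue w σ ∥) ⟩
          ∑ (λ _ → 1) F ≡⟨ trans (∑-const 1 F) (*-identityʳ L) ⟩
          L             ∎
        L≤2g : L ≤ 2 * g
        L≤2g = +-cancelʳ-≤ (2 * b w) L (2 * g) (begin
          L + 2 * b w       ≤⟨ +-monoʳ-≤ L 2b≤L ⟩
          L + L             ≡⟨ cong₂ _+_ g+b≡L g+b≡L ⟨
          g + b w + (g + b w) ≡⟨ lemma′ g (b w) ⟩
          2 * g + 2 * b w   ∎)
          where
          lemma′ : ∀ x y → x + y + (x + y) ≡ 2 * x + 2 * y
          lemma′ = solve-∀
        good-nonempty : 0 < g
        good-nonempty with g in eq
        ... | suc _ = z<s
        ... | zero  = contradiction (subst (λ z → L ≤ 2 * z) eq L≤2g) (<⇒≱ nonempty)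
        good-flat : ∀ {σ} → σ ∈ˡ good → 4 * (2 + t) ^ ∥ residue w σ ∥ ≤ 5 * t ^ ∥ residue w σ ∥
        good-flat σ∈ = flat (proj₂ (∈-filter⁻ (λ σ → ∥ residue w σ ∥ <? k) {xs = F} σ∈))
        good-spread : Spread t g (residue w) good
        good-spread Q = halve-spread t ∥ Q ∥
          (≤-trans (∑-filter-≤ (λ σ → ∥ residue w σ ∥ <? k) (λ σ → 𝟙 (Q ⊆? residue w σ)) F)
            (∑-mono-∈ F (λ {σ} σ∈F → 𝟙-mono (Q ⊆? residue w σ) (Q ⊆? σ) (λ Q⊆ x∈ → residue⊆ σ∈F w (Q⊆ x∈)))))
          (≤-trans (∑-mono good (λ σ → 𝟙≤1 (Q ⊆? residue w σ))) (≤-reflexive (trans (∑-const 1 good) (*-identityʳ g))))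
          (spread Q) L≤2g

    -- The constant is 9/16 = 3/4 - (3/2)(1/8): `per-w` gives a probability of at least 3/4 - (3/2)
    -- b / L for each `w`, and `E-b` bounds the mean of b / L by 1/8.
    spread-lemma : 9 * 2 ^ N ≤ 16 * E 1 1 (λ v → 𝟙 (any? (_⊆? v) F))
    spread-lemma = *-cancelˡ-≤ (2 * (L * 6 ^ N)) {{m*n≢0 2 (L * 6 ^ N) {{_}} {{m*n≢0 L (6 ^ N) {{L≢0}} {{m^n≢0 6 N}}}}}}
      (+-cancelʳ-≤ (6 * (3 ^ N * (4 ^ N * L))) _ _ (begin
        2 * (L * 6 ^ N) * (9 * 2 ^ N) + 6 * (3 ^ N * (4 ^ N * L))
          ≡⟨ lemma₁ L (6 ^ N) (2 ^ N) (3 ^ N) (4 ^ N) ⟩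
        18 * (L * (6 ^ N * 2 ^ N)) + 6 * (3 ^ N * (4 ^ N * L))
          ≡⟨ cong (λ z → 18 * (L * z) + 6 * (3 ^ N * (4 ^ N * L))) (trans (sym (^-distribʳ-* N 6 2)) (^-distribʳ-* N 4 3)) ⟩
        18 * (L * (4 ^ N * 3 ^ N)) + 6 * (3 ^ N * (4 ^ N * L))
          ≡⟨ lemma₂ L (3 ^ N) (4 ^ N) ⟩
        8 * (4 ^ N * (3 * 3 ^ N * L))
          ≡⟨ cong (8 *_) (E-const {N = N} (3 * 3 ^ N * L)) ⟨
        8 * E {N} 1 3 (λ _ → 3 * 3 ^ N * L)
          ≤⟨ *-monoʳ-≤ 8 (E-mono per-w) ⟩
        8 * E 1 3 (λ w → 4 * L * H w + 6 * 3 ^ N * b w)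
          ≡⟨ cong (8 *_) (trans (E-+ (λ w → 4 * L * H w) (λ w → 6 * 3 ^ N * b w))
               (cong₂ _+_ (E-* (4 * L) H) (E-* (6 * 3 ^ N) b))) ⟩
        8 * (4 * L * E 1 3 H + 6 * 3 ^ N * E 1 3 b)
          ≡⟨ lemma₃ L (E 1 3 H) (3 ^ N) (E 1 3 b) ⟩
        32 * L * E 1 3 H + 6 * (3 ^ N * (8 * E 1 3 b))
          ≤⟨ +-mono-≤ (≤-reflexive (cong (32 * L *_) (E-coupling hit))) (*-monoʳ-≤ 6 (*-monoʳ-≤ (3 ^ N) E-b)) ⟩
        32 * L * (6 ^ N * E 1 1 hit) + 6 * (3 ^ N * (4 ^ N * L))
          ≡⟨ cong (_+ 6 * (3 ^ N * (4 ^ N * L))) (lemma₄ L (6 ^ N) (E 1 1 hit)) ⟩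
        2 * (L * 6 ^ N) * (16 * E 1 1 hit) + 6 * (3 ^ N * (4 ^ N * L)) ∎))
      where
      open ≤-Reasoning
      lemma₁ : ∀ l a b c d → 2 * (l * a) * (9 * b) + 6 * (c * (d * l)) ≡ 18 * (l * (a * b)) + 6 * (c * (d * l))
      lemma₁ = solve-∀
      lemma₂ : ∀ l c d → 18 * (l * (d * c)) + 6 * (c * (d * l)) ≡ 8 * (d * (3 * c * l))
      lemma₂ = solve-∀
      lemma₃ : ∀ l h c b → 8 * (4 * l * h + 6 * c * b) ≡ 32 * l * h + 6 * (c * (8 * b))
      lemma₃ = solve-∀
      lemma₄ : ∀ l a h → 32 * l * (a * h) ≡ 2 * (l * a) * (16 * h)
      lemma₄ = solve-∀

-- A uniformly random set contains a member of F, and its complement one of G, each with probability above 1/2.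
disjoint-members : (F G : List (Subset N)) →
  9 * 2 ^ N ≤ 16 * E 1 1 (λ v → 𝟙 (any? (_⊆? v) F)) →
  9 * 2 ^ N ≤ 16 * E 1 1 (λ v → 𝟙 (any? (_⊆? v) G)) →
  ∃[ σ ] ∃[ τ ] σ ∈ˡ F × τ ∈ˡ G × Sub.Empty (σ ∩ τ)
disjoint-members {N} F G hF hG = split (E-exists 1 (λ v → f v + g (∁ v)) total)
  where
  f g : Subset N → ℕ
  f v = 𝟙 (any? (_⊆? v) F)
  g v = 𝟙 (any? (_⊆? v) G)
  total : 2 ^ N * 1 < E 1 1 (λ v → f v + g (∁ v))
  total = *-cancelˡ-< 16 _ _ (begin-strict
    16 * (2 ^ N * 1)              <⟨ m<m+n (16 * (2 ^ N * 1)) (*-mono-≤ {1} {2} (s≤s z≤n) (m^n>0 2 N)) ⟩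
    16 * (2 ^ N * 1) + 2 * 2 ^ N  ≡⟨ lemma (2 ^ N) ⟩
    9 * 2 ^ N + 9 * 2 ^ N         ≤⟨ +-mono-≤ hF hG ⟩
    16 * E 1 1 f + 16 * E 1 1 g   ≡⟨ *-distribˡ-+ 16 (E 1 1 f) (E 1 1 g) ⟨
    16 * (E 1 1 f + E 1 1 g)      ≡⟨ cong (λ z → 16 * (E 1 1 f + z)) (E-∁ g) ⟨
    16 * (E 1 1 f + E 1 1 (g ∘ ∁)) ≡⟨ cong (16 *_) (E-+ f (g ∘ ∁)) ⟨
    16 * E 1 1 (λ v → f v + g (∁ v)) ∎)
    where
    open ≤-Reasoning
    lemma : ∀ x → 16 * (x * 1) + 2 * x ≡ 9 * x + 9 * x
    lemma = solve-∀
  split : (∃[ v ] 1 < f v + g (∁ v)) → ∃[ σ ] ∃[ τ ] σ ∈ˡ F × τ ∈ˡ G × Sub.Empty (σ ∩ τ)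
  split (v , h) with any? (_⊆? v) F | any? (_⊆? ∁ v) G
  split (v , s≤s ()) | yes _ | no _
  split (v , s≤s ()) | no _  | yes _
  split (v , ())     | no _  | no _
  ... | yes p | yes q = let (σ , σ∈ , σ⊆) = find p ; (τ , τ∈ , τ⊆) = find q in
    σ , τ , σ∈ , τ∈ , λ (x , x∈) → let (x∈σ , x∈τ) = Sub.x∈p∩q⁻ σ τ x∈ in
      Sub.x∈∁p⇒x∉p (τ⊆ x∈τ) (σ⊆ x∈σ)

-- Counting permutations

Distinct : List (Permutation′ n) → Set
Distinct {n} = USetoid.Unique (S n)

∑-allFin : ∀ (f : Fin (suc n) → ℕ) → ∑ f (allFin (suc n)) ≡ f zero + ∑ (f ∘ suc) (allFin n)
∑-allFin {n} f = cong (f zero +_) (cong (foldr _+_ 0)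
  (trans (map-tabulate suc f) (sym (map-tabulate (λ i → i) (f ∘ suc)))))

∑-𝟙-≟ : ∀ (k : Fin n) → ∑ (λ j → 𝟙 (k ≟ j)) (allFin n) ≡ 1
∑-𝟙-≟ {suc n} zero = trans (∑-allFin {n} (λ j → 𝟙 (zero ≟ j)))
  (cong suc (trans (∑-const 0 (allFin n)) (*-zeroʳ (length (allFin n)))))
∑-𝟙-≟ {suc n} (suc k) = trans (∑-allFin {n} (λ j → 𝟙 (suc k ≟ j))) (∑-𝟙-≟ k)

star : Fin n → Fin n → List (Permutation′ n) → List (Permutation′ n)
star i j = filter (λ σ → σ ⟨$⟩ʳ i ≟ j)

offStar : Fin n → Fin n → List (Permutation′ n) → List (Permutation′ n)
offStar i j = filter (λ σ → ¬? (σ ⟨$⟩ʳ i ≟ j))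

∈-star⁻ : ∀ {i j : Fin n} {L σ} → σ ∈ˡ star i j L → σ ∈ˡ L × σ ⟨$⟩ʳ i ≡ j
∈-star⁻ {i = i} {j} {L} = ∈-filter⁻ (λ σ → σ ⟨$⟩ʳ i ≟ j) {xs = L}

length-stars : ∀ (i : Fin n) L → length L ≡ ∑ (λ j → length (star i j L)) (allFin n)
length-stars {n} i L = begin
  length L                                                   ≡⟨ trans (∑-const 1 L) (*-identityʳ (length L)) ⟨
  ∑ (λ _ → 1) L                                              ≡⟨ ∑-cong L (λ σ → ∑-𝟙-≟ (σ ⟨$⟩ʳ i)) ⟨
  ∑ (λ σ → ∑ (λ j → 𝟙 (σ ⟨$⟩ʳ i ≟ j)) (allFin n)) L          ≡⟨ ∑-swap (λ σ j → 𝟙 (σ ⟨$⟩ʳ i ≟ j)) L (allFin n) ⟩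
  ∑ (λ j → ∑ (λ σ → 𝟙 (σ ⟨$⟩ʳ i ≟ j)) L) (allFin n)
    ≡⟨ ∑-cong (allFin n) (λ j → length-filter-∑ (λ σ → σ ⟨$⟩ʳ i ≟ j) L) ⟨
  ∑ (λ j → length (star i j L)) (allFin n)                   ∎
  where open ≡-Reasoning

length-stars-≤ : ∀ (i : Fin n) L M → (∀ j → length (star i j L) ≤ M) → length L ≤ n * M
length-stars-≤ {n} i L M h = begin
  length L                                   ≡⟨ length-stars i L ⟩
  ∑ (λ j → length (star i j L)) (allFin n)   ≤⟨ ∑-mono (allFin n) h ⟩
  ∑ (λ _ → M) (allFin n)                     ≡⟨ ∑-const M (allFin n) ⟩
  length (allFin n) * M                      ≡⟨ cong (_* M) (length-tabulate {n = n} (λ i → i)) ⟩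
  n * M                                      ∎
  where open ≤-Reasoning

star+offStar : ∀ (i j : Fin n) L → length (star i j L) + length (offStar i j L) ≡ length L
star+offStar i j []      = refl
star+offStar i j (σ ∷ L) with does (σ ⟨$⟩ʳ i ≟ j)
... | true  = cong suc (star+offStar i j L)
... | false = trans (+-suc _ _) (cong suc (star+offStar i j L))

filter-⊆-length : ∀ {p q} {P : Pred A p} {Q : Pred A q} (P? : Decidable P) (Q? : Decidable Q) →
  ∀ xs → length (filter P? (filter Q? xs)) ≤ length (filter P? xs)
filter-⊆-length P? Q? []       = z≤n
filter-⊆-length P? Q? (x ∷ xs) with does (Q? x)
... | false with does (P? x)
...   | true  = m≤n⇒m≤1+n (filter-⊆-length P? Q? xs)
...   | false = filter-⊆-length P? Q? xs
filter-⊆-length P? Q? (x ∷ xs) | true with does (P? x)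
...   | true  = s≤s (filter-⊆-length P? Q? xs)
...   | false = filter-⊆-length P? Q? xs

length≡0 : ∀ (xs : List A) → (∀ {x} → ¬ x ∈ˡ xs) → length xs ≡ 0
length≡0 []       h = refl
length≡0 (x ∷ xs) h = contradiction (here refl) h

offStar-bound : ∀ (i j : Fin n) L b M → (∀ j′ → j ≢ j′ → length (star i j′ L) * b ≤ M) → length (offStar i j L) * b ≤ n * M
offStar-bound {n} i j L b M h = begin
  length L′ * b                                  ≡⟨ cong (_* b) (length-stars i L′) ⟩
  ∑ (λ j′ → length (star i j′ L′)) (allFin n) * b ≡⟨ *-comm _ b ⟩
  b * ∑ (λ j′ → length (star i j′ L′)) (allFin n) ≡⟨ ∑-* b (λ j′ → length (star i j′ L′)) (allFin n) ⟨
  ∑ (λ j′ → b * length (star i j′ L′)) (allFin n) ≤⟨ ∑-mono (allFin n) bound ⟩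
  ∑ (λ _ → M) (allFin n)                         ≡⟨ ∑-const M (allFin n) ⟩
  length (allFin n) * M                          ≡⟨ cong (_* M) (length-tabulate {n = n} (λ i → i)) ⟩
  n * M                                          ∎
  where
  open ≤-Reasoning
  L′ = offStar i j L
  bound : ∀ j′ → b * length (star i j′ L′) ≤ M
  bound j′ with j ≟ j′
  ... | no j≢j′ = begin
    b * length (star i j′ L′)   ≤⟨ *-monoʳ-≤ b (filter-⊆-length (λ σ → σ ⟨$⟩ʳ i ≟ j′) (λ σ → ¬? (σ ⟨$⟩ʳ i ≟ j)) L) ⟩
    b * length (star i j′ L)    ≡⟨ *-comm b _ ⟩
    length (star i j′ L) * b    ≤⟨ h j′ j≢j′ ⟩
    M                           ∎
  ... | yes refl = begin
    b * length (star i j L′)    ≡⟨ cong (b *_) (length≡0 (star i j L′) (λ σ∈ → let (σ∈L′ , σi≡j) = ∈-star⁻ {L = L′} σ∈ in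
                                     proj₂ (∈-filter⁻ (λ σ → ¬? (σ ⟨$⟩ʳ i ≟ j)) {xs = L} σ∈L′) σi≡j)) ⟩
    b * 0                       ≡⟨ *-zeroʳ b ⟩
    0                           ≤⟨ z≤n ⟩
    M                           ∎

-- Injectivity is asked on `L` only, since `remove i` forgets the value at `i` and is injective only
-- within a star.
Distinct-map : ∀ {m} (f : Permutation′ n → Permutation′ m) L → (∀ {σ τ} → σ ∈ˡ L → τ ∈ˡ L → f σ ≈ f τ → σ ≈ τ) →
  Distinct L → Distinct (map f L)
Distinct-map f []      inj []       = []
Distinct-map f (σ ∷ L) inj (d ∷ ds) =
  All.map⁺ (All.tabulate (λ τ∈ fσ≈fτ → All.lookup d τ∈ (inj (here refl) (there τ∈) fσ≈fτ))) ∷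
  Distinct-map f L (λ σ∈ τ∈ → inj (there σ∈) (there τ∈)) ds

remove-injective : ∀ (i : Fin (suc n)) (σ τ : Permutation′ (suc n)) → σ ⟨$⟩ʳ i ≡ τ ⟨$⟩ʳ i →
  remove i σ ≈ remove i τ → σ ≈ τ
remove-injective i σ τ σi≡τi σ≈τ k with i ≟ k
... | yes refl = σi≡τi
... | no i≢k   = begin
  σ ⟨$⟩ʳ k                                              ≡⟨ cong (σ ⟨$⟩ʳ_) (punchIn-punchOut i≢k) ⟨
  σ ⟨$⟩ʳ punchIn i (punchOut i≢k)                       ≡⟨ punchIn-permute σ i (punchOut i≢k) ⟩
  punchIn (σ ⟨$⟩ʳ i) (remove i σ ⟨$⟩ʳ punchOut i≢k)     ≡⟨ cong₂ punchIn σi≡τi (σ≈τ (punchOut i≢k)) ⟩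
  punchIn (τ ⟨$⟩ʳ i) (remove i τ ⟨$⟩ʳ punchOut i≢k)     ≡⟨ punchIn-permute τ i (punchOut i≢k) ⟨
  τ ⟨$⟩ʳ punchIn i (punchOut i≢k)                       ≡⟨ cong (τ ⟨$⟩ʳ_) (punchIn-punchOut i≢k) ⟩
  τ ⟨$⟩ʳ k                                              ∎
  where open ≡-Reasoning

remove-agree : ∀ (i : Fin (suc n)) (σ τ : Permutation′ (suc n)) {k} → σ ⟨$⟩ʳ i ≡ τ ⟨$⟩ʳ i →
  σ ⟨$⟩ʳ punchIn i k ≡ τ ⟨$⟩ʳ punchIn i k → remove i σ ⟨$⟩ʳ k ≡ remove i τ ⟨$⟩ʳ k
remove-agree i σ τ {k} σi≡τi eq = punchIn-injective (σ ⟨$⟩ʳ i) _ _ (begin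
  punchIn (σ ⟨$⟩ʳ i) (remove i σ ⟨$⟩ʳ k)  ≡⟨ punchIn-permute σ i k ⟨
  σ ⟨$⟩ʳ punchIn i k                      ≡⟨ eq ⟩
  τ ⟨$⟩ʳ punchIn i k                      ≡⟨ punchIn-permute τ i k ⟩
  punchIn (τ ⟨$⟩ʳ i) (remove i τ ⟨$⟩ʳ k)  ≡⟨ cong (λ z → punchIn z (remove i τ ⟨$⟩ʳ k)) σi≡τi ⟨
  punchIn (σ ⟨$⟩ʳ i) (remove i τ ⟨$⟩ʳ k)  ∎)
  where open ≡-Reasoning

unpunch : ∀ (r : Fin (suc n)) {R} → All (r ≢_) R → ∃[ R′ ] map (punchIn r) R′ ≡ R
unpunch r []          = [] , refl
unpunch r (r≢x ∷ r≢R) = let (R′ , eq) = unpunch r r≢R in punchOut r≢x ∷ R′ , cong₂ _∷_ (punchIn-punchOut r≢x) eq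

Unique⇒length≤ : ∀ {R : List (Fin n)} → Unique R → length R ≤ n
Unique⇒length≤ {zero}  {[]}    _        = z≤n
Unique⇒length≤ {suc n} {[]}    _        = z≤n
Unique⇒length≤ {suc n} {r ∷ _} (d ∷ ds) with R′ , refl ← unpunch r d =
  s≤s (subst (_≤ n) (sym (length-map (punchIn r) R′)) (Unique⇒length≤ (Unique.map⁻ ds)))

Distinct-star : ∀ (i j : Fin (suc n)) {L} → Distinct L → Distinct (map (remove i) (star i j L))
Distinct-star {n} i j {L} d = Distinct-map (remove i) (star i j L)
  (λ {σ} {τ} σ∈ τ∈ → remove-injective i σ τ (trans (proj₂ (∈-star⁻ {L = L} σ∈)) (sym (proj₂ (∈-star⁻ {L = L} τ∈)))))
  (USetoid.filter⁺ (S (suc n)) (λ σ → σ ⟨$⟩ʳ i ≟ j) d)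

length-≤-! : ∀ {L : List (Permutation′ n)} → Distinct L → length L ≤ n !
length-≤-! {zero}  {[]}        _              = z≤n
length-≤-! {zero}  {_ ∷ []}    _              = ≤-refl
length-≤-! {zero}  {_ ∷ _ ∷ _} ((σ≉τ ∷ _) ∷ _) = contradiction (λ ()) σ≉τ
length-≤-! {suc n} {L}         d              = length-stars-≤ zero L (n !) (λ j →
  subst (_≤ n !) (length-map (remove zero) (star zero j L)) (length-≤-! (Distinct-star zero j d)))

-- Mutual agreement on `R`, rather than prescribed values there, is the form of the hypothesis that
-- survives the deletion of a common point together with its image.
length-≤-∸! : ∀ {L : List (Permutation′ n)} {R} → Distinct L → Unique R →
  (∀ {σ τ r} → σ ∈ˡ L → τ ∈ˡ L → r ∈ˡ R → σ ⟨$⟩ʳ r ≡ τ ⟨$⟩ʳ r) → length L ≤ (n ∸ length R) !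
length-≤-∸! {n}     {L} {[]}    d _        agree = length-≤-! d
length-≤-∸! {suc n} {L} {r ∷ _} d (u ∷ us) agree with R′ , refl ← unpunch r u = subst₂ (λ x y → x ≤ (n ∸ y) !)
  (length-map (remove r) L) (sym (length-map (punchIn r) R′))
  (length-≤-∸! (Distinct-map (remove r) L (λ {σ} {τ} σ∈ τ∈ → remove-injective r σ τ (agree σ∈ τ∈ (here refl))) d)
    (Unique.map⁻ us) agree′)
  where
  agree′ : ∀ {σ τ k} → σ ∈ˡ map (remove r) L → τ ∈ˡ map (remove r) L → k ∈ˡ R′ → σ ⟨$⟩ʳ k ≡ τ ⟨$⟩ʳ k
  agree′ σ∈ τ∈ k∈ with σ , σ∈L , refl ← ∈-map⁻ (remove r) σ∈ | τ , τ∈L , refl ← ∈-map⁻ (remove r) τ∈ =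
    remove-agree r σ τ (agree σ∈L τ∈L (here refl)) (agree σ∈L τ∈L (there (∈-map⁺ (punchIn r) k∈)))

-- Partial permutations as sets of cells

members : Subset N → List (Fin N)
members Vec.[]            = []
members (inside Vec.∷ p)  = zero ∷ map suc (members p)
members (outside Vec.∷ p) = map suc (members p)

length-members : ∀ (p : Subset N) → length (members p) ≡ ∥ p ∥
length-members Vec.[]            = refl
length-members (inside Vec.∷ p)  = cong suc (trans (length-map suc (members p)) (length-members p))
length-members (outside Vec.∷ p) = trans (length-map suc (members p)) (length-members p)

members-! : ∀ (p : Subset N) → Unique (members p)
members-! Vec.[]            = []
members-! (inside Vec.∷ p)  = All.map⁺ (All.tabulate (λ _ ())) ∷ Unique.map⁺ suc-injective (members-! p)
members-! (outside Vec.∷ p) = Unique.map⁺ suc-injective (members-! p)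

∈-members⁻ : ∀ (p : Subset N) {x} → x ∈ˡ members p → x Sub.∈ p
∈-members⁻ (inside Vec.∷ p)  (here refl) = here
∈-members⁻ (inside Vec.∷ p)  (there x∈) with y , y∈ , refl ← ∈-map⁻ suc x∈ = there (∈-members⁻ p y∈)
∈-members⁻ (outside Vec.∷ p) x∈         with y , y∈ , refl ← ∈-map⁻ suc x∈ = there (∈-members⁻ p y∈)

∈-members⁺ : ∀ {p : Subset N} {x} → x Sub.∈ p → x ∈ˡ members p
∈-members⁺ {p = inside Vec.∷ p}  here       = here refl
∈-members⁺ {p = inside Vec.∷ p}  (there x∈) = there (∈-map⁺ suc (∈-members⁺ x∈))
∈-members⁺ {p = outside Vec.∷ p} (there x∈) = ∈-map⁺ suc (∈-members⁺ x∈)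

row col : Fin (n * n) → Fin n
row {n} e = proj₁ (remQuot {n} n e)
col {n} e = proj₂ (remQuot {n} n e)

graph : Permutation′ n → Subset (n * n)
graph {n} σ = Vec.tabulate (λ e → does (σ ⟨$⟩ʳ row {n} e ≟ col {n} e))

∈-graph⁻ : ∀ (σ : Permutation′ n) {e} → e Sub.∈ graph σ → σ ⟨$⟩ʳ row {n} e ≡ col {n} e
∈-graph⁻ {n} σ {e} e∈ = witness (σ ⟨$⟩ʳ row {n} e ≟ col {n} e) (trans (sym (lookup∘tabulate (λ e → does (σ ⟨$⟩ʳ row {n} e ≟ col {n} e)) e)) ([]=⇒lookup e∈))
  where
  witness : ∀ {p} {P : Set p} (P? : Dec P) → does P? ≡ true → P
  witness (yes p) _ = p

∈-graph⁺ : ∀ (σ : Permutation′ n) {e} → σ ⟨$⟩ʳ row {n} e ≡ col {n} e → e Sub.∈ graph σ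
∈-graph⁺ {n} σ {e} eq = lookup⇒[]= e (graph σ) (trans (lookup∘tabulate (λ e → does (σ ⟨$⟩ʳ row {n} e ≟ col {n} e)) e) (dec-true (σ ⟨$⟩ʳ row {n} e ≟ col {n} e) eq))

graph-combine : ∀ (σ : Permutation′ n) i → combine i (σ ⟨$⟩ʳ i) Sub.∈ graph σ
graph-combine {n} σ i = ∈-graph⁺ σ (subst (λ p → σ ⟨$⟩ʳ proj₁ p ≡ proj₂ p) (sym (remQuot-combine {n} i (σ ⟨$⟩ʳ i))) refl)

rows-! : ∀ (σ : Permutation′ n) {X} → X ⊆ graph σ → Unique (map (row {n}) (members X))
rows-! {n} σ {X} X⊆ = go (members X) (λ e∈ → ∈-graph⁻ σ (X⊆ (∈-members⁻ X e∈))) (members-! X)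
  where
  row-injective : ∀ {e e′} → σ ⟨$⟩ʳ row {n} e ≡ col {n} e → σ ⟨$⟩ʳ row {n} e′ ≡ col {n} e′ → row {n} e ≡ row {n} e′ → e ≡ e′
  row-injective {e} {e′} h h′ eq = begin
    e                                  ≡⟨ combine-remQuot {n} n e ⟨
    combine (row {n} e) (col {n} e)    ≡⟨ cong₂ combine eq (trans (sym h) (trans (cong (σ ⟨$⟩ʳ_) eq) h′)) ⟩
    combine (row {n} e′) (col {n} e′)  ≡⟨ combine-remQuot {n} n e′ ⟩
    e′                                 ∎
    where open ≡-Reasoning
  go : ∀ es → (∀ {e} → e ∈ˡ es → σ ⟨$⟩ʳ row {n} e ≡ col {n} e) → Unique es → Unique (map (row {n}) es)
  go []       h []       = []
  go (e ∷ es) h (u ∷ us) = All.map⁺ (All.tabulate (λ e′∈ eq → All.lookup u e′∈ (row-injective (h (here refl)) (h (there e′∈)) eq)))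
                         ∷ go es (h ∘ there) us

graph-⊆-size : ∀ (σ : Permutation′ n) {X} → X ⊆ graph σ → ∥ X ∥ ≤ n
graph-⊆-size {n} σ {X} X⊆ = subst (_≤ n) (trans (length-map (row {n}) (members X)) (length-members X))
  (Unique⇒length≤ (rows-! σ X⊆))

extensions-≤-! : ∀ {L : List (Permutation′ n)} → Distinct L → ∀ X → length (filter (λ σ → X ⊆? graph σ) L) ≤ (n ∸ ∥ X ∥) !
extensions-≤-! {n} {L} d X = bound (filter (λ σ → X ⊆? graph σ) L) (USetoid.filter⁺ (S n) (λ σ → X ⊆? graph σ) d)
  (λ σ∈ → proj₂ (∈-filter⁻ (λ σ → X ⊆? graph σ) {xs = L} σ∈))
  where
  bound : ∀ M → Distinct M → (∀ {σ} → σ ∈ˡ M → X ⊆ graph σ) → length M ≤ (n ∸ ∥ X ∥) !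
  bound []      _ _ = z≤n
  -- A member is needed here: only because `X` lies in its graph does `X` have at most one cell in
  -- each row, so that its rows are |X| distinct points.
  bound (σ ∷ M) d h = subst (λ m → suc (length M) ≤ (n ∸ m) !) (trans (length-map (row {n}) (members X)) (length-members X))
    (length-≤-∸! d (rows-! σ (h (here refl))) agree)
    where
    agree : ∀ {σ′ τ r} → σ′ ∈ˡ σ ∷ M → τ ∈ˡ σ ∷ M → r ∈ˡ map (row {n}) (members X) → σ′ ⟨$⟩ʳ r ≡ τ ⟨$⟩ʳ r
    agree {σ′} {τ} σ∈ τ∈ r∈ with e , e∈ , refl ← ∈-map⁻ (row {n}) r∈ =
      trans (∈-graph⁻ σ′ (h σ∈ (∈-members⁻ X e∈))) (sym (∈-graph⁻ τ (h τ∈ (∈-members⁻ X e∈))))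

-- Elementary inequalities

-- Bernoulli's inequality (1 - b / (a + b)) ^ j ≥ 1 - j b / (a + b), cleared of denominators and subtraction.
bernoulli : ∀ a b j → (a + b) ^ j * (a + b) ≤ (a + b) * a ^ j + j * b * (a + b) ^ j
bernoulli a b zero    = ≤-reflexive (lemma (a + b))
  where
  lemma : ∀ c → 1 * c ≡ c * 1 + 0
  lemma = solve-∀
bernoulli a b (suc j) = begin
  c * c ^ j * c                                      ≡⟨ lemma₁ c (c ^ j) ⟩
  c * (c ^ j * c)                                    ≤⟨ *-monoʳ-≤ c (bernoulli a b j) ⟩
  c * (c * a ^ j + j * b * c ^ j)                    ≡⟨ lemma₂ a b (a ^ j) j (c ^ j) ⟩
  c * (a * a ^ j) + c * (j * b * c ^ j) + b * (c * a ^ j)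
    ≤⟨ +-monoʳ-≤ (c * (a * a ^ j) + c * (j * b * c ^ j)) (*-monoʳ-≤ b (*-monoʳ-≤ c (^-monoˡ-≤ j (m≤m+n a b)))) ⟩
  c * (a * a ^ j) + c * (j * b * c ^ j) + b * (c * c ^ j) ≡⟨ lemma₃ a b (a ^ j) j (c ^ j) ⟩
  c * (a * a ^ j) + suc j * b * (c * c ^ j)          ∎
  where
  open ≤-Reasoning
  c = a + b
  lemma₁ : ∀ c x → c * x * c ≡ c * (x * c)
  lemma₁ = solve-∀
  lemma₂ : ∀ a b x j y → (a + b) * ((a + b) * x + j * b * y) ≡ (a + b) * (a * x) + (a + b) * (j * b * y) + b * ((a + b) * x)
  lemma₂ = solve-∀
  lemma₃ : ∀ a b x j y → (a + b) * (a * x) + (a + b) * (j * b * y) + b * ((a + b) * y) ≡ (a + b) * (a * x) + (1 + j) * b * ((a + b) * y)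
  lemma₃ = solve-∀

4[2+t]^j≤5t^j : ∀ t j → 10 * j ≤ 2 + t → 4 * (2 + t) ^ j ≤ 5 * t ^ j
4[2+t]^j≤5t^j t j h = *-cancelˡ-≤ (2 + t) (+-cancelʳ-≤ (c * c ^ j) _ _ (begin
  c * (4 * c ^ j) + c * c ^ j                   ≡⟨ lemma₁ c (c ^ j) ⟩
  5 * (c ^ j * c)                               ≤⟨ *-monoʳ-≤ 5 (subst (λ c → c ^ j * c ≤ c * t ^ j + j * 2 * c ^ j) (+-comm t 2) (bernoulli t 2 j)) ⟩
  5 * (c * t ^ j + j * 2 * c ^ j)               ≡⟨ lemma₂ c (t ^ j) j (c ^ j) ⟩
  c * (5 * t ^ j) + 10 * j * c ^ j              ≤⟨ +-monoʳ-≤ (c * (5 * t ^ j)) (*-monoˡ-≤ (c ^ j) h) ⟩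
  c * (5 * t ^ j) + c * c ^ j                   ∎))
  where
  open ≤-Reasoning
  c = 2 + t
  lemma₁ : ∀ c x → c * (4 * x) + c * x ≡ 5 * (x * c)
  lemma₁ = solve-∀
  lemma₂ : ∀ c x j y → 5 * (c * x + j * 2 * y) ≡ c * (5 * x) + 10 * j * y
  lemma₂ = solve-∀

[1+m]^j≤2m^j : ∀ m j → 2 * j ≤ 1 + m → (1 + m) ^ j ≤ 2 * m ^ j
[1+m]^j≤2m^j m j h = *-cancelˡ-≤ (1 + m) (+-cancelʳ-≤ (c * c ^ j) _ _ (begin
  c * c ^ j + c * c ^ j                 ≡⟨ lemma₁ c (c ^ j) ⟩
  2 * (c ^ j * c)                       ≤⟨ *-monoʳ-≤ 2 (subst (λ c → c ^ j * c ≤ c * m ^ j + j * 1 * c ^ j) (+-comm m 1) (bernoulli m 1 j)) ⟩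
  2 * (c * m ^ j + j * 1 * c ^ j)       ≡⟨ lemma₂ c (m ^ j) j (c ^ j) ⟩
  c * (2 * m ^ j) + 2 * j * c ^ j       ≤⟨ +-monoʳ-≤ (c * (2 * m ^ j)) (*-monoˡ-≤ (c ^ j) h) ⟩
  c * (2 * m ^ j) + c * c ^ j           ∎))
  where
  open ≤-Reasoning
  c = 1 + m
  lemma₁ : ∀ c x → c * x + c * x ≡ 2 * (x * c)
  lemma₁ = solve-∀
  lemma₂ : ∀ c x j y → 2 * (c * x + j * 1 * y) ≡ c * (2 * x) + 2 * j * y
  lemma₂ = solve-∀

-- Bernoulli's inequality is too weak for j close to m, where its defect approaches 1. After halving
-- the exponent the defect is at most 1/2, and each half costs a factor 2; the resulting 4 stands in
-- for e.
[1+m]^j≤4m^j : ∀ m {j} → j ≤ m → (1 + m) ^ j ≤ 4 * m ^ j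
[1+m]^j≤4m^j m {j} j≤m = begin
  (1 + m) ^ j                                   ≡⟨ cong ((1 + m) ^_) (⌊n/2⌋+⌈n/2⌉≡n j) ⟨
  (1 + m) ^ (⌊ j /2⌋ + ⌈ j /2⌉)                 ≡⟨ ^-distribˡ-+-* (1 + m) ⌊ j /2⌋ ⌈ j /2⌉ ⟩
  (1 + m) ^ ⌊ j /2⌋ * (1 + m) ^ ⌈ j /2⌉         ≤⟨ *-mono-≤ ([1+m]^j≤2m^j m ⌊ j /2⌋ (≤-trans (*-monoʳ-≤ 2 (⌊n/2⌋≤⌈n/2⌉ j)) half))
                                                            ([1+m]^j≤2m^j m ⌈ j /2⌉ half) ⟩
  2 * m ^ ⌊ j /2⌋ * (2 * m ^ ⌈ j /2⌉)           ≡⟨ lemma (m ^ ⌊ j /2⌋) (m ^ ⌈ j /2⌉) ⟩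
  4 * (m ^ ⌊ j /2⌋ * m ^ ⌈ j /2⌉)               ≡⟨ cong (4 *_) (^-distribˡ-+-* m ⌊ j /2⌋ ⌈ j /2⌉) ⟨
  4 * m ^ (⌊ j /2⌋ + ⌈ j /2⌉)                   ≡⟨ cong (λ z → 4 * m ^ z) (⌊n/2⌋+⌈n/2⌉≡n j) ⟩
  4 * m ^ j                                     ∎
  where
  open ≤-Reasoning
  lemma : ∀ x y → 2 * x * (2 * y) ≡ 4 * (x * y)
  lemma = solve-∀
  half : 2 * ⌈ j /2⌉ ≤ 1 + m
  half = begin
    ⌈ j /2⌉ + (⌈ j /2⌉ + 0)      ≡⟨ cong (⌈ j /2⌉ +_) (+-identityʳ ⌈ j /2⌉) ⟩
    ⌊ suc j /2⌋ + ⌈ j /2⌉        ≤⟨ +-monoʳ-≤ ⌊ suc j /2⌋ (⌈n/2⌉-mono (n≤1+n j)) ⟩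
    ⌊ suc j /2⌋ + ⌈ suc j /2⌉    ≡⟨ ⌊n/2⌋+⌈n/2⌉≡n (suc j) ⟩
    suc j                        ≤⟨ s≤s j≤m ⟩
    1 + m                        ∎

-- This is the spreadness, with parameter n / 4, of the full symmetric group: (n - ℓ)! permutations
-- extend a partial permutation of size ℓ. Lowering the base of the power from n to n - 1 costs a
-- factor 4 for each of the ℓ values.
n^ℓ[n∸ℓ]!≤4^ℓn! : ∀ n {ℓ} → ℓ ≤ n → n ^ ℓ * (n ∸ ℓ) ! ≤ 4 ^ ℓ * n !
n^ℓ[n∸ℓ]!≤4^ℓn! n       {zero}  _         = ≤-refl
n^ℓ[n∸ℓ]!≤4^ℓn! (suc n) {suc ℓ} (s≤s ℓ≤n) = begin
  suc n * suc n ^ ℓ * (n ∸ ℓ) !          ≤⟨ *-monoˡ-≤ ((n ∸ ℓ) !) (*-monoʳ-≤ (suc n) ([1+m]^j≤4m^j n ℓ≤n)) ⟩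
  suc n * (4 * n ^ ℓ) * (n ∸ ℓ) !        ≡⟨ lemma₁ (suc n) (n ^ ℓ) ((n ∸ ℓ) !) ⟩
  4 * suc n * (n ^ ℓ * (n ∸ ℓ) !)        ≤⟨ *-monoʳ-≤ (4 * suc n) (n^ℓ[n∸ℓ]!≤4^ℓn! n ℓ≤n) ⟩
  4 * suc n * (4 ^ ℓ * n !)              ≡⟨ lemma₂ (suc n) (4 ^ ℓ) (n !) ⟩
  4 * 4 ^ ℓ * (suc n * n !)              ∎
  where
  open ≤-Reasoning
  lemma₁ : ∀ a b c → a * (4 * b) * c ≡ 4 * a * (b * c)
  lemma₁ = solve-∀
  lemma₂ : ∀ a b c → 4 * a * (b * c) ≡ 4 * b * (a * c)
  lemma₂ = solve-∀

-- If ℓ values can be prescribed at a gain of r ≤ n / 8 per value then ℓ is at most logarithmic.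
2^ℓ≤M : ∀ n r .{{_ : NonZero r}} M {ℓ} → ℓ ≤ n → 8 * r ≤ n → n ! ≤ M * (r ^ ℓ * (n ∸ ℓ) !) → 2 ^ ℓ ≤ M
2^ℓ≤M n r M {ℓ} ℓ≤n 8r≤n h =
  *-cancelˡ-≤ (4 ^ ℓ * (r ^ ℓ * (n ∸ ℓ) !)) {{m*n≢0 (4 ^ ℓ) _ {{m^n≢0 4 ℓ}} {{m*n≢0 (r ^ ℓ) _ {{m^n≢0 r ℓ}} {{(n ∸ ℓ) !≢0}}}}}} (begin
  4 ^ ℓ * (r ^ ℓ * (n ∸ ℓ) !) * 2 ^ ℓ       ≡⟨ lemma₁ (4 ^ ℓ) (r ^ ℓ) ((n ∸ ℓ) !) (2 ^ ℓ) ⟩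
  4 ^ ℓ * 2 ^ ℓ * r ^ ℓ * (n ∸ ℓ) !         ≡⟨ cong (λ z → z * r ^ ℓ * (n ∸ ℓ) !) (^-distribʳ-* ℓ 4 2) ⟨
  8 ^ ℓ * r ^ ℓ * (n ∸ ℓ) !                 ≡⟨ cong (_* (n ∸ ℓ) !) (^-distribʳ-* ℓ 8 r) ⟨
  (8 * r) ^ ℓ * (n ∸ ℓ) !                   ≤⟨ *-monoˡ-≤ ((n ∸ ℓ) !) (^-monoˡ-≤ ℓ 8r≤n) ⟩
  n ^ ℓ * (n ∸ ℓ) !                         ≤⟨ n^ℓ[n∸ℓ]!≤4^ℓn! n ℓ≤n ⟩
  4 ^ ℓ * n !                               ≤⟨ *-monoʳ-≤ (4 ^ ℓ) h ⟩
  4 ^ ℓ * (M * (r ^ ℓ * (n ∸ ℓ) !))         ≡⟨ lemma₂ (4 ^ ℓ) M (r ^ ℓ * (n ∸ ℓ) !) ⟩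
  4 ^ ℓ * (r ^ ℓ * (n ∸ ℓ) !) * M           ∎)
  where
  open ≤-Reasoning
  lemma₁ : ∀ a b c d → a * (b * c) * d ≡ a * d * b * c
  lemma₁ = solve-∀
  lemma₂ : ∀ a b c → a * (b * c) ≡ a * c * b
  lemma₂ = solve-∀

-- Links of densest partial permutations

∑-pigeonhole : ∀ (f : A → ℕ) x xs → ∃[ y ] ∑ f (x ∷ xs) ≤ suc (length xs) * f y
∑-pigeonhole f x []        = x , ≤-refl
∑-pigeonhole f x (x′ ∷ xs) with ∑-pigeonhole f x′ xs
... | y , h with ≤-total (f x) (f y)
... | inj₁ fx≤fy = y , +-mono-≤ fx≤fy h
... | inj₂ fy≤fx = x , +-monoʳ-≤ (f x) (≤-trans h (*-monoʳ-≤ (suc (length xs)) fy≤fx))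

maximum : ∀ (f : Subset N → ℕ) → ∃[ X ] ∀ Y → f Y ≤ f X
maximum {zero}  f = Vec.[] , λ { Vec.[] → ≤-refl }
maximum {suc N} f with maximum (f ∘ (inside Vec.∷_)) | maximum (f ∘ (outside Vec.∷_))
... | X , maxX | Y , maxY with ≤-total (f (inside Vec.∷ X)) (f (outside Vec.∷ Y))
... | inj₁ X≤Y = outside Vec.∷ Y , λ { (inside Vec.∷ Z) → ≤-trans (maxX Z) X≤Y ; (outside Vec.∷ Z) → maxY Z }
... | inj₂ Y≤X = inside Vec.∷ X , λ { (inside Vec.∷ Z) → maxX Z ; (outside Vec.∷ Z) → ≤-trans (maxY Z) Y≤X }

∣p∪q∣≡∣p∣+∣q∣ : ∀ (p q : Subset N) → Sub.Empty (p ∩ q) → ∥ p ∪ q ∥ ≡ ∥ p ∥ + ∥ q ∥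
∣p∪q∣≡∣p∣+∣q∣ Vec.[] Vec.[] _ = refl
∣p∪q∣≡∣p∣+∣q∣ (inside Vec.∷ p) (inside Vec.∷ q) h = contradiction (zero , here) h
∣p∪q∣≡∣p∣+∣q∣ (inside Vec.∷ p) (outside Vec.∷ q) h = cong suc (∣p∪q∣≡∣p∣+∣q∣ p q (Sub.drop-∷-Empty h))
∣p∪q∣≡∣p∣+∣q∣ (outside Vec.∷ p) (inside Vec.∷ q) h =
  trans (cong suc (∣p∪q∣≡∣p∣+∣q∣ p q (Sub.drop-∷-Empty h))) (sym (+-suc ∥ p ∥ ∥ q ∥))
∣p∪q∣≡∣p∣+∣q∣ (outside Vec.∷ p) (outside Vec.∷ q) h = ∣p∪q∣≡∣p∣+∣q∣ p q (Sub.drop-∷-Empty h)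

extensions : Subset (n * n) → List (Permutation′ n) → List (Permutation′ n)
extensions X = filter (λ σ → X ⊆? graph σ)

avoiding : Subset (n * n) → List (Permutation′ n) → List (Permutation′ n)
avoiding X = filter (λ σ → ¬? (nonempty? (graph σ ∩ X)))

∈-extensions⁻ : ∀ {X : Subset (n * n)} {L : List (Permutation′ n)} {σ} → σ ∈ˡ extensions X L → σ ∈ˡ L × X ⊆ graph σ
∈-extensions⁻ {X = X} {L} = ∈-filter⁻ (λ σ → X ⊆? graph σ) {xs = L}

∈-avoiding⁻ : ∀ {X : Subset (n * n)} {L : List (Permutation′ n)} {σ} → σ ∈ˡ avoiding X L → σ ∈ˡ L × Sub.Empty (graph σ ∩ X)
∈-avoiding⁻ {X = X} {L} = ∈-filter⁻ (λ σ → ¬? (nonempty? (graph σ ∩ X))) {xs = L}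

starAt : Fin (n * n) → List (Permutation′ n) → List (Permutation′ n)
starAt {n} e = star (row {n} e) (col {n} e)

-- The union bound over the cells of `X`.
length-avoiding : ∀ (X : Subset (n * n)) L →
  length L ≤ length (avoiding X L) + ∑ (λ e → length (starAt e L)) (members X)
length-avoiding {n} X L = begin
  length L                                     ≡⟨ trans (∑-const 1 L) (*-identityʳ (length L)) ⟨
  ∑ (λ _ → 1) L                                ≤⟨ ∑-mono L pointwise ⟩
  ∑ (λ σ → avoids σ + ∑ (λ e → at e σ) (members X)) L
    ≡⟨ ∑-+ avoids (λ σ → ∑ (λ e → at e σ) (members X)) L ⟩
  ∑ avoids L + ∑ (λ σ → ∑ (λ e → at e σ) (members X)) L
    ≡⟨ cong₂ _+_ (sym (length-filter-∑ (λ σ → ¬? (nonempty? (graph σ ∩ X))) L)) (∑-swap (λ σ e → at e σ) L (members X)) ⟩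
  length (avoiding X L) + ∑ (λ e → ∑ (at e) L) (members X)
    ≡⟨ cong (length (avoiding X L) +_) (∑-cong (members X) (λ e → length-filter-∑ (λ σ → σ ⟨$⟩ʳ row {n} e ≟ col {n} e) L)) ⟨
  length (avoiding X L) + ∑ (λ e → length (starAt e L)) (members X) ∎
  where
  open ≤-Reasoning
  avoids : Permutation′ n → ℕ
  avoids σ = 𝟙 (¬? (nonempty? (graph σ ∩ X)))
  at : Fin (n * n) → Permutation′ n → ℕ
  at e σ = 𝟙 (σ ⟨$⟩ʳ row {n} e ≟ col {n} e)
  pointwise : ∀ σ → 1 ≤ avoids σ + ∑ (λ e → at e σ) (members X)
  pointwise σ with nonempty? (graph σ ∩ X)
  ... | no _          = m≤m+n 1 _
  ... | yes (e , e∈) = let (e∈σ , e∈X) = Sub.x∈p∩q⁻ (graph σ) X e∈ in begin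
    1                                 ≡⟨ 𝟙-true (σ ⟨$⟩ʳ row {n} e ≟ col {n} e) (∈-graph⁻ σ e∈σ) ⟨
    at e σ                            ≤⟨ ∑-term (λ e → at e σ) (∈-members⁺ e∈X) ⟩
    ∑ (λ e → at e σ) (members X)     ∎

module Densest (r : ℕ) .{{_ : NonZero r}} (L : List (Permutation′ n)) where

  weight : Subset (n * n) → ℕ
  weight X = r ^ ∥ X ∥ * length (extensions X L)

  core : Subset (n * n)
  core = proj₁ (maximum weight)

  link : List (Permutation′ n)
  link = extensions core L

  length≤ : length L ≤ r ^ ∥ core ∥ * length link
  length≤ = begin
    length L                                 ≡⟨ cong length (filter-all (λ σ → Sub.⊥ ⊆? graph σ) (All.tabulate {xs = L} (λ {σ} _ → Sub.⊥⊆ {p = graph σ}))) ⟨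
    length (extensions Sub.⊥ L)              ≡⟨ *-identityˡ _ ⟨
    r ^ 0 * length (extensions Sub.⊥ L)      ≡⟨ cong (λ z → r ^ z * length (extensions Sub.⊥ L)) (Sub.∣⊥∣≡0 (n * n)) ⟨
    weight Sub.⊥                             ≤⟨ proj₂ (maximum weight) Sub.⊥ ⟩
    weight core                              ∎
    where open ≤-Reasoning

  maximal : ∀ Q → Sub.Empty (core ∩ Q) → r ^ ∥ Q ∥ * length (extensions (core ∪ Q) L) ≤ length link
  maximal Q disj = *-cancelˡ-≤ (r ^ ∥ core ∥) {{m^n≢0 r ∥ core ∥}} (begin
    r ^ ∥ core ∥ * (r ^ ∥ Q ∥ * length (extensions (core ∪ Q) L))  ≡⟨ *-assoc (r ^ ∥ core ∥) (r ^ ∥ Q ∥) _ ⟨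
    r ^ ∥ core ∥ * r ^ ∥ Q ∥ * length (extensions (core ∪ Q) L)    ≡⟨ cong (_* length (extensions (core ∪ Q) L)) (^-distribˡ-+-* r ∥ core ∥ ∥ Q ∥) ⟨
    r ^ (∥ core ∥ + ∥ Q ∥) * length (extensions (core ∪ Q) L)      ≡⟨ cong (λ z → r ^ z * length (extensions (core ∪ Q) L)) (∣p∪q∣≡∣p∣+∣q∣ core Q disj) ⟨
    weight (core ∪ Q)                                              ≤⟨ proj₂ (maximum weight) (core ∪ Q) ⟩
    weight core                                                    ∎)
    where open ≤-Reasoning

  -- An arbitrary property forcing `Q` into the graph lets the maximality of the core serve twice:
  -- for traces containing `Q`, and for the star of a single cell outside the core.
  link-count : ∀ Q {p} {P : Permutation′ n → Set p} (P? : Decidable P) → Sub.Empty (core ∩ Q) →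
    (∀ {σ} → P σ → Q ⊆ graph σ) → r ^ ∥ Q ∥ * ∑ (λ σ → 𝟙 (P? σ)) link ≤ length link
  link-count Q P? disj h = ≤-trans (*-monoʳ-≤ (r ^ ∥ Q ∥) (begin
    ∑ (λ σ → 𝟙 (P? σ)) link                       ≤⟨ ∑-mono-∈ link (λ {σ} σ∈ → 𝟙-mono (P? σ) (core ∪ Q ⊆? graph σ)
                                                       (λ Pσ x∈ → [ proj₂ (∈-extensions⁻ {X = core} {L = L} σ∈) , h Pσ ]′ (Sub.x∈p∪q⁻ core Q x∈))) ⟩
    ∑ (λ σ → 𝟙 (core ∪ Q ⊆? graph σ)) link        ≤⟨ ∑-filter-≤ (λ σ → core ⊆? graph σ) (λ σ → 𝟙 (core ∪ Q ⊆? graph σ)) L ⟩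
    ∑ (λ σ → 𝟙 (core ∪ Q ⊆? graph σ)) L           ≡⟨ length-filter-∑ (λ σ → core ∪ Q ⊆? graph σ) L ⟨
    length (extensions (core ∪ Q) L)              ∎)) (maximal Q disj)
    where open ≤-Reasoning

  module _ (distinct : Distinct L) (8r≤n : 8 * r ≤ n) (M : ℕ) (large : n ! ≤ M * length L) where

    private
      bound : n ! ≤ M * (r ^ ∥ core ∥ * length link)
      bound = ≤-trans large (*-monoʳ-≤ M length≤)

    link-nonempty : 0 < length link
    link-nonempty with length link in eq
    ... | suc _ = z<s
    ... | zero  = contradiction bound (<⇒≱ (subst (_< n !) (sym z≡0) (n>0 (n !) {{n !≢0}})))
      where
      n>0 : ∀ m .{{_ : NonZero m}} → 0 < m
      n>0 (suc _) = z<s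
      z≡0 : M * (r ^ ∥ core ∥ * length link) ≡ 0
      z≡0 rewrite eq | *-zeroʳ (r ^ ∥ core ∥) = *-zeroʳ M

    link-member : ∃[ σ ] σ ∈ˡ link
    link-member with link in eq
    ... | σ ∷ _ = σ , here refl
    ... | []    = contradiction (subst (λ l → 0 < length l) eq link-nonempty) (λ ())

    2^∣core∣≤ : 2 ^ ∥ core ∥ ≤ M
    2^∣core∣≤ = 2^ℓ≤M n r M (graph-⊆-size (proj₁ link-member) (proj₂ (∈-extensions⁻ {X = core} {L = L} (proj₂ link-member)))) 8r≤n
      (≤-trans bound (*-monoʳ-≤ M (*-monoʳ-≤ (r ^ ∥ core ∥) (extensions-≤-! distinct core))))

-- Traces of a link outside its core

module _ {n : ℕ} (t : ℕ) .{{_ : NonZero t}} (L : List (Permutation′ n)) where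

  private
    instance
      4t≢0 : NonZero (2 * (2 * t))
      4t≢0 = m*n≢0 2 (2 * t) {{_}} {{m*n≢0 2 t}}
    module D = Densest (2 * (2 * t)) L

  traces : List (Permutation′ n) → List (Subset (n * n))
  traces = map (λ σ → graph σ ∩ ∁ D.core)

  traces-size : ∀ M {ρ} → ρ ∈ˡ traces M → ∥ ρ ∥ ≤ n
  traces-size M ρ∈ with σ , _ , refl ← ∈-map⁻ (λ σ → graph σ ∩ ∁ D.core) ρ∈ = graph-⊆-size σ (Sub.p∩q⊆p (graph σ) (∁ D.core))

  -- The link is 4t-spread; one factor 2 pays for keeping only half of it, the other is spent inside
  -- `spread-lemma`. The first hypothesis expresses that `M` is a sublist of the link. A set `Q`
  -- that meets the core lies in no trace, so only disjoint `Q` need maximality.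
  traces-spread : ∀ M → (∀ f → ∑ f M ≤ ∑ f D.link) → length D.link ≤ 2 * length M →
    Spread (2 * t) (length (traces M)) (λ ρ → ρ) (traces M)
  traces-spread M M≤ link≤ Q = subst₂ (λ c g → (2 * t) ^ ∥ Q ∥ * c ≤ g)
    (cong (foldr _+_ 0) (map-∘ M)) (sym (length-map _ M))
    (halve-spread (2 * t) ∥ Q ∥ (M≤ within)
      (≤-trans (∑-mono M (λ σ → 𝟙≤1 (Q ⊆? graph σ ∩ ∁ D.core))) (≤-reflexive (trans (∑-const 1 M) (*-identityʳ (length M)))))
      bound link≤)
    where
    within : Permutation′ n → ℕ
    within σ = 𝟙 (Q ⊆? graph σ ∩ ∁ D.core)
    bound : (2 * (2 * t)) ^ ∥ Q ∥ * ∑ within D.link ≤ length D.link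
    bound with nonempty? (D.core ∩ Q)
    ... | no disj = D.link-count Q (λ σ → Q ⊆? graph σ ∩ ∁ D.core) disj (λ {σ} Q⊆ x∈ → Sub.p∩q⊆p (graph σ) (∁ D.core) (Q⊆ x∈))
    ... | yes (e , e∈) = ≤-trans (≤-reflexive (trans (cong ((2 * (2 * t)) ^ ∥ Q ∥ *_) none) (*-zeroʳ ((2 * (2 * t)) ^ ∥ Q ∥)))) z≤n
      where
      none : ∑ within D.link ≡ 0
      none = trans (∑-cong D.link (λ σ → 𝟙-false (Q ⊆? graph σ ∩ ∁ D.core) (λ Q⊆ →
        let (e∈core , e∈Q) = Sub.x∈p∩q⁻ D.core Q e∈ in
        Sub.x∈∁p⇒x∉p (proj₂ (Sub.x∈p∩q⁻ (graph σ) (∁ D.core) (Q⊆ e∈Q))) e∈core)))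
        (trans (∑-const 0 D.link) (*-zeroʳ (length D.link)))

-- A popular star for large cross-intersecting families

Cross : List (Permutation′ n) → List (Permutation′ n) → Set
Cross A B = ∀ {σ τ} → σ ∈ˡ A → τ ∈ˡ B → ∃[ i ] σ ⟨$⟩ʳ i ≡ τ ⟨$⟩ʳ i

2^-cancel-< : ∀ {m n} → 2 ^ m < 2 ^ n → m < n
2^-cancel-< {m} {n} h = ≰⇒> (λ n≤m → <⇒≱ h (^-monoʳ-≤ 2 n≤m))

module _ {n : ℕ} (t k q M : ℕ) .{{_ : NonZero t}}
         (few : 8 * 8 ^ n ≤ suc (2 * t) ^ k) (10k≤2+t : 10 * k ≤ 2 + t)
         (8r≤n : 8 * (2 * (2 * t)) ≤ n) (q≤2t : q ≤ 2 * t) (2M<2^q : 2 * M < 2 ^ q)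
         {A B : List (Permutation′ n)} (distinctA : Distinct A) (distinctB : Distinct B)
         (largeA : n ! ≤ M * length A) (largeB : n ! ≤ M * length B) (cross : Cross A B) where

  private
    r : ℕ
    r = 2 * (2 * t)
    instance
      r≢0 : NonZero r
      r≢0 = m*n≢0 2 (2 * t) {{_}} {{m*n≢0 2 t}}

    module DA = Densest r A
    X : Subset (n * n)
    X = DA.core

    ∣X∣<q : ∥ X ∥ < q
    ∣X∣<q = 2^-cancel-< (≤-<-trans (DA.2^∣core∣≤ distinctA 8r≤n M largeA) (≤-<-trans (m≤m+n M _) 2M<2^q))

    flat : ∀ {j} → j < k → 4 * (2 + t) ^ j ≤ 5 * t ^ j
    flat {j} j<k = 4[2+t]^j≤5t^j t j (≤-trans (*-monoʳ-≤ 10 (<⇒≤ j<k)) 10k≤2+t)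

    module _ (B≤2B′ : length B ≤ 2 * length (avoiding X B)) where

      B′ : List (Permutation′ n)
      B′ = avoiding X B

      distinctB′ : Distinct B′
      distinctB′ = USetoid.filter⁺ (S n) (λ σ → ¬? (nonempty? (graph σ ∩ X))) distinctB

      largeB′ : n ! ≤ 2 * M * length B′
      largeB′ = ≤-trans largeB (≤-trans (*-monoʳ-≤ M B≤2B′) (≤-reflexive (lemma M (length B′))))
        where
        lemma : ∀ a b → a * (2 * b) ≡ 2 * a * b
        lemma = solve-∀

      module DB = Densest r B′
      Y : Subset (n * n)
      Y = DB.core

      ∣Y∣<q : ∥ Y ∥ < q
      ∣Y∣<q = 2^-cancel-< (≤-<-trans (DB.2^∣core∣≤ distinctB′ 8r≤n (2 * M) largeB′) 2M<2^q)

      -- Some τ in `B′` contains all of `Y`, and no member of `B′` has a cell in `X`.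
      X∩Y-empty : ∀ {y} → y Sub.∈ Y → ¬ y Sub.∈ X
      X∩Y-empty {y} y∈Y y∈X =
        let (τ , τ∈)   = DB.link-member distinctB′ 8r≤n (2 * M) largeB′
            (τ∈B′ , Y⊆) = ∈-extensions⁻ {X = Y} {L = B′} τ∈
        in proj₂ (∈-avoiding⁻ {X = X} {L = B} τ∈B′) (y , Sub.x∈p∩q⁺ (Y⊆ y∈Y , y∈X))

      -- Disjoint traces contradict cross-intersection only if no agreement can hide in `X` or in
      -- `Y`. Members of `B′` avoid `X` by choice, but `Y` is known only after `B′`, so the link of
      -- `A` has to be thinned afterwards.
      A′ : List (Permutation′ n)
      A′ = avoiding Y DA.link

      e : ℕ
      e = length DA.link

      star-small : ∀ {y} → y ∈ˡ members Y → r * length (starAt y DA.link) ≤ e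
      star-small {y} y∈ = subst₂ (λ a b → a * b ≤ e)
        (trans (cong (r ^_) (Sub.∣⁅x⁆∣≡1 y)) (*-identityʳ r))
        (sym (length-filter-∑ (λ σ → σ ⟨$⟩ʳ row {n} y ≟ col {n} y) DA.link))
        (DA.link-count ⁅ y ⁆ (λ σ → σ ⟨$⟩ʳ row {n} y ≟ col {n} y)
          (λ (x , x∈) → let (x∈X , x∈y) = Sub.x∈p∩q⁻ X ⁅ y ⁆ x∈ in
             X∩Y-empty (∈-members⁻ Y y∈) (subst (Sub._∈ X) (Sub.x∈⁅y⁆⇒x≡y y x∈y) x∈X))
          (λ {σ} σy x∈ → subst (Sub._∈ graph σ) (sym (Sub.x∈⁅y⁆⇒x≡y y x∈)) (∈-graph⁺ σ σy)))

      -- A cell of `Y` lies outside the core `X`, so at most a 1 / r part of the link contains it.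
      -- As |Y| < q ≤ 2t = r / 2, the union bound removes at most half of the link.
      e≤2A′ : e ≤ 2 * length A′
      e≤2A′ = +-cancelʳ-≤ e e (2 * length A′) (begin
        e + e                              ≤⟨ +-mono-≤ (length-avoiding Y DA.link) (length-avoiding Y DA.link) ⟩
        length A′ + s + (length A′ + s)    ≡⟨ lemma₁ (length A′) s ⟩
        2 * length A′ + 2 * s              ≤⟨ +-monoʳ-≤ (2 * length A′) 2s≤e ⟩
        2 * length A′ + e                  ∎)
        where
        open ≤-Reasoning
        s : ℕ
        s = ∑ (λ y → length (starAt y DA.link)) (members Y)
        lemma₁ : ∀ a s → a + s + (a + s) ≡ 2 * a + 2 * s
        lemma₁ = solve-∀
        lemma₂ : ∀ r s → r * (2 * s) ≡ 2 * (r * s)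
        lemma₂ = solve-∀
        2s≤e : 2 * s ≤ e
        2s≤e = *-cancelˡ-≤ r (begin
          r * (2 * s)                          ≡⟨ lemma₂ r s ⟩
          2 * (r * s)                          ≡⟨ cong (2 *_) (∑-* r (λ y → length (starAt y DA.link)) (members Y)) ⟨
          2 * ∑ (λ y → r * length (starAt y DA.link)) (members Y)
                                               ≤⟨ *-monoʳ-≤ 2 (∑-mono-∈ (members Y) star-small) ⟩
          2 * ∑ (λ _ → e) (members Y)         ≡⟨ cong (2 *_) (∑-const e (members Y)) ⟩
          2 * (length (members Y) * e)        ≡⟨ cong (λ z → 2 * (z * e)) (length-members Y) ⟩
          2 * (∥ Y ∥ * e)                      ≡⟨ *-assoc 2 ∥ Y ∥ e ⟨
          2 * ∥ Y ∥ * e                        ≤⟨ *-monoˡ-≤ e (*-monoʳ-≤ 2 (≤-trans (<⇒≤ ∣Y∣<q) q≤2t)) ⟩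
          r * e                                ∎)

      A′-nonempty : 0 < length A′
      A′-nonempty with length A′ in eq
      ... | suc _ = z<s
      ... | zero  = contradiction (subst (λ z → e ≤ 2 * z) eq e≤2A′) (<⇒≱ (DA.link-nonempty distinctA 8r≤n M largeA))

      F G : List (Subset (n * n))
      F = traces t A A′
      G = traces t B′ DB.link

      disjoint-traces : ∃[ ρ ] ∃[ ρ′ ] ρ ∈ˡ F × ρ′ ∈ˡ G × Sub.Empty (ρ ∩ ρ′)
      disjoint-traces = disjoint-members F G
        (spread-lemma F t k
          (traces-spread t A A′ (λ f → ∑-filter-≤ (λ σ → ¬? (nonempty? (graph σ ∩ Y))) f DA.link) e≤2A′)
          (traces-size t A A′) (subst (0 <_) (sym (length-map _ A′)) A′-nonempty) few flat)
        (spread-lemma G t k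
          (traces-spread t B′ DB.link (λ f → ≤-refl) (m≤m+n _ _))
          (traces-size t B′ DB.link)
          (subst (0 <_) (sym (length-map _ DB.link)) (DB.link-nonempty distinctB′ 8r≤n (2 * M) largeB′)) few flat)

      traces-meet : ∀ {σ τ} → σ ∈ˡ A′ → τ ∈ˡ DB.link → Sub.Nonempty ((graph σ ∩ ∁ X) ∩ (graph τ ∩ ∁ Y))
      traces-meet {σ} {τ} σ∈ τ∈ =
        let (σ∈link , σ∩Y) = ∈-avoiding⁻ {X = Y} {L = DA.link} σ∈
            (σ∈A , _)      = ∈-extensions⁻ {X = X} {L = A} σ∈link
            (τ∈B′ , _)     = ∈-extensions⁻ {X = Y} {L = B′} τ∈
            (τ∈B , τ∩X)    = ∈-avoiding⁻ {X = X} {L = B} τ∈B′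
            (i , σi≡τi)    = cross σ∈A τ∈B
            c∈σ            = graph-combine σ i
            c∈τ            = subst (λ j → combine i j Sub.∈ graph τ) (sym σi≡τi) (graph-combine τ i)
        in combine i (σ ⟨$⟩ʳ i) , Sub.x∈p∩q⁺
             ( Sub.x∈p∩q⁺ (c∈σ , Sub.x∉p⇒x∈∁p (λ c∈X → τ∩X (combine i (σ ⟨$⟩ʳ i) , Sub.x∈p∩q⁺ (c∈τ , c∈X))))
             , Sub.x∈p∩q⁺ (c∈τ , Sub.x∉p⇒x∈∁p (λ c∈Y → σ∩Y (combine i (σ ⟨$⟩ʳ i) , Sub.x∈p∩q⁺ (c∈σ , c∈Y)))))

      absurd : ⊥
      absurd =
        let (ρ , ρ′ , ρ∈ , ρ′∈ , disj) = disjoint-traces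
            (σ , σ∈ , ρ≡)  = ∈-map⁻ (λ σ → graph σ ∩ ∁ X) ρ∈
            (τ , τ∈ , ρ′≡) = ∈-map⁻ (λ τ → graph τ ∩ ∁ Y) ρ′∈
        in disj (subst₂ (λ ρ ρ′ → Sub.Nonempty (ρ ∩ ρ′)) (sym ρ≡) (sym ρ′≡) (traces-meet σ∈ τ∈))

  -- If half of `B` avoided the core of `A`, the two spread families would have disjoint traces. So
  -- more than half of `B` meets fewer than q cells, and one of these cells receives at least a 1 /
  -- (2 q) part. The bound 2^q > 2M, rather than 2^q > M, allows for `B′` having lost half of `B`.
  popular-star : ∃[ i ] ∃[ j ] length B ≤ 2 * q * length (star i j B)
  popular-star with length B ≤? 2 * length (avoiding X B)
  ... | yes B≤2B′ = ⊥-elim (absurd B≤2B′)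
  ... | no  B≰2B′ = pick (members X) refl
    where
    open ≤-Reasoning
    B≤2∑ : length B ≤ 2 * ∑ (λ x → length (starAt x B)) (members X)
    B≤2∑ = +-cancelˡ-≤ (length B) _ _ (begin
      length B + length B        ≤⟨ +-mono-≤ (length-avoiding X B) (length-avoiding X B) ⟩
      b′ + s + (b′ + s)          ≡⟨ lemma b′ s ⟩
      2 * b′ + 2 * s             ≤⟨ +-monoˡ-≤ (2 * s) (≰⇒≥ B≰2B′) ⟩
      length B + 2 * s           ∎)
      where
      b′ s : ℕ
      b′ = length (avoiding X B)
      s = ∑ (λ x → length (starAt x B)) (members X)
      lemma : ∀ a s → a + s + (a + s) ≡ 2 * a + 2 * s
      lemma = solve-∀
    pick : ∀ xs → members X ≡ xs → ∃[ i ] ∃[ j ] length B ≤ 2 * q * length (star i j B)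
    -- An empty core makes the sum vanish and leaves `B` empty, against `B≰2B′`.
    pick [] eq = contradiction (≤-trans (subst (λ xs → length B ≤ 2 * ∑ (λ x → length (starAt x B)) xs) eq B≤2∑) z≤n) B≰2B′
    pick (x ∷ xs) eq with y , h ← ∑-pigeonhole (λ x → length (starAt x B)) x xs = row {n} y , col {n} y , (begin
      length B                                               ≤⟨ subst (λ xs → length B ≤ 2 * ∑ (λ x → length (starAt x B)) xs) eq B≤2∑ ⟩
      2 * ∑ (λ x → length (starAt x B)) (x ∷ xs)             ≤⟨ *-monoʳ-≤ 2 h ⟩
      2 * (length (x ∷ xs) * length (starAt y B))            ≡⟨ *-assoc 2 (length (x ∷ xs)) _ ⟨
      2 * length (x ∷ xs) * length (starAt y B)
        ≤⟨ *-monoˡ-≤ (length (starAt y B)) (*-monoʳ-≤ 2 (begin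
             length (x ∷ xs)        ≡⟨ cong length eq ⟨
             length (members X)    ≡⟨ length-members X ⟩
             ∥ X ∥                  ≤⟨ <⇒≤ ∣X∣<q ⟩
             q                      ∎)) ⟩
      2 * q * length (starAt y B)                            ∎)

-- Choice of parameters and numerical bootstrapping

m<[1+m/n]*n : ∀ m n .{{_ : NonZero n}} → m < suc (m / n) * n
m<[1+m/n]*n m n = begin-strict
  m                      ≡⟨ m≡m%n+[m/n]*n m n ⟩
  m % n + (m / n) * n    <⟨ +-monoˡ-< ((m / n) * n) (m%n<n m n) ⟩
  n + (m / n) * n        ∎
  where open ≤-Reasoning

m*n≤o⇒m≤o/n : ∀ m n o .{{_ : NonZero n}} → m * n ≤ o → m ≤ o / n
m*n≤o⇒m≤o/n m n o h = subst (_≤ _) (m*n/n≡m m n) (/-monoˡ-≤ n h)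

n<2^n : ∀ n → n < 2 ^ n
n<2^n zero    = z<s
n<2^n (suc n) = begin-strict
  suc n            <⟨ s<s (n<2^n n) ⟩
  1 + 2 ^ n        ≤⟨ +-mono-≤ (m^n>0 2 n) (≤-reflexive (sym (+-identityʳ (2 ^ n)))) ⟩
  2 ^ suc n        ∎
  where open ≤-Reasoning

-- A cube beats a square: with p = q / 3 one has 2^q ≥ (2^p)³ ≥ (1 + p)³. One factor 1 + p absorbs 9
-- M, the other two absorb (1 + q)² / 9.
M[1+q]²≤2^q : ∀ M q → 27 * M ≤ q → M * (suc q * suc q) ≤ 2 ^ q
M[1+q]²≤2^q M q 27M≤q = begin
  M * (suc q * suc q)                            ≤⟨ *-monoʳ-≤ M (*-mono-≤ q<3[1+p] q<3[1+p]) ⟩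
  M * (suc p * 3 * (suc p * 3))                  ≡⟨ lemma₁ M (suc p) ⟩
  M * 9 * (suc p * suc p)                        ≤⟨ *-monoˡ-≤ (suc p * suc p) (m≤n⇒m≤1+n (m*n≤o⇒m≤o/n (M * 9) 3 q (≤-trans (≤-reflexive (lemma₂ M)) 27M≤q))) ⟩
  suc p * (suc p * suc p)                        ≤⟨ *-mono-≤ (n<2^n p) (*-mono-≤ (n<2^n p) (n<2^n p)) ⟩
  2 ^ p * (2 ^ p * 2 ^ p)                        ≡⟨ cong (2 ^ p *_) (^-distribˡ-+-* 2 p p) ⟨
  2 ^ p * 2 ^ (p + p)                            ≡⟨ ^-distribˡ-+-* 2 p (p + p) ⟨
  2 ^ (p + (p + p))                              ≤⟨ ^-monoʳ-≤ 2 (≤-trans (≤-reflexive (lemma₃ p)) (m/n*n≤m q 3)) ⟩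
  2 ^ q                                          ∎
  where
  open ≤-Reasoning
  p = q / 3
  q<3[1+p] : suc q ≤ suc p * 3
  q<3[1+p] = m<[1+m/n]*n q 3
  lemma₁ : ∀ m x → m * (x * 3 * (x * 3)) ≡ m * 9 * (x * x)
  lemma₁ = solve-∀
  lemma₂ : ∀ m → m * 9 * 3 ≡ 27 * m
  lemma₂ = solve-∀
  lemma₃ : ∀ p → p + (p + p) ≡ p * 3
  lemma₃ = solve-∀

8^[1+n]≤ : ∀ n k s c → suc n ≤ c * k → 8 ^ c ≤ s → 8 * 8 ^ n ≤ s ^ k
8^[1+n]≤ n k s c h₁ h₂ = begin
  8 ^ suc n     ≤⟨ ^-monoʳ-≤ 8 h₁ ⟩
  8 ^ (c * k)   ≡⟨ ^-*-assoc 8 c k ⟨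
  (8 ^ c) ^ k   ≤⟨ ^-monoˡ-≤ k h₂ ⟩
  s ^ k         ∎
  where open ≤-Reasoning

-- The numerical hypotheses of `popular-star` at M = D n², the density loss computed in `large`,
-- together with `qG≤n`, which keeps the loss 2 q of the popular star below the factor n gained by
-- swapping.
record Parameters (D G n : ℕ) : Set where
  field
    t k q   : ℕ
    t≢0     : NonZero t
    few     : 8 * 8 ^ n ≤ suc (2 * t) ^ k
    10k≤2+t : 10 * k ≤ 2 + t
    8r≤n    : 8 * (2 * (2 * t)) ≤ n
    q≤2t    : q ≤ 2 * t
    2M<2^q  : 2 * (D * (n * n)) < 2 ^ q
    qG≤n    : q * G ≤ n

-- t = 10 k with k ≈ n / u for u = 320, so that r = 4 t ≈ n / 8; and q ≈ n / (G + 32), far above the logarithm of D n².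
module _ (u c : ℕ) .{{_ : NonZero u}} (8r≡ : ∀ k → 8 * (2 * (2 * (10 * k))) ≡ k * u)
         (32*2t≡ : ∀ k → (u + u) * k ≡ 2 * (10 * k) * 32) (2u<c : u + u < c)
         (D G H n : ℕ) .{{_ : NonZero H}} (G≤H : G ≤ H) (32≤H : 32 ≤ H) (0<D : 0 < D)
         (n-large₁ : suc (8 ^ c) * u ≤ n) (n-large₂ : 27 * (2 * D * H * H) * H ≤ n) where

  private
    open ≤-Reasoning
    k q : ℕ
    k = n / u
    q = n / H

    qH≤n : q * H ≤ n
    qH≤n = m/n*n≤m n H

    n<[1+q]H : n < suc q * H
    n<[1+q]H = m<[1+m/n]*n n H

    8^c<k : 8 ^ c < k
    8^c<k = m*n≤o⇒m≤o/n (suc (8 ^ c)) u n n-large₁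

    0<k : 0 < k
    0<k = ≤-<-trans z≤n 8^c<k

    instance
      k≢0 : NonZero k
      k≢0 = >-nonZero 0<k

    n≤2uk : n ≤ (u + u) * k
    n≤2uk = begin
      n                  ≤⟨ <⇒≤ (m<[1+m/n]*n n u) ⟩
      u + k * u          ≤⟨ +-mono-≤ (m≤m*n u k) (≤-reflexive (*-comm k u)) ⟩
      u * k + u * k      ≡⟨ *-distribʳ-+ k u u ⟨
      (u + u) * k        ∎

    n<ck : suc n ≤ c * k
    n<ck = begin
      1 + n              ≤⟨ +-mono-≤ 0<k n≤2uk ⟩
      suc (u + u) * k    ≤⟨ *-monoˡ-≤ k 2u<c ⟩
      c * k              ∎

    27M≤q : 27 * (2 * D * H * H) ≤ q
    27M≤q = m*n≤o⇒m≤o/n (27 * (2 * D * H * H)) H n n-large₂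

    8^c≤1+2t : 8 ^ c ≤ suc (2 * (10 * k))
    8^c≤1+2t = begin
      8 ^ c                 ≤⟨ <⇒≤ 8^c<k ⟩
      k                     ≤⟨ m≤n*m k 20 ⟩
      20 * k                ≡⟨ *-assoc 2 10 k ⟩
      2 * (10 * k)          ≤⟨ n≤1+n _ ⟩
      suc (2 * (10 * k))    ∎

    q≤20k : q ≤ 2 * (10 * k)
    q≤20k = *-cancelʳ-≤ q (2 * (10 * k)) 32 (begin
      q * 32                ≤⟨ *-monoʳ-≤ q 32≤H ⟩
      q * H                 ≤⟨ qH≤n ⟩
      n                     ≤⟨ n≤2uk ⟩
      (u + u) * k           ≡⟨ 32*2t≡ k ⟩
      2 * (10 * k) * 32     ∎)

    2Dn²<2^q : 2 * (D * (n * n)) < 2 ^ q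
    2Dn²<2^q = begin-strict
      2 * (D * (n * n))                           <⟨ *-monoʳ-< 2 (*-monoʳ-< D {{>-nonZero 0<D}} (*-mono-< n<[1+q]H n<[1+q]H)) ⟩
      2 * (D * (suc q * H * (suc q * H)))         ≡⟨ lemma D (suc q) H ⟩
      2 * D * H * H * (suc q * suc q)             ≤⟨ M[1+q]²≤2^q (2 * D * H * H) q 27M≤q ⟩
      2 ^ q                                       ∎
      where
      lemma : ∀ d x h → 2 * (d * (x * h * (x * h))) ≡ 2 * d * h * h * (x * x)
      lemma = solve-∀

  parameters : Parameters D G n
  parameters = record
    { t       = 10 * k
    ; k       = k
    ; q       = q
    ; t≢0     = m*n≢0 10 k
    ; few     = 8^[1+n]≤ n k (suc (2 * (10 * k))) c n<ck 8^c≤1+2t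
    ; 10k≤2+t = m≤n+m (10 * k) 2
    ; 8r≤n    = ≤-trans (≤-reflexive (8r≡ k)) (m/n*n≤m n u)
    ; q≤2t    = q≤20k
    ; 2M<2^q  = 2Dn²<2^q
    ; qG≤n    = ≤-trans (*-monoʳ-≤ q G≤H) qH≤n
    }

abstract

  eventually-parameters : ∀ D G → 0 < D → ∃[ n₀ ] ∀ n → n₀ ≤ n → Parameters D G n
  eventually-parameters D G 0<D = n₁ + n₂ , λ n n₀≤n →
    -- Here 8 r = 8 · 4 · 10 k = 320 k ≤ n, which fixes u. Rounding gives n ≤ 640 k, so 641 is an
    -- exponent with n + 1 ≤ 641 k.
    parameters 320 641 (λ k → trans (lemma₁ 8 2 10 k) (*-comm 320 k)) (λ k → sym (lemma₂ 2 10 32 k)) ≤-refl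
      D G H n {{H≢0}} (m≤m+n G 32) (m≤n+m 32 G) 0<D (≤-trans (m≤m+n n₁ n₂) n₀≤n) (≤-trans (m≤n+m n₂ n₁) n₀≤n)
    where
    H n₁ n₂ : ℕ
    -- The summand 32 yields q ≤ 2t: 32 q ≤ n ≤ 640 k = 32 · 20 k.
    H = G + 32
    n₁ = suc (8 ^ 641) * 320
    n₂ = 27 * (2 * D * H * H) * H
    H≢0 : NonZero H
    H≢0 = >-nonZero (≤-trans (s≤s z≤n) (m≤n+m 32 G))
    lemma₁ : ∀ a b c k → a * (b * (b * (c * k))) ≡ a * b * b * c * k
    lemma₁ = solve-∀
    lemma₂ : ∀ a b c k → a * (b * k) * c ≡ a * b * c * k
    lemma₂ = solve-∀

private
  half : ∀ x y z → x + y ≡ z → 2 * y ≤ z → z ≤ 2 * x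
  half x y z x+y≡z 2y≤z = +-cancelʳ-≤ z z (2 * x) (begin
    z + z             ≡⟨ cong₂ _+_ x+y≡z x+y≡z ⟨
    x + y + (x + y)   ≡⟨ lemma x y ⟩
    2 * x + 2 * y     ≤⟨ +-monoʳ-≤ (2 * x) 2y≤z ⟩
    2 * x + z         ∎)
    where
    open ≤-Reasoning
    lemma : ∀ x y → x + y + (x + y) ≡ 2 * x + 2 * y
    lemma = solve-∀

  -- Read a′ as the members of one family off the star and y as those of the other family in it.
  -- Then a′ ≤ (1 + p) W / y ≤ 2 q (1 + p) W / b ≤ 2 q G ((1 + p) / p²) a, and the last hypothesis
  -- makes the coefficient of a at most 1/2.
  minority : ∀ {a′ y b a p W G q} .{{_ : NonZero b}} .{{_ : NonZero p}} → a′ * y ≤ suc p * W → b ≤ 2 * q * y →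
    p * p * W ≤ G * (a * b) → 4 * q * G * suc p ≤ p * p → 2 * a′ ≤ a
  minority {a′} {y} {b} {a} {p} {W} {G} {q} h₁ h₂ h₃ h₄ =
    *-cancelʳ-≤ (2 * a′) a (p * p * b) {{m*n≢0 (p * p) b {{m*n≢0 p p}}}} (begin
      2 * a′ * (p * p * b)                 ≤⟨ *-monoʳ-≤ (2 * a′) (*-monoʳ-≤ (p * p) h₂) ⟩
      2 * a′ * (p * p * (2 * q * y))       ≡⟨ lemma₁ a′ p q y ⟩
      4 * q * (p * p) * (a′ * y)           ≤⟨ *-monoʳ-≤ (4 * q * (p * p)) h₁ ⟩
      4 * q * (p * p) * (suc p * W)        ≡⟨ lemma₂ q (p * p) (suc p) W ⟩
      4 * q * suc p * (p * p * W)          ≤⟨ *-monoʳ-≤ (4 * q * suc p) h₃ ⟩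
      4 * q * suc p * (G * (a * b))        ≡⟨ lemma₃ q (suc p) G a b ⟩
      4 * q * G * suc p * (a * b)          ≤⟨ *-monoˡ-≤ (a * b) h₄ ⟩
      p * p * (a * b)                      ≡⟨ lemma₄ (p * p) a b ⟩
      a * (p * p * b)                      ∎)
    where
    open ≤-Reasoning
    lemma₁ : ∀ a′ p q y → 2 * a′ * (p * p * (2 * q * y)) ≡ 4 * q * (p * p) * (a′ * y)
    lemma₁ = solve-∀
    lemma₂ : ∀ q x z w → 4 * q * x * (z * w) ≡ 4 * q * z * (x * w)
    lemma₂ = solve-∀
    lemma₃ : ∀ q z g a b → 4 * q * z * (g * (a * b)) ≡ 4 * q * g * z * (a * b)
    lemma₃ = solve-∀
    lemma₄ : ∀ x a b → x * (a * b) ≡ a * (x * b)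
    lemma₄ = solve-∀

-- Two rounds of `minority`: the weak popularity 1 / (2 q) of the star in the second family
-- concentrates the first, and then a ≤ 2 x is popularity with q = 1 in the opposite direction. The
-- constant 16 is the 4 of `minority` times the 4 in (1 + p)² ≤ 4 p².
majority : ∀ x x′ a y y′ b p W G q .{{_ : NonZero a}} .{{_ : NonZero b}} .{{_ : NonZero p}} →
  x + x′ ≡ a → y + y′ ≡ b → x′ * y ≤ suc p * W → y′ * x ≤ suc p * W → b ≤ 2 * q * y →
  p * p * W ≤ G * (a * b) → q * (16 * G) ≤ suc p → a ≤ 2 * x × b ≤ 2 * y
majority x x′ a y y′ b p W G q ea eb hx hy hq hW hG = a≤2x , half y y′ b eb
  (minority {a′ = y′} {y = x} {G = G} {q = 1} hy a≤2x (≤-trans hW (≤-reflexive (cong (G *_) (*-comm a b)))) (begin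
    4 * 1 * G * suc p   ≡⟨ cong (λ z → z * G * suc p) (*-identityʳ 4) ⟩
    4 * G * suc p       ≤⟨ *-monoˡ-≤ (suc p) (*-monoˡ-≤ G (m≤m*n 4 q {{q≢0}})) ⟩
    4 * q * G * suc p   ≤⟨ bound ⟩
    p * p               ∎))
  where
  open ≤-Reasoning
  q≢0 : NonZero q
  q≢0 = ≢-nonZero (λ { refl → contradiction hq (<⇒≱ (>-nonZero⁻¹ b)) })
  lemma₁ : ∀ q g z → 4 * (4 * q * g * z) ≡ q * (16 * g) * z
  lemma₁ = solve-∀
  lemma₂ : ∀ p → 2 * p * (2 * p) ≡ 4 * (p * p)
  lemma₂ = solve-∀
  1+p≤2p : suc p ≤ 2 * p
  1+p≤2p = +-mono-≤ (>-nonZero⁻¹ p) (≤-reflexive (sym (+-identityʳ p)))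
  bound : 4 * q * G * suc p ≤ p * p
  bound = *-cancelˡ-≤ 4 (begin
    4 * (4 * q * G * suc p)   ≡⟨ lemma₁ q G (suc p) ⟩
    q * (16 * G) * suc p      ≤⟨ *-monoˡ-≤ (suc p) hG ⟩
    suc p * suc p             ≤⟨ *-mono-≤ 1+p≤2p 1+p≤2p ⟩
    2 * p * (2 * p)           ≡⟨ lemma₂ p ⟩
    4 * (p * p)               ∎)
  a≤2x : a ≤ 2 * x
  a≤2x = half x x′ a ea (minority {a′ = x′} {y = y} {G = G} {q = q} hx hq hW bound)

-- With f = (n - 2)! and p = n - 1, the bound b ≤ 2 p f forces a, hence also x, to have order p f.
-- The product bound on y′ x then leaves only order f for y′.
minority-bound : ∀ a x y′ b p f C D .{{_ : NonZero p}} .{{_ : NonZero f}} →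
  p * f * (p * f) ≤ D * (a * b) → b ≤ 2 * (p * f) → a ≤ 2 * x → y′ * x ≤ suc p * (C * (f * f)) → y′ ≤ 8 * D * C * f
minority-bound a x y′ b p f C D h₁ h₂ h₃ h₄ =
  *-cancelʳ-≤ y′ (8 * D * C * f) (p * f) {{m*n≢0 p f}} (begin
    y′ * (p * f)                          ≤⟨ *-monoʳ-≤ y′ pf≤2Da ⟩
    y′ * (2 * D * a)                      ≤⟨ *-monoʳ-≤ y′ (*-monoʳ-≤ (2 * D) h₃) ⟩
    y′ * (2 * D * (2 * x))                ≡⟨ lemma₂ y′ D x ⟩
    4 * D * (y′ * x)                      ≤⟨ *-monoʳ-≤ (4 * D) h₄ ⟩
    4 * D * (suc p * (C * (f * f)))       ≤⟨ *-monoʳ-≤ (4 * D) (*-monoˡ-≤ (C * (f * f)) 1+p≤2p) ⟩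
    4 * D * (2 * p * (C * (f * f)))       ≡⟨ lemma₃ D p C f ⟩
    8 * D * C * f * (p * f)               ∎)
  where
  open ≤-Reasoning
  1+p≤2p : suc p ≤ 2 * p
  1+p≤2p = +-mono-≤ (>-nonZero⁻¹ p) (≤-reflexive (sym (+-identityʳ p)))
  lemma₁ : ∀ d a z → d * (a * (2 * z)) ≡ 2 * d * a * z
  lemma₁ = solve-∀
  lemma₂ : ∀ y d x → y * (2 * d * (2 * x)) ≡ 4 * d * (y * x)
  lemma₂ = solve-∀
  lemma₃ : ∀ d p c f → 4 * d * (2 * p * (c * (f * f))) ≡ 8 * d * c * f * (p * f)
  lemma₃ = solve-∀
  pf≤2Da : p * f ≤ 2 * D * a
  pf≤2Da = *-cancelʳ-≤ (p * f) (2 * D * a) (p * f) {{m*n≢0 p f}} (begin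
    p * f * (p * f)          ≤⟨ h₁ ⟩
    D * (a * b)              ≤⟨ *-monoʳ-≤ D (*-monoʳ-≤ a h₂) ⟩
    D * (a * (2 * (p * f)))  ≡⟨ lemma₁ D a (p * f) ⟩
    2 * D * a * (p * f)      ∎)

-- Concentration on a star

Cross-sym : ∀ {A B : List (Permutation′ n)} → Cross A B → Cross B A
Cross-sym cross τ∈ σ∈ = let (i , eq) = cross σ∈ τ∈ in i , sym eq

transpose-i : ∀ (i j : Fin n) → transpose i j ⟨$⟩ʳ i ≡ j
transpose-i i j with i ≟ i
... | yes _  = refl
... | no i≢i = contradiction refl i≢i

transpose-≢ : ∀ {i j k : Fin n} → k ≢ i → k ≢ j → transpose i j ⟨$⟩ʳ k ≡ k
transpose-≢ {i = i} {j} {k} k≢i k≢j with k ≟ i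
... | yes k≡i = contradiction k≡i k≢i
... | no _ with k ≟ j
...   | yes k≡j = contradiction k≡j k≢j
...   | no _    = refl

permutation-injective : ∀ (σ : Permutation′ n) {i j} → σ ⟨$⟩ʳ i ≡ σ ⟨$⟩ʳ j → i ≡ j
permutation-injective σ eq = trans (sym (inverseˡ σ))
  (trans (cong (σ ⟨$⟩ˡ_) eq) (inverseˡ σ))

-- Members σ, τ with σ(i) = j ≠ j′ = τ(i) agree away from i and at a value other than j and j′. Hence swapping the
-- values j and j′ in τ and deleting i yields cross-intersecting families of permutations of one point fewer.
module _ (W : ℕ) (bound : ∀ {A B : List (Permutation′ n)} → Distinct A → Distinct B → Cross A B → length A * length B ≤ W)
         {A B : List (Permutation′ (suc n))} (distinctA : Distinct A) (distinctB : Distinct B) (cross : Cross A B) where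

  stars-product : ∀ i {j j′} → j ≢ j′ → length (star i j A) * length (star i j′ B) ≤ W
  stars-product i {j} {j′} j≢j′ = subst₂ (λ a b → a * b ≤ W) (length-map (remove i) (star i j A)) (length-map swapRemove (star i j′ B))
    (bound {map (remove i) (star i j A)} {map swapRemove (star i j′ B)} (Distinct-star i j distinctA) distinct cross′)
    where
    swap : Permutation′ (suc n) → Permutation′ (suc n)
    swap τ = τ ∘ₚ transpose j′ j
    swapRemove : Permutation′ (suc n) → Permutation′ n
    swapRemove τ = remove i (swap τ)
    swap-i : ∀ {τ} → τ ∈ˡ star i j′ B → swap τ ⟨$⟩ʳ i ≡ j
    swap-i τ∈ = trans (cong (transpose j′ j ⟨$⟩ʳ_) (proj₂ (∈-star⁻ {L = B} τ∈))) (transpose-i j′ j)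
    distinct : Distinct (map swapRemove (star i j′ B))
    distinct = Distinct-map swapRemove (star i j′ B)
      (λ {σ} {τ} σ∈ τ∈ eq k → permutation-injective (transpose j′ j) {σ ⟨$⟩ʳ k} {τ ⟨$⟩ʳ k}
        (remove-injective i (swap σ) (swap τ) (trans (swap-i σ∈) (sym (swap-i τ∈))) eq k))
      (USetoid.filter⁺ (S (suc n)) (λ σ → σ ⟨$⟩ʳ i ≟ j′) distinctB)
    agree : ∀ {σ τ} → σ ∈ˡ star i j A → τ ∈ˡ star i j′ B → ∃[ k ] remove i σ ⟨$⟩ʳ k ≡ swapRemove τ ⟨$⟩ʳ k
    agree {σ} {τ} σ∈ τ∈ = punchOut i≢l , remove-agree i σ (swap τ) {punchOut i≢l} (trans σi≡j (sym (swap-i τ∈)))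
        (subst (λ l → σ ⟨$⟩ʳ l ≡ swap τ ⟨$⟩ʳ l) (sym (punchIn-punchOut i≢l))
          (trans σl≡τl (sym (transpose-≢ {i = j′} {j} {τ ⟨$⟩ʳ l} τl≢j′ τl≢j))))
      where
      σi≡j : σ ⟨$⟩ʳ i ≡ j
      σi≡j = proj₂ (∈-star⁻ {L = A} σ∈)
      τi≡j′ : τ ⟨$⟩ʳ i ≡ j′
      τi≡j′ = proj₂ (∈-star⁻ {L = B} τ∈)
      common : ∃[ l ] σ ⟨$⟩ʳ l ≡ τ ⟨$⟩ʳ l
      common = cross (proj₁ (∈-star⁻ {L = A} σ∈)) (proj₁ (∈-star⁻ {L = B} τ∈))
      l : Fin (suc n)
      l = proj₁ common
      σl≡τl : σ ⟨$⟩ʳ l ≡ τ ⟨$⟩ʳ l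
      σl≡τl = proj₂ common
      i≢l : i ≢ l
      i≢l i≡l = j≢j′ (trans (sym σi≡j) (trans (cong (σ ⟨$⟩ʳ_) i≡l) (trans σl≡τl (trans (cong (τ ⟨$⟩ʳ_) (sym i≡l)) τi≡j′))))
      τl≢j′ : τ ⟨$⟩ʳ l ≢ j′
      τl≢j′ eq = i≢l (permutation-injective τ {i} {l} (trans τi≡j′ (sym eq)))
      τl≢j : τ ⟨$⟩ʳ l ≢ j
      τl≢j eq = i≢l (permutation-injective σ {i} {l} (trans σi≡j (trans (sym eq) (sym σl≡τl))))
    cross′ : Cross (map (remove i) (star i j A)) (map swapRemove (star i j′ B))
    cross′ {ρ} {ρ′} ρ∈ ρ′∈ =
      let (σ , σ∈ , ρ≡)  = ∈-map⁻ (remove i) {y = ρ} ρ∈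
          (τ , τ∈ , ρ′≡) = ∈-map⁻ swapRemove {y = ρ′} ρ′∈
      in subst₂ (λ ρ ρ′ → ∃[ k ] ρ ⟨$⟩ʳ k ≡ ρ′ ⟨$⟩ʳ k) (sym ρ≡) (sym ρ′≡) (agree σ∈ τ∈)

-- Majorities in one star, the product bound and stability

offStar-product : ∀ (W : ℕ) → (∀ {A B : List (Permutation′ n)} → Distinct A → Distinct B → Cross A B → length A * length B ≤ W) →
  ∀ {A B : List (Permutation′ (suc n))} → Distinct A → Distinct B → Cross A B →
  ∀ i j → length (offStar i j A) * length (star i j B) ≤ suc n * W
offStar-product W bound {A} {B} dA dB cross i j = offStar-bound i j A (length (star i j B)) W
  (λ j′ j≢j′ → stars-product W bound dA dB cross i (j≢j′ ∘ sym))

star-≤-! : ∀ {L : List (Permutation′ (suc n))} → Distinct L → ∀ i j → length (star i j L) ≤ n !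
star-≤-! {n} {L} d i j = subst (_≤ n !) (length-map (remove i) (star i j L)) (length-≤-! (Distinct-star i j d))

-- The trivial bound n! on the other family turns a product of order (n - 1)!² into a density of at
-- least 1 / (D n²) for this one; a polynomial loss is harmless because `q` only has to exceed its
-- logarithm.
large : ∀ p D a b → p ! * p ! ≤ D * (a * b) → b ≤ suc p ! → suc p ! ≤ D * (suc p * suc p) * a
large p D a b h b≤ = begin
  suc p * p !                     ≤⟨ *-monoʳ-≤ (suc p) (*-cancelʳ-≤ (p !) (D * a * suc p) (p !) {{p !≢0}} (begin
    p ! * p !                       ≤⟨ h ⟩
    D * (a * b)                     ≤⟨ *-monoʳ-≤ D (*-monoʳ-≤ a b≤) ⟩
    D * (a * (suc p * p !))         ≡⟨ lemma₁ D a (suc p) (p !) ⟩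
    D * a * suc p * p !             ∎)) ⟩
  suc p * (D * a * suc p)         ≡⟨ lemma₂ (suc p) D a ⟩
  D * (suc p * suc p) * a         ∎
  where
  open ≤-Reasoning
  lemma₁ : ∀ d a s x → d * (a * (s * x)) ≡ d * a * s * x
  lemma₁ = solve-∀
  lemma₂ : ∀ s d a → s * (d * a * s) ≡ d * (s * s) * a
  lemma₂ = solve-∀

-- The product of the sizes is measured twice: against p!² through `D`, for the popular star, and
-- against p² W through `G`, for the majorities. Keeping the two apart allows G = 1 in the
-- induction, however large the constant inside `W` is.
module Concentration (W : ℕ) {p : ℕ} (bound : ∀ {A B : List (Permutation′ p)} → Distinct A → Distinct B → Cross A B → length A * length B ≤ W)
         (D G : ℕ) (param : Parameters D (16 * G) (suc p)) .{{_ : NonZero p}}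
         {A B : List (Permutation′ (suc p))} (distinctA : Distinct A) (distinctB : Distinct B) (cross : Cross A B)
         (h : p ! * p ! ≤ D * (length A * length B)) (hG : p * p * W ≤ G * (length A * length B)) where

  open Parameters param

  private
    instance
      product≢0 : NonZero (length A * length B)
      product≢0 = m*n≢0⇒n≢0 D {{>-nonZero (≤-trans (>-nonZero⁻¹ (p ! * p !) {{m*n≢0 (p !) (p !) {{p !≢0}} {{p !≢0}}}}) h)}}

  popular : ∃[ i ] ∃[ j ] length B ≤ 2 * q * length (star i j B)
  popular = popular-star t k q (D * (suc p * suc p)) {{t≢0}} few 10k≤2+t 8r≤n q≤2t 2M<2^q distinctA distinctB
    (large p D (length A) (length B) h (length-≤-! distinctB))
    (large p D (length B) (length A) (≤-trans h (≤-reflexive (cong (D *_) (*-comm (length A) (length B))))) (length-≤-! distinctA))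
    cross

  i j : Fin (suc p)
  i = proj₁ popular
  j = proj₁ (proj₂ popular)

  offA : length (offStar i j A) * length (star i j B) ≤ suc p * W
  offA = offStar-product W bound distinctA distinctB cross i j

  offB : length (offStar i j B) * length (star i j A) ≤ suc p * W
  offB = offStar-product W bound distinctB distinctA (Cross-sym cross) i j

  majorities : length A ≤ 2 * length (star i j A) × length B ≤ 2 * length (star i j B)
  majorities = majority (length (star i j A)) (length (offStar i j A)) (length A)
    (length (star i j B)) (length (offStar i j B)) (length B) p W G q {{m*n≢0⇒m≢0 (length A)}} {{m*n≢0⇒n≢0 (length A)}}
    (star+offStar i j A) (star+offStar i j B) offA offB (proj₂ (proj₂ popular)) hG qG≤n

-- The threshold n₀ belongs to D = G = 1 and is fixed before C. This order avoids a circle, since C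
-- must cover all n up to n₀.
product-bound : ∃[ C ] ∀ n {A B : List (Permutation′ n)} → Distinct A → Distinct B → Cross A B →
  length A * length B ≤ C * ((n ∸ 1) ! * (n ∸ 1) !)
product-bound = C , induct
  where
  n₀ : ℕ
  n₀ = proj₁ (eventually-parameters 1 16 z<s)
  C : ℕ
  -- The 4 is what concentration yields for large n; n₀² covers n ≤ n₀, where n!² = n² (n - 1)!².
  C = 4 + n₀ * n₀

  Bound : ℕ → Set
  Bound n = ∀ {A B : List (Permutation′ n)} → Distinct A → Distinct B → Cross A B →
    length A * length B ≤ C * ((n ∸ 1) ! * (n ∸ 1) !)

  small : ∀ p → suc p ≤ n₀ → Bound (suc p)
  small p n≤n₀ {A} {B} dA dB cross = begin
    length A * length B                    ≤⟨ *-mono-≤ (length-≤-! dA) (length-≤-! dB) ⟩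
    suc p * p ! * (suc p * p !)            ≡⟨ lemma (suc p) (p !) ⟩
    suc p * suc p * (p ! * p !)            ≤⟨ *-monoˡ-≤ (p ! * p !) (*-mono-≤ n≤n₀ n≤n₀) ⟩
    n₀ * n₀ * (p ! * p !)                  ≤⟨ *-monoˡ-≤ (p ! * p !) (m≤n+m (n₀ * n₀) 4) ⟩
    C * (p ! * p !)                        ∎
    where
    open ≤-Reasoning
    lemma : ∀ s x → s * x * (s * x) ≡ s * s * (x * x)
    lemma = solve-∀

  -- The constant does not grow along the induction. A product above C (n - 1)!² is compared with
  -- the bound C (n - 2)!² one level below, so C cancels and G = 1 suffices; concentration then
  -- bounds the product by 4 (n - 1)!², whatever C is.
  step : ∀ p′ → n₀ ≤ suc (suc p′) → Bound (suc p′) → Bound (suc (suc p′))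
  step p′ n₀≤n bound {A} {B} dA dB cross with ≤-total (length A * length B) (C * (suc p′ ! * suc p′ !))
  ... | inj₁ below = below
  ... | inj₂ above = begin
    length A * length B                            ≤⟨ *-mono-≤ (proj₁ Conc.majorities) (proj₂ Conc.majorities) ⟩
    2 * length (star Conc.i Conc.j A) * (2 * length (star Conc.i Conc.j B))
      ≤⟨ *-mono-≤ (*-monoʳ-≤ 2 (star-≤-! dA Conc.i Conc.j)) (*-monoʳ-≤ 2 (star-≤-! dB Conc.i Conc.j)) ⟩
    2 * p ! * (2 * p !)                            ≡⟨ lemma₁ (p !) ⟩
    4 * (p ! * p !)                                ≤⟨ *-monoˡ-≤ (p ! * p !) (m≤m+n 4 (n₀ * n₀)) ⟩
    C * (p ! * p !)                                ∎
    where
    open ≤-Reasoning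
    p : ℕ
    p = suc p′
    lemma₁ : ∀ x → 2 * x * (2 * x) ≡ 4 * (x * x)
    lemma₁ = solve-∀
    lemma₂ : ∀ p c f → p * p * (c * (f * f)) ≡ c * (p * f * (p * f))
    lemma₂ = solve-∀
    p!²≤ : p ! * p ! ≤ 1 * (length A * length B)
    p!²≤ = begin
      p ! * p !                    ≤⟨ m≤n*m (p ! * p !) C ⟩
      C * (p ! * p !)              ≤⟨ above ⟩
      length A * length B          ≡⟨ *-identityˡ _ ⟨
      1 * (length A * length B)    ∎
    p²W≤ : p * p * (C * (p′ ! * p′ !)) ≤ 1 * (length A * length B)
    p²W≤ = begin
      p * p * (C * (p′ ! * p′ !))  ≡⟨ lemma₂ p C (p′ !) ⟩
      C * (p ! * p !)              ≤⟨ above ⟩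
      length A * length B          ≡⟨ *-identityˡ _ ⟨
      1 * (length A * length B)    ∎
    module Conc = Concentration (C * (p′ ! * p′ !)) bound 1 1 (proj₂ (eventually-parameters 1 16 z<s) (suc p) n₀≤n)
      dA dB cross p!²≤ p²W≤

  induct : ∀ n → Bound n
  induct zero          dA dB cross = ≤-trans (*-mono-≤ (length-≤-! dA) (length-≤-! dB)) (m≤m+n 1 _)
  induct 1             dA dB cross = ≤-trans (*-mono-≤ (length-≤-! dA) (length-≤-! dB)) (m≤m+n 1 _)
  induct (suc (suc p)) = [ small (suc p) , (λ n₀≤n → step p n₀≤n (induct (suc p))) ]′ (≤-total (suc (suc p)) n₀)

offStar-≤-! : ∀ {L : List (Permutation′ n)} → Distinct L → ∀ i j → length (offStar i j L) ≤ n !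
offStar-≤-! {L = L} d i j = ≤-trans (length-filter (λ σ → ¬? (σ ⟨$⟩ʳ i ≟ j)) L) (length-≤-! d)

stability : ∀ D → 0 < D → ∃[ K ] ∀ n {A B : List (Permutation′ n)} → Distinct A → Distinct B → Cross A B →
  (n ∸ 1) ! * (n ∸ 1) ! ≤ D * (length A * length B) →
  ∃[ i ] ∃[ j ] length (offStar i j A) ≤ K * (n ∸ 2) ! × length (offStar i j B) ≤ K * (n ∸ 2) !
stability D 0<D = K , conclude
  where
  open ≤-Reasoning
  C n₀ K : ℕ
  C = proj₁ product-bound
  -- Now C is fixed and the threshold may depend on it: the hypothesis gives p² W = C p!² ≤ C D
  -- |A||B|, so G = C D.
  n₀ = proj₁ (eventually-parameters D (16 * (C * D)) 0<D)
  -- One summand for each range: n = 1, where 1 suffices; 2 ≤ n ≤ n₀, where n! ≤ n₀² (n - 2)!; and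
  -- large n, from `minority-bound`.
  K = 1 + n₀ * n₀ + 8 * D * C

  1≤K : 1 ≤ K
  1≤K = m≤m+n 1 _

  Conclusion : ∀ n → List (Permutation′ n) → List (Permutation′ n) → Set
  Conclusion n A B = ∃[ i ] ∃[ j ] length (offStar i j A) ≤ K * (n ∸ 2) ! × length (offStar i j B) ≤ K * (n ∸ 2) !

  small : ∀ p → suc (suc p) ≤ n₀ → suc (suc p) ! ≤ K * p !
  small p n≤n₀ = begin
    suc (suc p) * (suc p * p !)    ≡⟨ *-assoc (suc (suc p)) (suc p) (p !) ⟨
    suc (suc p) * suc p * p !      ≤⟨ *-monoˡ-≤ (p !) (*-mono-≤ n≤n₀ (≤-trans (n≤1+n (suc p)) n≤n₀)) ⟩
    n₀ * n₀ * p !                  ≤⟨ *-monoˡ-≤ (p !) (≤-trans (n≤1+n (n₀ * n₀)) (m≤m+n (1 + n₀ * n₀) (8 * D * C))) ⟩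
    K * p !                        ∎

  module Large (p′ : ℕ) (n₀≤n : n₀ ≤ suc (suc p′)) {A B : List (Permutation′ (suc (suc p′)))}
               (dA : Distinct A) (dB : Distinct B) (cross : Cross A B)
               (h : suc p′ ! * suc p′ ! ≤ D * (length A * length B)) where
    p : ℕ
    p = suc p′
    lemma : ∀ p c f → p * p * (c * (f * f)) ≡ c * (p * f * (p * f))
    lemma = solve-∀
    p²W≤ : p * p * (C * (p′ ! * p′ !)) ≤ C * D * (length A * length B)
    p²W≤ = begin
      p * p * (C * (p′ ! * p′ !))        ≡⟨ lemma p C (p′ !) ⟩
      C * (p ! * p !)                    ≤⟨ *-monoʳ-≤ C h ⟩
      C * (D * (length A * length B))    ≡⟨ *-assoc C D _ ⟨
      C * D * (length A * length B)      ∎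
    module Conc = Concentration (C * (p′ ! * p′ !)) (proj₂ product-bound p) D (C * D)
      (proj₂ (eventually-parameters D (16 * (C * D)) 0<D) (suc p) n₀≤n) dA dB cross h p²W≤
    open Conc using (i; j)
    A≤ : length A ≤ 2 * (p * p′ !)
    A≤ = ≤-trans (proj₁ Conc.majorities) (*-monoʳ-≤ 2 (star-≤-! dA i j))
    B≤ : length B ≤ 2 * (p * p′ !)
    B≤ = ≤-trans (proj₂ Conc.majorities) (*-monoʳ-≤ 2 (star-≤-! dB i j))
    h′ : p * p′ ! * (p * p′ !) ≤ D * (length B * length A)
    h′ = ≤-trans h (≤-reflexive (cong (D *_) (*-comm (length A) (length B))))
    ≤K : 8 * D * C * p′ ! ≤ K * p′ !
    ≤K = *-monoˡ-≤ (p′ !) (m≤n+m (8 * D * C) (1 + n₀ * n₀))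
    conclusion : Conclusion (suc (suc p′)) A B
    conclusion = i , j
      , ≤-trans (minority-bound (length B) (length (star i j B)) (length (offStar i j A)) (length A) p (p′ !) C D {{_}} {{p′ !≢0}}
                  h′ A≤ (proj₂ Conc.majorities) Conc.offA) ≤K
      , ≤-trans (minority-bound (length A) (length (star i j A)) (length (offStar i j B)) (length B) p (p′ !) C D {{_}} {{p′ !≢0}}
                  h B≤ (proj₁ Conc.majorities) Conc.offB) ≤K

  conclude : ∀ n {A B : List (Permutation′ n)} → Distinct A → Distinct B → Cross A B →
    (n ∸ 1) ! * (n ∸ 1) ! ≤ D * (length A * length B) → Conclusion n A B
  -- For n = 0 no point i exists, so the hypotheses must clash: an empty family makes the product 0,
  -- below 0!² = 1, and two nonempty families would agree at a point of `Fin 0`.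
  conclude zero {[]}    {B}     dA dB cross h = contradiction (subst (1 ≤_) (*-zeroʳ D) h) λ ()
  conclude zero {A@(_ ∷ _)} {[]} dA dB cross h = contradiction (subst (1 ≤_) (trans (cong (D *_) (*-zeroʳ (length A))) (*-zeroʳ D)) h) λ ()
  conclude zero {_ ∷ _} {_ ∷ _} dA dB cross h with () ← proj₁ (cross (here refl) (here refl))
  conclude 1 dA dB cross h = zero , zero , bound dA , bound dB
    where
    bound : ∀ {L : List (Permutation′ 1)} → Distinct L → length (offStar zero zero L) ≤ K * 1
    bound d = ≤-trans (offStar-≤-! d zero zero) (≤-trans 1≤K (≤-reflexive (sym (*-identityʳ K))))
  conclude (suc (suc p)) dA dB cross h with ≤-total (suc (suc p)) n₀
  ... | inj₁ n≤n₀ = zero , zero , ≤-trans (offStar-≤-! dA zero zero) (small p n≤n₀) , ≤-trans (offStar-≤-! dB zero zero) (small p n≤n₀)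
  ... | inj₂ n₀≤n = Large.conclusion p n₀≤n dA dB cross h

-- Real numbers

open ℝ

ℕ→ℚ-mkℚ : ∀ m → ℕ→ℚ m ≡ mkℚ (ℤ.+ m) 0 (Coprimality.sym (1-coprimeTo m))
ℕ→ℚ-mkℚ m = ℚ.↥p/↧p≡p (mkℚ (ℤ.+ m) 0 (Coprimality.sym (1-coprimeTo m)))

ℕ→ℚ-* : ∀ m n → ℕ→ℚ m ℚ.* ℕ→ℚ n ≡ ℕ→ℚ (m ℕ.* n)
ℕ→ℚ-* m n = trans (cong₂ ℚ._*_ (ℕ→ℚ-mkℚ m) (ℕ→ℚ-mkℚ n)) (cong (ℚ._/ 1) (sym (ℤ.pos-* m n)))

ℕ→ℚ-mono-≤ : ∀ {m n} → m ℕ.≤ n → ℕ→ℚ m ℚ.≤ ℕ→ℚ n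
ℕ→ℚ-mono-≤ {m} {n} m≤n = subst₂ ℚ._≤_ (sym (ℕ→ℚ-mkℚ m)) (sym (ℕ→ℚ-mkℚ n)) (ℚ.*≤* (ℤ.*-monoʳ-≤-nonNeg (ℤ.+ 1) (ℤ.+≤+ m≤n)))

ℕ→ℚ-cancel-≤ : ∀ {m n} → ℕ→ℚ m ℚ.≤ ℕ→ℚ n → m ℕ.≤ n
ℕ→ℚ-cancel-≤ {m} {n} h with ℚ.*≤* h′ ← subst₂ ℚ._≤_ (ℕ→ℚ-mkℚ m) (ℕ→ℚ-mkℚ n) h =
  ℤ.drop‿+≤+ (ℤ.*-cancelʳ-≤-pos (ℤ.+ m) (ℤ.+ n) (ℤ.+ 1) h′)

0<ℕ→ℚ : ∀ m .{{_ : ℕ.NonZero m}} → 0ℚ ℚ.< ℕ→ℚ m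
0<ℕ→ℚ m = ℚ.positive⁻¹ (ℕ→ℚ m) {{ℚ.normalize-pos m 1}}

1≤q*↧ₙq : ∀ q → 0ℚ ℚ.< q → 1ℚ ℚ.≤ q ℚ.* ℕ→ℚ (↧ₙ q)
1≤q*↧ₙq q@(mkℚ n d-1 c) 0<q = ℚ.toℚᵘ-cancel-≤ (ℚᵘ.≤-trans (lemma n (ℚ.positive 0<q)) (ℚᵘ.≤-reflexive (ℚᵘ.≃-sym
  (ℚᵘ.≃-trans (ℚ.toℚᵘ-homo-* q (ℕ→ℚ (↧ₙ q))) (ℚᵘ.≃-reflexive (cong (λ x → ℚ.toℚᵘ q ℚᵘ.* ℚ.toℚᵘ x) (ℕ→ℚ-mkℚ (↧ₙ q))))))))
  where
  lemma : ∀ n → ℤ.Positive n → ℚᵘ.1ℚᵘ ℚᵘ.≤ mkℚᵘ n d-1 ℚᵘ.* mkℚᵘ (ℤ.+ suc d-1) 0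
  lemma ℤ.+[1+ n ] _ = ℚᵘ.*≤* (ℤ.+≤+ (ℕ.≤-trans (ℕ.≤-reflexive (trans (ℕ.*-identityˡ _) (ℕ.*-comm (suc d-1) 1)))
    (ℕ.≤-trans (ℕ.*-monoˡ-≤ (suc d-1) (ℕ.s≤s (ℕ.z≤n {n}))) (ℕ.≤-reflexive (sym (ℕ.*-identityʳ _))))))

p*r÷r≡p : ∀ p r .{{_ : ℚ.NonZero r}} → (p ℚ.* r) ÷ r ≡ p
p*r÷r≡p p r = trans (ℚ.*-assoc p r (1/ r)) (trans (cong (p ℚ.*_) (ℚ.*-inverseʳ r)) (ℚ.*-identityʳ p))

p<q*r⇒p÷r<q : ∀ {p q} r {{_ : ℚ.Positive r}} → p ℚ.< q ℚ.* r → (p ÷ r) {{ℚ.pos⇒nonZero r}} ℚ.< q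
p<q*r⇒p÷r<q {p} {q} r h = subst ((p ÷ r) {{ℚ.pos⇒nonZero r}} ℚ.<_) (p*r÷r≡p q r {{ℚ.pos⇒nonZero r}})
  (ℚ.*-monoˡ-<-pos ((1/ r) {{ℚ.pos⇒nonZero r}}) {{ℚ.1/pos⇒pos r}} h)

≤ᵣ-·! : ∀ {x} K m → x ℕ.≤ K ℕ.* m ℕ.! → ℕ→ℝ x ≤ᵣ ℕ→ℝ K ·! m
≤ᵣ-·! {x} K m h q<x = p<q*r⇒p÷r<q (ℕ→ℚ (m ℕ.!)) {{ℚ.normalize-pos (m ℕ.!) 1 {{_}} {{m !≢0}}}}
  (ℚ.<-≤-trans q<x (ℚ.≤-trans (ℕ→ℚ-mono-≤ h) (ℚ.≤-reflexive (sym (ℕ→ℚ-* K (m ℕ.!))))))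

-- For 0 < q < c the square of q k! is at most m; clear the denominator of q.
√-lower : ∀ (c : ℝ) q → 0ℚ ℚ.< q → Lower c q → ∀ k m → c ·! k ≤ᵣ √ m →
  k ℕ.! ℕ.* k ℕ.! ℕ.≤ ↧ₙ q ℕ.* ↧ₙ q ℕ.* m
√-lower c q 0<q q<c k m h = bound (h {q ℚ.* r} (subst (Lower c) (sym (p*r÷r≡p q r)) q<c))
  where
  r d : ℚ
  r = ℕ→ℚ (k ℕ.!)
  d = ℕ→ℚ (↧ₙ q)
  instance
    r-pos : ℚ.Positive r
    r-pos = ℚ.normalize-pos (k ℕ.!) 1 {{_}} {{k !≢0}}
    r-nonZero : ℚ.NonZero r
    r-nonZero = ℚ.pos⇒nonZero r
    r-nonNeg : ℚ.NonNegative r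
    r-nonNeg = ℚ.pos⇒nonNeg r
    d-pos : ℚ.Positive d
    d-pos = ℚ.normalize-pos (↧ₙ q) 1
    d-nonNeg : ℚ.NonNegative d
    d-nonNeg = ℚ.pos⇒nonNeg d
  bound : (∃[ s ] q ℚ.* r ℚ.< s × s ℚ.* s ℚ.≤ ℕ→ℚ m) → k ℕ.! ℕ.* k ℕ.! ℕ.≤ ↧ₙ q ℕ.* ↧ₙ q ℕ.* m
  bound (s , qr<s , s²≤m) = ℕ→ℚ-cancel-≤ (begin
    ℕ→ℚ (k ℕ.! ℕ.* k ℕ.!)        ≡⟨ ℕ→ℚ-* (k ℕ.!) (k ℕ.!) ⟨
    r ℚ.* r                      ≤⟨ ℚ.*-monoˡ-≤-nonNeg r r≤ds ⟩
    r ℚ.* (d ℚ.* s)              ≤⟨ ℚ.*-monoʳ-≤-nonNeg (d ℚ.* s) {{ds-nonNeg}} r≤ds ⟩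
    (d ℚ.* s) ℚ.* (d ℚ.* s)      ≡⟨ lemma d s ⟩
    (d ℚ.* d) ℚ.* (s ℚ.* s)      ≤⟨ ℚ.*-monoˡ-≤-nonNeg (d ℚ.* d) {{ℚ.nonNeg*nonNeg⇒nonNeg d d}} s²≤m ⟩
    (d ℚ.* d) ℚ.* ℕ→ℚ m          ≡⟨ cong (ℚ._* ℕ→ℚ m) (ℕ→ℚ-* (↧ₙ q) (↧ₙ q)) ⟩
    ℕ→ℚ (↧ₙ q ℕ.* ↧ₙ q) ℚ.* ℕ→ℚ m ≡⟨ ℕ→ℚ-* (↧ₙ q ℕ.* ↧ₙ q) m ⟩
    ℕ→ℚ (↧ₙ q ℕ.* ↧ₙ q ℕ.* m)    ∎)
    where
    open ℚ.≤-Reasoning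
    lemma : ∀ d s → (d ℚ.* s) ℚ.* (d ℚ.* s) ≡ (d ℚ.* d) ℚ.* (s ℚ.* s)
    lemma d s = trans (ℚ.*-assoc d s (d ℚ.* s)) (trans (cong (d ℚ.*_) (trans (sym (ℚ.*-assoc s d s))
      (trans (cong (ℚ._* s) (ℚ.*-comm s d)) (ℚ.*-assoc d s s)))) (sym (ℚ.*-assoc d d (s ℚ.* s))))
    r≤ds : r ℚ.≤ d ℚ.* s
    r≤ds = begin
      r                     ≡⟨ ℚ.*-identityˡ r ⟨
      1ℚ ℚ.* r              ≤⟨ ℚ.*-monoʳ-≤-nonNeg r (1≤q*↧ₙq q 0<q) ⟩
      (q ℚ.* d) ℚ.* r       ≡⟨ cong (ℚ._* r) (ℚ.*-comm q d) ⟩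
      (d ℚ.* q) ℚ.* r       ≡⟨ ℚ.*-assoc d q r ⟩
      d ℚ.* (q ℚ.* r)       ≤⟨ ℚ.*-monoˡ-≤-nonNeg d (ℚ.<⇒≤ qr<s) ⟩
      d ℚ.* s               ∎
    ds-nonNeg : ℚ.NonNegative (d ℚ.* s)
    ds-nonNeg = ℚ.nonNegative (ℚ.≤-trans (ℚ.nonNegative⁻¹ r) r≤ds)

theorem8 : ∀ (c : ℝ) → 0ℝ <ᵣ c →
    ∃[ K ] (0ℝ <ᵣ K ×
    (∀ (n : ℕ) (𝒜 ℬ : Family n) → CrossIntersecting 𝒜 ℬ →
    c ·! (n ∸ 1) ≤ᵣ √ (∣ 𝒜 ∣ * ∣ ℬ ∣) →
    ∃[ i ] ∃[ j ]
    (ℕ→ℝ ∣ 𝒜 ∣[ i ↛ j ] ≤ᵣ K ·! (n ∸ 2) ×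
    ℕ→ℝ ∣ ℬ ∣[ i ↛ j ] ≤ᵣ K ·! (n ∸ 2))))
-- The witness of 0 < c is a rational q strictly between. Using `suc K` makes the real constant
-- positive.
theorem8 c (q , 0<q , q<c) = ℕ→ℝ (suc K) , ℚ.<-dense (0<ℕ→ℚ (suc K)) , λ n 𝒜 ℬ cross h →
  let (i , j , hA , hB) = proj₂ stable n (Family.unique 𝒜) (Family.unique ℬ)
        (λ {σ} {τ} σ∈ τ∈ → cross σ τ (Any.map (λ { refl _ → refl }) σ∈) (Any.map (λ { refl _ → refl }) τ∈))
        (√-lower c q 0<q q<c (n ∸ 1) (∣ 𝒜 ∣ * ∣ ℬ ∣) h)
  in i , j , ≤ᵣ-·! (suc K) (n ∸ 2) (≤-trans hA (m≤n+m _ ((n ∸ 2) !))) , ≤ᵣ-·! (suc K) (n ∸ 2) (≤-trans hB (m≤n+m _ ((n ∸ 2) !)))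
  where
  -- The numerator of q is at least 1, so q ≥ 1 / `↧ₙ q`, and after squaring D is the square of this
  -- denominator.
  stable = stability (↧ₙ q * ↧ₙ q) (>-nonZero⁻¹ (↧ₙ q * ↧ₙ q))
  K = proj₁ stable
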